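{- There is a deterministic algorithm that, given a set $S$ of $n$ permutations over $[d]$ and the number $k$ of medians, finds a $1.999$-approximate $k$-median of $S$ under the Ulam metric in time $n^{O(k)}d\log d+O(n^5d^3)$.
   Context: $[d]=\{1,\dots,d\}$ and $\mathcal{S}_d$ is the set of all permutations of $[d]$, viewed as sequences of length $d$. The Ulam distance $\Delta(x,y)$ between $x,y\in\mathcal{S}_d$ is the minimum number of character-move operations (pick up one symbol and reinsert it at another position) transforming $x$ into $y$; equivalently $\Delta(x,y)=d-|\mathrm{LCS}(x,y)|$, where $\mathrm{LCS}(x,y)$ is a longest common subsequence. For $Y\subseteq\mathcal{S}_d$ let $\Delta(x,Y)=\min_{y\in Y}\Delta(x,y)$, and for $S\subseteq\mathcal{S}_d$ let $\mathrm{Obj}(S,Y)=\sum_{x\in S}\Delta(x,Y)$. The $k$-median problem: given $S$, find a set $Y\subseteq\mathcal{S}_d$ (not necessarily contained in $S$) with $|Y|\le k$ minimizing $\mathrm{Obj}(S,Y)$; the minimum value is $\mathrm{OPT}(S)$. A set $\tilde Y\subseteq\mathcal{S}_d$ with $|\tilde Y|\le k$ is a $c$-approximate $k$-median of $S$ if $\mathrm{Obj}(S,\tilde Y)\le c\cdot\mathrm{OPT}(S)$. -}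

module Defs where

open import Data.Bool using (if_then_else_)
open import Data.Fin using (Fin; zero; suc; toℕ; punchOut)
import Data.Fin.Properties as Fin
open import Data.Fin.Permutation using (Permutation′; _⟨$⟩ʳ_; _⟨$⟩ˡ_; _≈_; inverseˡ; inverseʳ)
open import Data.Integer using (+_)
open import Data.List using (List; []; _∷_)
open import Data.Nat using (ℕ; zero; suc; _+_; _*_; _∸_; _^_; _/_; _%_; _⊓_; _≤_; z≤n; s≤s; _≡ᵇ_; _<ᵇ_; NonZero)
open import Data.Nat.Properties using (m^n≢0; _≟_)
open import Data.Product using (Σ; ∃; ∃-syntax; _×_; _,_; proj₁; proj₂)
open import Data.Rational as ℚ using (ℚ)
open import Data.Vec as Vec using (Vec; []; _∷_; lookup; tabulate; insertAt; removeAt; toList)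
open import Data.Vec.Properties using (≡-dec; lookup∘tabulate; removeAt-punchOut)
open import Data.Vec.Relation.Unary.AllPairs using (AllPairs)
open import Function using (_∘_)
open import Relation.Binary.PropositionalEquality using (_≡_; _≢_; refl; sym; trans; cong; subst; module ≡-Reasoning)
open import Relation.Nullary using (¬_; Dec; yes; no; contradiction)

------------------------------------------------------------------------
-- The Ulam metric

-- Symbols are 0, …, d-1 rather than 1, …, d.
oneLine : ∀ {d} → Permutation′ d → Vec (Fin d) d
oneLine σ = tabulate (σ ⟨$⟩ʳ_)

moveTo : ∀ {A : Set} {d} → Fin d → Fin d → Vec A d → Vec A d
moveTo {d = suc _} i j x = insertAt (removeAt x i) j (lookup x i)

-- Exactly m moves lead from x to y.
Moves : ∀ {A : Set} {d} → ℕ → Vec A d → Vec A d → Set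
Moves zero    x y = x ≡ y
Moves (suc m) x y = ∃[ i ] ∃[ j ] Moves m (moveTo i j x) y

moves? : ∀ {d} m (x y : Vec (Fin d) d) → Dec (Moves m x y)
moves? zero    x y = ≡-dec Fin._≟_ x y
moves? (suc m) x y = Fin.any? λ i → Fin.any? λ j → moves? m (moveTo i j x) y

-- The least m ≤ b with P m, or b if there is none.
least : ∀ {P : ℕ → Set} → (∀ m → Dec (P m)) → ℕ → ℕ
least P? zero    = zero
least P? (suc b) with P? zero
... | yes _ = zero
... | no  _ = suc (least (P? ∘ suc) b)

-- The search bound d is harmless: see Δ-reached and Δ-minimal.
Δ : ∀ {d} → Permutation′ d → Permutation′ d → ℕ
Δ {d} σ τ = least (λ m → moves? m (oneLine σ) (oneLine τ)) d

least-reached : ∀ {P : ℕ → Set} (P? : ∀ m → Dec (P m)) b → P b → P (least P? b)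
least-reached P? zero    p = p
least-reached P? (suc b) p with P? zero
... | yes q = q
... | no  _ = least-reached (P? ∘ suc) b p

least-minimal : ∀ {P : ℕ → Set} (P? : ∀ m → Dec (P m)) b {m} → P m → least P? b ≤ m
least-minimal P? zero    p = z≤n
least-minimal P? (suc b) p with P? zero
least-minimal P? (suc b) p             | yes _ = z≤n
least-minimal P? (suc b) {zero}  p     | no ¬q = contradiction p ¬q
least-minimal P? (suc b) {suc m} p     | no _  = s≤s (least-minimal (P? ∘ suc) b p)

moveTo-∷ : ∀ {A : Set} {d} (c : A) (i j : Fin d) (x : Vec A d) →
           moveTo (suc i) (suc j) (c ∷ x) ≡ c ∷ moveTo i j x
moveTo-∷ c i j (_ ∷ _) = refl

Moves-∷ : ∀ {A : Set} {d} (c : A) m {x y : Vec A d} → Moves m x y → Moves m (c ∷ x) (c ∷ y)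
Moves-∷ c zero    refl                = refl
Moves-∷ c (suc m) {x} {y} (i , j , p) =
  suc i , suc j , subst (λ z → Moves m z (c ∷ y)) (sym (moveTo-∷ c i j x)) (Moves-∷ c m p)

moves-suffice : ∀ {A : Set} {d} (x y : Vec A d) →
                (∀ {i j} → lookup y i ≡ lookup y j → i ≡ j) →
                (∀ j → ∃[ i ] lookup x i ≡ lookup y j) →
                Moves d x y
moves-suffice {d = zero}  []        []      _   _   = refl
moves-suffice {d = suc d} x (c ∷ y) inj cov with cov zero
... | i , refl = i , zero , Moves-∷ _ d
    (moves-suffice (removeAt x i) y (Fin.suc-injective ∘ inj) cov′)
  where
  cov′ : ∀ j → ∃[ i′ ] lookup (removeAt x i) i′ ≡ lookup y j
  cov′ j with cov (suc j)
  ... | i′ , eq = punchOut i≢i′ , trans (removeAt-punchOut x i≢i′) eq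
    where
    i≢i′ : i ≢ i′
    i≢i′ refl = contradiction (inj {zero} {suc j} eq) λ ()

Δ-reached : ∀ {d} (σ τ : Permutation′ d) → Moves (Δ σ τ) (oneLine σ) (oneLine τ)
Δ-reached {d} σ τ = least-reached (λ m → moves? m (oneLine σ) (oneLine τ)) d
  (moves-suffice (oneLine σ) (oneLine τ) inj cov)
  where
  open ≡-Reasoning
  inj : ∀ {i j} → lookup (oneLine τ) i ≡ lookup (oneLine τ) j → i ≡ j
  inj {i} {j} eq = begin
    i                        ≡⟨ sym (inverseˡ τ) ⟩
    τ ⟨$⟩ˡ (τ ⟨$⟩ʳ i)        ≡⟨ cong (τ ⟨$⟩ˡ_) (trans (sym (lookup∘tabulate (τ ⟨$⟩ʳ_) i)) (trans eq (lookup∘tabulate (τ ⟨$⟩ʳ_) j))) ⟩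
    τ ⟨$⟩ˡ (τ ⟨$⟩ʳ j)        ≡⟨ inverseˡ τ ⟩
    j                        ∎
  cov : ∀ j → ∃[ i ] lookup (oneLine σ) i ≡ lookup (oneLine τ) j
  cov j = σ ⟨$⟩ˡ lookup (oneLine τ) j ,
          trans (lookup∘tabulate (σ ⟨$⟩ʳ_) _) (inverseʳ σ)

Δ-minimal : ∀ {d} (σ τ : Permutation′ d) {m} → Moves m (oneLine σ) (oneLine τ) → Δ σ τ ≤ m
Δ-minimal {d} σ τ = least-minimal (λ m → moves? m (oneLine σ) (oneLine τ)) d

------------------------------------------------------------------------
-- The k-median problem

Distinct : ∀ {d n} → Vec (Permutation′ d) n → Set
Distinct = AllPairs (λ σ τ → ¬ σ ≈ τ)

-- A set of medians is a nonempty vector, possibly with repetitions: the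
-- vectors of length at most k enumerate exactly the nonempty sets of
-- cardinality at most k.
dist : ∀ {d m} → Permutation′ d → Vec (Permutation′ d) (suc m) → ℕ
dist x Y = Vec.foldr₁ _⊓_ (Vec.map (Δ x) Y)

Obj : ∀ {d n m} → Vec (Permutation′ d) n → Vec (Permutation′ d) (suc m) → ℕ
Obj S Y = Vec.sum (Vec.map (λ x → dist x Y) S)

IsOPT : ∀ {d n} → Vec (Permutation′ d) n → ℕ → ℕ → Set
IsOPT {d} S k v =
  (∃[ m ] Σ (Vec (Permutation′ d) (suc m)) λ Y → suc m ≤ k × Obj S Y ≡ v) ×
  (∀ m (Y : Vec (Permutation′ d) (suc m)) → suc m ≤ k → v ≤ Obj S Y)

IsApproxMedian : ∀ {d n m} → ℚ → Vec (Permutation′ d) n → ℕ → Vec (Permutation′ d) (suc m) → Set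
IsApproxMedian {m = m} c S k Y =
  suc m ≤ k ×
  (∃[ v ] IsOPT S k v × (+ Obj S Y ℚ./ 1) ℚ.≤ c ℚ.* (+ v ℚ./ 1))

------------------------------------------------------------------------
-- Deterministic algorithms: structured programs for the word RAM with w-bit
-- words.  Every operation on words takes unit time; a program is a fixed
-- finite object, independent of the input and of w.

data Op : Set where
  add sub mul div mod lt eq : Op

data Expr : Set where
  lit  : ℕ → Expr
  reg  : ℕ → Expr
  load : Expr → Expr
  op   : Op → Expr → Expr → Expr

infixr 5 _⨾_

data Prog : Set where
  skip    : Prog
  _≔_     : ℕ → Expr → Prog
  store   : Expr → Expr → Prog
  _⨾_     : Prog → Prog → Prog
  ifz     : Expr → Prog → Prog → Prog
  whilenz : Expr → Prog → Prog

record Store : Set where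
  constructor mkStore
  field
    regs : ℕ → ℕ
    mem  : ℕ → ℕ

open Store public

_[_↦_] : (ℕ → ℕ) → ℕ → ℕ → ℕ → ℕ
(f [ a ↦ v ]) b = if a ≡ᵇ b then v else f b

setReg setMem : ℕ → ℕ → Store → Store
setReg r v s = record s { regs = regs s [ r ↦ v ] }
setMem a v s = record s { mem  = mem  s [ a ↦ v ] }

-- sub truncates at 0, and a zero divisor gives 0.
apply : Op → ℕ → ℕ → ℕ
apply add a b       = a + b
apply sub a b       = a ∸ b
apply mul a b       = a * b
apply div a zero    = 0
apply div a (suc b) = a / suc b
apply mod a zero    = 0
apply mod a (suc b) = a % suc b
apply lt  a b       = if a <ᵇ b then 1 else 0
apply eq  a b       = if a ≡ᵇ b then 1 else 0

wrap : ℕ → ℕ → ℕ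
wrap w a = (a % (2 ^ w)) {{m^n≢0 2 w}}

eval : ℕ → Store → Expr → ℕ
eval w s (lit a)    = wrap w a
eval w s (reg r)    = regs s r
eval w s (load e)   = mem s (eval w s e)
eval w s (op o e f) = wrap w (apply o (eval w s e) (eval w s f))

cost : Expr → ℕ
cost (lit _)    = 1
cost (reg _)    = 1
cost (load e)   = 1 + cost e
cost (op _ e f) = 1 + cost e + cost f

-- Run w P s t s′: on w-bit words, P started in s halts in s′ after t steps.
data Run (w : ℕ) : Prog → Store → ℕ → Store → Set where
  skip : ∀ {s} → Run w skip s 1 s
  assign : ∀ {r e s} → Run w (r ≔ e) s (1 + cost e) (setReg r (eval w s e) s)
  store : ∀ {e f s} →
    Run w (store e f) s (1 + cost e + cost f) (setMem (eval w s e) (eval w s f) s)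
  seq : ∀ {P Q s s′ s″ t t′} →
    Run w P s t s′ → Run w Q s′ t′ s″ → Run w (P ⨾ Q) s (t + t′) s″
  if-zero : ∀ {e P Q s s′ t} → eval w s e ≡ 0 →
    Run w P s t s′ → Run w (ifz e P Q) s (1 + cost e + t) s′
  if-nonzero : ∀ {e P Q s s′ t} → eval w s e ≢ 0 →
    Run w Q s t s′ → Run w (ifz e P Q) s (1 + cost e + t) s′
  while-zero : ∀ {e P s} → eval w s e ≡ 0 →
    Run w (whilenz e P) s (1 + cost e) s
  while-nonzero : ∀ {e P s s′ s″ t t′} → eval w s e ≢ 0 →
    Run w P s t s′ → Run w (whilenz e P) s′ t′ s″ →
    Run w (whilenz e P) s (1 + cost e + t + t′) s″

Run-deterministic : ∀ {w P s t t′ s′ s″} →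
                    Run w P s t s′ → Run w P s t′ s″ → t ≡ t′ × s′ ≡ s″
Run-deterministic skip skip = refl , refl
Run-deterministic assign assign = refl , refl
Run-deterministic store store = refl , refl
Run-deterministic (seq p q) (seq p′ q′) with Run-deterministic p p′
... | refl , refl with Run-deterministic q q′
... | refl , refl = refl , refl
Run-deterministic (if-zero _ p) (if-zero _ p′) with Run-deterministic p p′
... | refl , refl = refl , refl
Run-deterministic (if-zero z _) (if-nonzero nz _) = contradiction z nz
Run-deterministic (if-nonzero nz _) (if-zero z _) = contradiction z nz
Run-deterministic (if-nonzero _ p) (if-nonzero _ p′) with Run-deterministic p p′
... | refl , refl = refl , refl
Run-deterministic (while-zero _) (while-zero _) = refl , refl
Run-deterministic (while-zero z) (while-nonzero nz _ _) = contradiction z nz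
Run-deterministic (while-nonzero nz _ _) (while-zero z) = contradiction z nz
Run-deterministic (while-nonzero _ p q) (while-nonzero _ p′ q′) with Run-deterministic p p′
... | refl , refl with Run-deterministic q q′
... | refl , refl = refl , refl

------------------------------------------------------------------------
-- Input and output conventions

-- The sequences one after the other, one word per symbol.
symbols : ∀ {d n} → Vec (Permutation′ d) n → Vec ℕ (n * d)
symbols S = Vec.concat (Vec.map (Vec.map toℕ ∘ oneLine) S)

wordAt : List ℕ → ℕ → ℕ
wordAt []       _       = 0
wordAt (a ∷ as) zero    = a
wordAt (a ∷ as) (suc i) = wordAt as i

-- Registers 0, 1, 2 contain n, d, k; the symbols of S fill the memory from
-- address 0; everything else is 0.
input : ∀ {d n} → Vec (Permutation′ d) n → ℕ → Store
input {d} {n} S k = mkStore (wordAt (n ∷ d ∷ k ∷ [])) (wordAt (toList (symbols S)))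

-- Register 0 contains |Y|; register 1 contains the address from which the
-- symbols of Y are stored.
Outputs : ∀ {d m} → Store → Vec (Permutation′ d) m → Set
Outputs {d} {m} s Y =
  regs s 0 ≡ m ×
  (∀ (i : Fin (m * d)) → mem s (regs s 1 + toℕ i) ≡ lookup (symbols Y) i)

{-# OPTIONS --safe #-}

-- Let x₁, x₂, … be the permutations of one cluster and y its centre.  Outside a set I_x of
-- Δ(x, y) symbols, x and y agree on the order of the symbols.  If the sets I_x overlap much on
-- average, then Δ(x, x′) ≤ |I_x ∪ I_x′| is on average noticeably less than Δ(x, y) + Δ(x′, y),
-- so some x′ is a good median.  If they overlap little, there are five permutations such that
-- few symbols, the bad ones, lie in two of their sets.  Two other symbols are ordered as in y by
-- at least three of the five, so every cycle of length three in the majority tournament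
-- contains a bad symbol.  Deleting disjoint such cycles greedily leaves a transitive tournament,
-- whose order, followed by the deleted symbols, is a permutation close to y.  A constant tuple
-- yields its own entry, so the n⁵ tuples give enough candidates, and the algorithm tries all
-- k-tuples of candidates.
--
-- The distances are computed by longest increasing subsequences in quadratic time; this is
-- affordable because n⁶ d² ≤ n⁵ d³ + n⁷ d.  The program only fills tables, cell after cell; a
-- table is correct if each of its cells is, given the earlier ones, and the stored values are
-- polynomial in n + d + k, so that no operation overflows.
module Submission where

open import Defs
open import Data.Bool using (Bool; true; false; if_then_else_; not; _∨_; T)
open import Data.Bool.Properties using (not-involutive; ∨-comm)
open import Data.Empty using (⊥; ⊥-elim)
open import Data.Fin as Fin using (Fin; zero; suc; toℕ; punchIn; punchOut)
import Data.Fin.Properties as Fin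
open import Data.Fin.Permutation as Perm using (Permutation′; _⟨$⟩ʳ_; _⟨$⟩ˡ_; _≈_; inverseˡ; inverseʳ; permutation; insert; remove; insert-punchIn; insert-remove)
import Data.Integer as ℤ
import Data.Integer.Properties as ℤ
open import Data.List using (List; []; _∷_; length)
open import Data.List.Membership.Propositional using (_∉_)
open import Data.List.Relation.Unary.Any using (here; there)
import Data.Nat as ℕ
open import Data.Nat hiding (_/_)
open import Data.Nat.Divisibility using (divides-refl)
open import Data.Nat.DivMod using (m/n≤m; m%n≤m; m%n<n; m<n⇒m%n≡m; m<n⇒m/n≡0; m*n/n≡m; m<n*o⇒m/o<n; m≡m%n+[m/n]*n; [m+kn]%n≡m%n; +-distrib-/-∣ʳ)
open import Data.Nat.Logarithm using (⌈log₂_⌉; ⌈log₂⌉-mono-≤; ⌈log₂2^n⌉≡n)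
open import Data.Nat.Properties
open import Data.Nat.Tactic.RingSolver using (solve-∀)
open import Data.Product using (Σ; ∃; ∃-syntax; _×_; _,_; proj₁; proj₂)
import Data.Rational as ℚ
import Data.Rational.Properties as ℚ
import Data.Rational.Unnormalised as ℚᵘ
import Data.Rational.Unnormalised.Properties as ℚᵘ
open import Data.Sum using (_⊎_; inj₁; inj₂)
open import Data.Vec as Vec using (Vec; []; _∷_; lookup; insertAt; removeAt; tabulate; toList)
open import Data.Vec.Properties using (insertAt-lookup; insertAt-punchIn; removeAt-punchOut; removeAt-insertAt; insertAt-removeAt; tabulate-cong; lookup∘tabulate; lookup-map)
open import Data.Vec.Relation.Binary.Pointwise.Inductive as Pointwise using (Pointwise; []; _∷_)
open import Data.Vec.Relation.Unary.All using (_∷_)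
open import Data.Vec.Relation.Unary.AllPairs using (_∷_)
open import Function using (_∘_)
open import Relation.Binary.Definitions using (tri<; tri≈; tri>)
open import Relation.Binary.PropositionalEquality
open import Relation.Nullary using (Dec; yes; no; contradiction)

-- Finite sums

-- Let a cluster have weight N, total distance A to its centre and total overlap Q. The two cases
-- are separated by the threshold Q = N A / K, where K is that of `good-candidate`. Above it, the
-- average union yields cost at most 2A - Q/N, a factor 2 - 1/K. Below it, the five permutations are
-- chosen one by one; each choice at most doubles a potential and adds Q, so at most (2^5 - 1) Q /
-- N² symbols are bad. Deletion makes up to three further symbols unreliable per bad one, which
-- costs 4 · 31 Q / N² for each permutation and gives the factor 1 + 124/K. Every K ≥ 125 balances
-- the cases at 2 - 1/K; K = 1000 gives 1.999. Five voters are the fewest possible: two good symbols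
-- may cost one vote each, and three of five is still a majority, whereas one of three and two of
-- four are not. The clusters are unknown to the algorithm. Hence a cluster enters as a 0-1 weight,
-- some candidate is shown to be good for it, and minimising an upper bound of the cost over all
-- tuples can only do better.

𝟙 : Bool → ℕ
𝟙 b = if b then 1 else 0

𝟙≤1 : ∀ b → 𝟙 b ≤ 1
𝟙≤1 true  = ≤-refl
𝟙≤1 false = z≤n

<ᵇ-true : ∀ {a b} → a < b → (a <ᵇ b) ≡ true
<ᵇ-true {zero}  {suc b} _         = refl
<ᵇ-true {suc a} {suc b} (s≤s a<b) = <ᵇ-true a<b

<ᵇ-false : ∀ {a b} → b ≤ a → (a <ᵇ b) ≡ false
<ᵇ-false {a}     {zero}  _         = refl
<ᵇ-false {suc a} {suc b} (s≤s b≤a) = <ᵇ-false b≤a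

<ᵇ-true⁻¹ : ∀ {a b} → (a <ᵇ b) ≡ true → a < b
<ᵇ-true⁻¹ {a} {b} eqn = <ᵇ⇒< a b (subst T (sym eqn) _)

≡ᵇ-true : ∀ {a b} → a ≡ b → (a ≡ᵇ b) ≡ true
≡ᵇ-true {zero}  refl = refl
≡ᵇ-true {suc a} refl = ≡ᵇ-true {a} refl

≡ᵇ-false : ∀ {a b} → a ≢ b → (a ≡ᵇ b) ≡ false
≡ᵇ-false {zero}  {zero}  a≢b = contradiction refl a≢b
≡ᵇ-false {zero}  {suc b} a≢b = refl
≡ᵇ-false {suc a} {zero}  a≢b = refl
≡ᵇ-false {suc a} {suc b} a≢b = ≡ᵇ-false (a≢b ∘ cong suc)

≡ᵇ-true⁻¹ : ∀ {a b} → (a ≡ᵇ b) ≡ true → a ≡ b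
≡ᵇ-true⁻¹ {a} {b} eqn = ≡ᵇ⇒≡ a b (subst T (sym eqn) _)

sumTo : ℕ → (ℕ → ℕ) → ℕ
sumTo zero    f = 0
sumTo (suc n) f = sumTo n f + f n

sum-cong : ∀ n {f g : ℕ → ℕ} → (∀ i → i < n → f i ≡ g i) → sumTo n f ≡ sumTo n g
sum-cong zero    eqn = refl
sum-cong (suc n) eqn = cong₂ _+_ (sum-cong n λ i i<n → eqn i (m<n⇒m<1+n i<n)) (eqn n ≤-refl)

sum-mono : ∀ n {f g : ℕ → ℕ} → (∀ i → i < n → f i ≤ g i) → sumTo n f ≤ sumTo n g
sum-mono zero    le = z≤n
sum-mono (suc n) le = +-mono-≤ (sum-mono n λ i i<n → le i (m<n⇒m<1+n i<n)) (le n ≤-refl)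

interchange : ∀ a b c d → (a + b) + (c + d) ≡ (a + c) + (b + d)
interchange a b c d = begin
  (a + b) + (c + d)  ≡⟨ +-assoc a b (c + d) ⟩
  a + (b + (c + d))  ≡⟨ cong (a +_) (sym (+-assoc b c d)) ⟩
  a + ((b + c) + d)  ≡⟨ cong (λ z → a + (z + d)) (+-comm b c) ⟩
  a + ((c + b) + d)  ≡⟨ cong (a +_) (+-assoc c b d) ⟩
  a + (c + (b + d))  ≡⟨ sym (+-assoc a c (b + d)) ⟩
  (a + c) + (b + d)  ∎
  where open ≡-Reasoning

sum-head : ∀ n (f : ℕ → ℕ) → sumTo (suc n) f ≡ f 0 + sumTo n (f ∘ suc)
sum-head zero    f = sym (+-identityʳ (f 0))
sum-head (suc n) f = trans (cong (_+ f (suc n)) (sum-head n f)) (+-assoc (f 0) _ _)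

sum-+ : ∀ n (f g : ℕ → ℕ) → sumTo n (λ i → f i + g i) ≡ sumTo n f + sumTo n g
sum-+ zero    f g = refl
sum-+ (suc n) f g = trans (cong (_+ (f n + g n)) (sum-+ n f g))
                          (interchange (sumTo n f) (sumTo n g) (f n) (g n))

sum-* : ∀ n c (f : ℕ → ℕ) → sumTo n (λ i → c * f i) ≡ c * sumTo n f
sum-* zero    c f = sym (*-zeroʳ c)
sum-* (suc n) c f = trans (cong (_+ c * f n) (sum-* n c f)) (sym (*-distribˡ-+ c (sumTo n f) (f n)))

sum-const : ∀ n c → sumTo n (λ _ → c) ≡ n * c
sum-const zero    c = refl
sum-const (suc n) c = trans (cong (_+ c) (sum-const n c)) (+-comm (n * c) c)

sum-zero : ∀ n → sumTo n (λ _ → 0) ≡ 0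
sum-zero n = trans (sum-const n 0) (*-zeroʳ n)

sum-swap : ∀ m n (f : ℕ → ℕ → ℕ) →
           sumTo m (λ i → sumTo n (f i)) ≡ sumTo n (λ j → sumTo m (λ i → f i j))
sum-swap zero    n f = sym (sum-zero n)
sum-swap (suc m) n f = trans (cong (_+ sumTo n (f m)) (sum-swap m n f))
                             (sym (sum-+ n (λ j → sumTo m (λ i → f i j)) (f m)))

sum-bound : ∀ n {f : ℕ → ℕ} {c} → (∀ i → i < n → f i ≤ c) → sumTo n f ≤ n * c
sum-bound n {f} {c} le = ≤-trans (sum-mono n le) (≤-reflexive (sum-const n c))

term≤sum : ∀ n (f : ℕ → ℕ) {i} → i < n → f i ≤ sumTo n f
term≤sum (suc n) f {i} i<1+n with m≤n⇒m<n∨m≡n (≤-pred i<1+n)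
... | inj₁ i<n  = ≤-trans (term≤sum n f i<n) (m≤m+n _ _)
... | inj₂ refl = m≤n+m _ _

sum-none : ∀ n a (f : ℕ → ℕ) → n ≤ a → sumTo n (λ i → 𝟙 (i ≡ᵇ a) * f i) ≡ 0
sum-none n a f n≤a = trans (sum-cong n λ i i<n → cong (λ b → 𝟙 b * f i) (≡ᵇ-false (<⇒≢ (<-≤-trans i<n n≤a))))
                           (sum-zero n)

sum-pick : ∀ n {a} (f : ℕ → ℕ) → a < n → sumTo n (λ i → 𝟙 (i ≡ᵇ a) * f i) ≡ f a
sum-pick (suc n) {a} f a<1+n with m≤n⇒m<n∨m≡n (≤-pred a<1+n)
... | inj₁ a<n  rewrite ≡ᵇ-false (≢-sym (<⇒≢ a<n)) = trans (+-identityʳ _) (sum-pick n f a<n)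
... | inj₂ refl rewrite sum-none n a f ≤-refl | ≡ᵇ-true {a} refl = +-identityʳ (f a)

argmin : ∀ n (f : ℕ → ℕ) → 1 ≤ n → ∃[ x ] x < n × (∀ y → y < n → f x ≤ f y)
argmin (suc zero)    f _ = 0 , ≤-refl , λ { zero _ → ≤-refl ; (suc _) (s≤s ()) }
argmin (suc (suc n)) f _ with argmin (suc n) f (s≤s z≤n)
... | x , x<n , min with ≤-total (f x) (f (suc n))
... | inj₁ le = x , m<n⇒m<1+n x<n , λ y y<n → step y (m≤n⇒m<n∨m≡n (≤-pred y<n))
  where
  step : ∀ y → y < suc n ⊎ y ≡ suc n → f x ≤ f y
  step y (inj₁ y<n)  = min y y<n
  step y (inj₂ refl) = le
... | inj₂ ge = suc n , ≤-refl , λ y y<n → step y (m≤n⇒m<n∨m≡n (≤-pred y<n))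
  where
  step : ∀ y → y < suc n ⊎ y ≡ suc n → f (suc n) ≤ f y
  step y (inj₁ y<n)  = ≤-trans ge (min y y<n)
  step y (inj₂ refl) = ≤-refl

-- Moves and common orders

Prec : ∀ {A : Set} {d} → Vec A d → A → A → Set
Prec x a b = ∃[ i ] ∃[ j ] i Fin.< j × lookup x i ≡ a × lookup x j ≡ b

punchOut-< : ∀ {d} {p i j : Fin (suc d)} (p≢i : p ≢ i) (p≢j : p ≢ j) →
             i Fin.< j → punchOut p≢i Fin.< punchOut p≢j
punchOut-< p≢i p≢j i<j = Fin.≤∧≢⇒< (Fin.punchOut-mono-≤ p≢i p≢j (<⇒≤ i<j))
  (λ eqn → Fin.<⇒≢ i<j (Fin.punchOut-injective p≢i p≢j eqn))

punchIn-< : ∀ {d} (p : Fin (suc d)) {i j : Fin d} → i Fin.< j → punchIn p i Fin.< punchIn p j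
punchIn-< p {i} {j} i<j = Fin.≤∧≢⇒< (Fin.punchIn-mono-≤ p i j (<⇒≤ i<j))
  (λ eqn → Fin.<⇒≢ i<j (Fin.punchIn-injective p i j eqn))

Prec-removeAt : ∀ {A : Set} {d} (x : Vec A (suc d)) p {a b} → a ≢ lookup x p → b ≢ lookup x p →
                Prec x a b → Prec (removeAt x p) a b
Prec-removeAt x p a≢ b≢ (i , j , i<j , refl , refl) =
  punchOut p≢i , punchOut p≢j , punchOut-< p≢i p≢j i<j ,
  removeAt-punchOut x p≢i , removeAt-punchOut x p≢j
  where
  p≢i : p ≢ i
  p≢i refl = a≢ refl
  p≢j : p ≢ j
  p≢j refl = b≢ refl

Prec-insertAt : ∀ {A : Set} {d} (x : Vec A d) q c {a b} → Prec x a b → Prec (insertAt x q c) a b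
Prec-insertAt x q c (i , j , i<j , refl , refl) =
  punchIn q i , punchIn q j , punchIn-< q i<j , insertAt-punchIn x q c i , insertAt-punchIn x q c j

-- A move leaves the order of any two symbols other than the moved one as it is, so `L` collects the
-- moved symbols, one entry for each move.
moves⇒common-order : ∀ {A : Set} {d} m {x y : Vec A d} → Moves m x y →
  Σ (List A) λ L → length L ≡ m × (∀ {a b} → a ∉ L → b ∉ L → Prec x a b → Prec y a b)
moves⇒common-order zero refl = [] , refl , λ _ _ p → p
moves⇒common-order {d = suc d} (suc m) {x} (i , j , mv) with moves⇒common-order m mv
... | L , eqn , agree = lookup x i ∷ L , cong suc eqn , λ a∉ b∉ p →
  agree (a∉ ∘ there) (b∉ ∘ there)
    (Prec-insertAt (removeAt x i) j (lookup x i) (Prec-removeAt x i (a∉ ∘ here) (b∉ ∘ here) p))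

-- A common subsequence with `m` symbols left out: `keep` matches two heads, and `drop` allows an
-- omitted symbol anywhere in either sequence. `agree⇒common` consumes its input in this way.
data Common {A : Set} : ℕ → ∀ {d} → Vec A d → Vec A d → Set where
  done : Common 0 [] []
  keep : ∀ {m d} {x y : Vec A d} c → Common m x y → Common m (c ∷ x) (c ∷ y)
  drop : ∀ {m d} {x y : Vec A d} i j e → Common m x y → Common (suc m) (insertAt x i e) (insertAt y j e)

-- Two insertions commute once the positions are adjusted. Here both positions on the left are
-- prescribed; in `insert-after` it is the two inner positions, which both refer to `C`.
insert-before : ∀ {A : Set} {d} (C : Vec A d) q a j e → ∃[ j′ ] ∃[ q′ ]
  insertAt (insertAt C q a) j e ≡ insertAt (insertAt C j′ e) q′ a
insert-before C       zero    a zero    e = zero , suc zero , refl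
insert-before C       zero    a (suc j) e = j , zero , refl
insert-before (c ∷ C) (suc q) a zero    e = zero , suc (suc q) , refl
insert-before (c ∷ C) (suc q) a (suc j) e with insert-before C q a j e
... | j′ , q′ , eqn = suc j′ , suc q′ , cong (c ∷_) eqn

insert-after : ∀ {A : Set} {d} (C : Vec A d) j e p a → ∃[ p′ ] ∃[ i′ ]
  insertAt (insertAt C p a) i′ e ≡ insertAt (insertAt C j e) p′ a
insert-after C       j       e zero    a = zero , suc j , refl
insert-after (c ∷ C) zero    e (suc p) a = suc (suc p) , zero , refl
insert-after (c ∷ C) (suc j) e (suc p) a with insert-after C j e p a
... | p′ , i′ , eqn = suc p′ , suc i′ , cong (c ∷_) eqn

moveTo-insertAt : ∀ {A : Set} {d} (C : Vec A d) p q a → moveTo p q (insertAt C p a) ≡ insertAt C q a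
moveTo-insertAt C p q a = cong₂ (λ z c → insertAt z q c) (removeAt-insertAt C p a) (insertAt-lookup C p a)

-- A further symbol e is carried along the moves, from a suitable start.
moves-insertAt : ∀ {A : Set} {d} m {x y : Vec A d} → Moves m x y → ∀ j e →
                 ∃[ i ] Moves m (insertAt x i e) (insertAt y j e)
moves-insertAt zero refl j e = j , refl
moves-insertAt {d = suc d} (suc m) {x} (p , q , mv) j e with moves-insertAt m mv j e
... | i , mv′ with insert-before (removeAt x p) q (lookup x p) i e
... | j′ , q′ , eqn with insert-after (removeAt x p) j′ e p (lookup x p)
... | p′ , i′ , eqn′ = i′ , p′ , q′ , subst (λ z → Moves m z _) (sym step) mv′
  where
  open ≡-Reasoning
  a = lookup x p
  C = removeAt x p
  step : moveTo p′ q′ (insertAt x i′ e) ≡ insertAt (insertAt C q a) i e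
  step = begin
    moveTo p′ q′ (insertAt x i′ e)                  ≡⟨ cong (λ z → moveTo p′ q′ (insertAt z i′ e)) (sym (insertAt-removeAt x p)) ⟩
    moveTo p′ q′ (insertAt (insertAt C p a) i′ e)   ≡⟨ cong (moveTo p′ q′) eqn′ ⟩
    moveTo p′ q′ (insertAt (insertAt C j′ e) p′ a)  ≡⟨ moveTo-insertAt (insertAt C j′ e) p′ q′ a ⟩
    insertAt (insertAt C j′ e) q′ a                 ≡⟨ sym eqn ⟩
    insertAt (insertAt C q a) i e                   ∎

-- For `drop`, the moves between the rests carry `e` from a suitable start to its final place; one
-- extra move takes `e` to that start beforehand.
common⇒moves : ∀ {A : Set} {m d} {x y : Vec A d} → Common m x y → Moves m x y
common⇒moves done = refl
common⇒moves {m = m} (keep c p) = Moves-∷ c m (common⇒moves p)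
common⇒moves {m = suc m} (drop {x = x} i j e p) with moves-insertAt m (common⇒moves p) j e
... | i′ , mv = i , i′ , subst (λ z → Moves m z _) (sym (moveTo-insertAt x i i′ e)) mv

Inj : ∀ {A : Set} {d} → Vec A d → Set
Inj x = ∀ {i j} → lookup x i ≡ lookup x j → i ≡ j

record SameSymbols {A : Set} {d} (x y : Vec A d) : Set where
  field
    injˡ : Inj x
    injʳ : Inj y
    to   : ∀ i → ∃[ j ] lookup y j ≡ lookup x i
    from : ∀ j → ∃[ i ] lookup x i ≡ lookup y j

lookup-removeAt : ∀ {A : Set} {d} (x : Vec A (suc d)) p i → lookup (removeAt x p) i ≡ lookup x (punchIn p i)
lookup-removeAt x p i = begin
  lookup (removeAt x p) i                                          ≡⟨ sym (insertAt-punchIn (removeAt x p) p (lookup x p) i) ⟩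
  lookup (insertAt (removeAt x p) p (lookup x p)) (punchIn p i)    ≡⟨ cong (λ z → lookup z (punchIn p i)) (insertAt-removeAt x p) ⟩
  lookup x (punchIn p i)                                           ∎
  where open ≡-Reasoning

SameSymbols-removeAt : ∀ {A : Set} {d} {x y : Vec A (suc d)} → SameSymbols x y → ∀ p q →
  lookup x p ≡ lookup y q → SameSymbols (removeAt x p) (removeAt y q)
SameSymbols-removeAt {x = x} {y} S p q eqn = record
  { injˡ = inj x injˡ p
  ; injʳ = inj y injʳ q
  ; to   = cover x y injˡ to p q eqn
  ; from = cover y x injʳ from q p (sym eqn)
  }
  where
  open SameSymbols S
  inj : ∀ x → Inj x → ∀ p → Inj (removeAt x p)
  inj x ix p {i} {j} eqn′ = Fin.punchIn-injective p i j
    (ix (trans (sym (lookup-removeAt x p i)) (trans eqn′ (lookup-removeAt x p j))))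
  cover : ∀ x y → Inj x → (∀ i → ∃[ j ] lookup y j ≡ lookup x i) → ∀ p q → lookup x p ≡ lookup y q →
          ∀ i → ∃[ j ] lookup (removeAt y q) j ≡ lookup (removeAt x p) i
  cover x y ix c p q eqn i with c (punchIn p i)
  ... | j , eqn′ = punchOut q≢j , trans (removeAt-punchOut y q≢j) (trans eqn′ (sym (lookup-removeAt x p i)))
    where
    q≢j : q ≢ j
    q≢j refl = Fin.punchInᵢ≢i p i (ix (trans (sym eqn′) (sym eqn)))

module _ {A : Set} (kept : A → Bool) where

  dropped : ∀ {d} → Vec A d → ℕ
  dropped []      = 0
  dropped (c ∷ x) = 𝟙 (not (kept c)) + dropped x

  dropped-insertAt : ∀ {d} (x : Vec A d) i c → dropped (insertAt x i c) ≡ 𝟙 (not (kept c)) + dropped x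
  dropped-insertAt x       zero    c = refl
  dropped-insertAt (e ∷ x) (suc i) c = begin
    E + dropped (insertAt x i c)  ≡⟨ cong (E +_) (dropped-insertAt x i c) ⟩
    E + (C + dropped x)           ≡⟨ sym (+-assoc E C _) ⟩
    (E + C) + dropped x           ≡⟨ cong (_+ dropped x) (+-comm E C) ⟩
    (C + E) + dropped x           ≡⟨ +-assoc C E _ ⟩
    C + (E + dropped x)           ∎
    where
    open ≡-Reasoning
    E = 𝟙 (not (kept e))
    C = 𝟙 (not (kept c))

  Agree : ∀ {d} → Vec A d → Vec A d → Set
  Agree x y = ∀ {a b} → kept a ≡ true → kept b ≡ true → Prec x a b → Prec y a b

  Agree-removeAt : ∀ {d} {x y : Vec A (suc d)} p q → SameSymbols x y → lookup x p ≡ lookup y q →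
                   Agree x y → Agree (removeAt x p) (removeAt y q)
  Agree-removeAt {x = x} {y} p q S eqn agree {a} {b} ka kb (i , j , i<j , refl , refl) =
    Prec-removeAt y q (other i) (other j)
      (agree ka kb (punchIn p i , punchIn p j , punchIn-< p i<j ,
                    sym (lookup-removeAt x p i) , sym (lookup-removeAt x p j)))
    where
    other : ∀ i → lookup (removeAt x p) i ≢ lookup y q
    other i eqn′ = Fin.punchInᵢ≢i p i (SameSymbols.injˡ S
      (trans (sym (lookup-removeAt x p i)) (trans eqn′ (sym eqn))))

  -- Strip the heads. A head that is not kept is removed from both sequences. Two kept heads
  -- coincide: otherwise `c` would precede `c′` in `x`, hence also in `y`, which begins with `c′`.
  agree⇒common : ∀ {d} (x y : Vec A d) → SameSymbols x y → Agree x y → Common (dropped x) x y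
  agree⇒common []      []       S agree = done
  agree⇒common (c ∷ x) (c′ ∷ y) S agree with kept c in kc | kept c′ in kc′
  ... | false | _ with SameSymbols.to S zero
  ...   | j , eqn = subst₂ (Common (suc (dropped x))) refl
            (trans (cong (insertAt (removeAt (c′ ∷ y) j) j) (sym eqn)) (insertAt-removeAt (c′ ∷ y) j))
            (drop zero j c (agree⇒common x (removeAt (c′ ∷ y) j)
              (SameSymbols-removeAt S zero j (sym eqn)) (Agree-removeAt {y = c′ ∷ y} zero j S (sym eqn) agree)))
  agree⇒common (c ∷ x) (c′ ∷ y) S agree | true | false with SameSymbols.from S zero
  ...   | i , eqn = subst₂ (λ m z → Common m z (c′ ∷ y)) (sym count) back
            (drop i zero c′ (agree⇒common (removeAt (c ∷ x) i) y
              (SameSymbols-removeAt S i zero eqn) (Agree-removeAt {x = c ∷ x} {y = c′ ∷ y} i zero S eqn agree)))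
    where
    open ≡-Reasoning
    back : insertAt (removeAt (c ∷ x) i) i c′ ≡ c ∷ x
    back = trans (cong (insertAt (removeAt (c ∷ x) i) i) (sym eqn)) (insertAt-removeAt (c ∷ x) i)
    count : dropped x ≡ suc (dropped (removeAt (c ∷ x) i))
    count = begin
      dropped x                                            ≡⟨ cong (λ b → 𝟙 (not b) + dropped x) (sym kc) ⟩
      dropped (c ∷ x)                                      ≡⟨ cong dropped (sym back) ⟩
      dropped (insertAt (removeAt (c ∷ x) i) i c′)         ≡⟨ dropped-insertAt (removeAt (c ∷ x) i) i c′ ⟩
      𝟙 (not (kept c′)) + dropped (removeAt (c ∷ x) i)     ≡⟨ cong (λ b → 𝟙 (not b) + dropped (removeAt (c ∷ x) i)) kc′ ⟩
      suc (dropped (removeAt (c ∷ x) i))                   ∎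
  agree⇒common (c ∷ x) (c′ ∷ y) S agree | true | true
    with SameSymbols.to S zero | SameSymbols.from S zero
  ...   | zero , refl | _ = keep c (agree⇒common x y
            (SameSymbols-removeAt S zero zero refl) (Agree-removeAt zero zero S refl agree))
  ...   | suc j , eqn | zero , refl = keep c (agree⇒common x y
            (SameSymbols-removeAt S zero zero refl) (Agree-removeAt zero zero S refl agree))
  ...   | suc j , eqn | suc i , eqn′ with agree kc kc′ (zero , suc i , s≤s z≤n , refl , eqn′)
  ...     | p , q , p<q , _ , eqn″ with SameSymbols.injʳ S {q} {zero} eqn″
  ...       | refl = contradiction p<q λ ()

-- Positions

-- f on [0, d), and 0 elsewhere.
extend : ∀ {d} → (Fin d → ℕ) → ℕ → ℕ
extend {zero}  f a       = 0
extend {suc d} f zero    = f zero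
extend {suc d} f (suc a) = extend (f ∘ suc) a

extend-toℕ : ∀ {d} (f : Fin d → ℕ) i → extend f (toℕ i) ≡ f i
extend-toℕ f zero    = refl
extend-toℕ f (suc i) = extend-toℕ (f ∘ suc) i

toFin : ∀ {d a} → a < d → ∃[ i ] toℕ {d} i ≡ a
toFin a<d = Fin.fromℕ< a<d , Fin.toℕ-fromℕ< a<d

seqOf posOf : ∀ {d} → Permutation′ d → ℕ → ℕ
seqOf σ = extend (λ i → toℕ (σ ⟨$⟩ʳ i))
posOf σ = extend (λ a → toℕ (σ ⟨$⟩ˡ a))

-- A permutation as the program handles it: a sequence `x` and the positions `p` of its symbols, as
-- total functions that are meaningful below `d`.
record InverseOn (d : ℕ) (x p : ℕ → ℕ) : Set where
  field
    x<  : ∀ {i} → i < d → x i < d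
    p<  : ∀ {a} → a < d → p a < d
    x∘p : ∀ {a} → a < d → x (p a) ≡ a
    p∘x : ∀ {i} → i < d → p (x i) ≡ i

open InverseOn public

module _ {d} (σ : Permutation′ d) where

  seqOf-toℕ : ∀ i → seqOf σ (toℕ i) ≡ toℕ (σ ⟨$⟩ʳ i)
  seqOf-toℕ = extend-toℕ (λ i → toℕ (σ ⟨$⟩ʳ i))

  posOf-toℕ : ∀ a → posOf σ (toℕ a) ≡ toℕ (σ ⟨$⟩ˡ a)
  posOf-toℕ = extend-toℕ (λ a → toℕ (σ ⟨$⟩ˡ a))

  inverseOn : InverseOn d (seqOf σ) (posOf σ)
  inverseOn = record { x< = x<′ ; p< = p<′ ; x∘p = x∘p′ ; p∘x = p∘x′ }
    where
    x<′ : ∀ {i} → i < d → seqOf σ i < d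
    x<′ i<d with toFin i<d
    ... | i , refl rewrite seqOf-toℕ i = Fin.toℕ<n _
    p<′ : ∀ {i} → i < d → posOf σ i < d
    p<′ i<d with toFin i<d
    ... | i , refl rewrite posOf-toℕ i = Fin.toℕ<n _
    x∘p′ : ∀ {a} → a < d → seqOf σ (posOf σ a) ≡ a
    x∘p′ a<d with toFin a<d
    ... | a , refl rewrite posOf-toℕ a = trans (seqOf-toℕ _) (cong toℕ (inverseʳ σ))
    p∘x′ : ∀ {a} → a < d → posOf σ (seqOf σ a) ≡ a
    p∘x′ a<d with toFin a<d
    ... | a , refl rewrite seqOf-toℕ a = trans (posOf-toℕ _) (cong toℕ (inverseˡ σ))

InverseOn-injective : ∀ {d x p} → InverseOn d x p → ∀ {a b} → a < d → b < d → p a ≡ p b → a ≡ b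
InverseOn-injective {x = x} I a<d b<d eqn = trans (sym (x∘p I a<d)) (trans (cong x eqn) (x∘p I b<d))

-- Both sides sum `g a` over the pairs `(i , a)` with `a` equal to `x i`; every `a` below `d` occurs
-- in exactly one of them.
sum-reindex : ∀ {d x p} → InverseOn d x p → ∀ g → sumTo d (g ∘ x) ≡ sumTo d g
sum-reindex {d} {x} {p} I g = begin
  sumTo d (g ∘ x)                                                ≡⟨ sum-cong d (λ i i<d → sym (sum-pick d g (x< I i<d))) ⟩
  sumTo d (λ i → sumTo d (λ a → 𝟙 (a ≡ᵇ x i) * g a))             ≡⟨ sum-swap d d _ ⟩
  sumTo d (λ a → sumTo d (λ i → 𝟙 (a ≡ᵇ x i) * g a))             ≡⟨ sum-cong d (λ a a<d → sum-cong d (λ i i<d → cong (λ b → 𝟙 b * g a) (flip a<d i<d))) ⟩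
  sumTo d (λ a → sumTo d (λ i → 𝟙 (i ≡ᵇ p a) * g a))             ≡⟨ sum-cong d (λ a a<d → sum-pick d (λ _ → g a) (p< I a<d)) ⟩
  sumTo d g                                                      ∎
  where
  open ≡-Reasoning
  flip : ∀ {a i} → a < d → i < d → (a ≡ᵇ x i) ≡ (i ≡ᵇ p a)
  flip {a} {i} a<d i<d with a ≡ᵇ x i in e₁ | i ≡ᵇ p a in e₂
  ... | true  | true  = refl
  ... | false | false = refl
  ... | true  | false with ≡ᵇ-true⁻¹ {a} e₁
  ...   | refl with trans (sym e₂) (≡ᵇ-true (sym (p∘x I i<d)))
  ...     | ()
  flip {a} {i} a<d i<d | false | true with ≡ᵇ-true⁻¹ {i} e₂
  ...   | refl with trans (sym e₁) (≡ᵇ-true (sym (x∘p I a<d)))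
  ...     | ()

count : ℕ → (ℕ → Bool) → ℕ
count d u = sumTo d (λ a → 𝟙 (u a))

module _ {d} (σ : Permutation′ d) where

  lookup-oneLine : ∀ i → lookup (oneLine σ) i ≡ σ ⟨$⟩ʳ i
  lookup-oneLine = lookup∘tabulate (σ ⟨$⟩ʳ_)

  Prec⇒pos< : ∀ {a b} → Prec (oneLine σ) a b → posOf σ (toℕ a) < posOf σ (toℕ b)
  Prec⇒pos< (i , j , i<j , refl , refl) = subst₂ _<_ (sym (position i)) (sym (position j)) i<j
    where
    position : ∀ i → posOf σ (toℕ (lookup (oneLine σ) i)) ≡ toℕ i
    position i rewrite lookup-oneLine i = trans (posOf-toℕ σ _) (cong toℕ (inverseˡ σ))

  pos<⇒Prec : ∀ {a b} → posOf σ (toℕ a) < posOf σ (toℕ b) → Prec (oneLine σ) a b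
  pos<⇒Prec {a} {b} a<b = σ ⟨$⟩ˡ a , σ ⟨$⟩ˡ b , subst₂ _<_ (posOf-toℕ σ a) (posOf-toℕ σ b) a<b ,
    trans (lookup-oneLine _) (inverseʳ σ) , trans (lookup-oneLine _) (inverseʳ σ)

sameSymbols : ∀ {d} (σ τ : Permutation′ d) → SameSymbols (oneLine σ) (oneLine τ)
sameSymbols σ τ = record { injˡ = inj σ ; injʳ = inj τ ; to = cover σ τ ; from = cover τ σ }
  where
  inj : ∀ σ → Inj (oneLine σ)
  inj σ {i} {j} eqn = trans (sym (inverseˡ σ)) (trans
    (cong (σ ⟨$⟩ˡ_) (trans (sym (lookup-oneLine σ i)) (trans eqn (lookup-oneLine σ j)))) (inverseˡ σ))
  cover : ∀ σ τ i → ∃[ j ] lookup (oneLine τ) j ≡ lookup (oneLine σ) i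
  cover σ τ i = τ ⟨$⟩ˡ lookup (oneLine σ) i , trans (lookup-oneLine τ _) (inverseʳ τ)

AgreeOff : ℕ → (ℕ → Bool) → (ℕ → ℕ) → (ℕ → ℕ) → Set
AgreeOff d u p q = ∀ {a b} → a < d → b < d → u a ≡ false → u b ≡ false → p a < p b → q a < q b

sumTo-tabulate : ∀ {A : Set} d (f : Fin d → A) (kept : A → Bool) (g : ℕ → ℕ) →
  (∀ i → 𝟙 (not (kept (f i))) ≡ g (toℕ i)) → dropped kept (tabulate f) ≡ sumTo d g
sumTo-tabulate zero    f kept g eqn = refl
sumTo-tabulate (suc d) f kept g eqn = trans
  (cong₂ _+_ (eqn zero) (sumTo-tabulate d (f ∘ suc) kept (g ∘ suc) (eqn ∘ suc)))
  (sym (sum-head d g))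

-- Together with `Δ⇒agree` this identifies `Δ` as the least number of symbols off which the two
-- orders agree, that is, `d` minus the length of a longest common subsequence.
Δ≤count : ∀ {d} (σ τ : Permutation′ d) u → AgreeOff d u (posOf σ) (posOf τ) → Δ σ τ ≤ count d u
Δ≤count {d} σ τ u agree = ≤-trans
  (Δ-minimal σ τ (common⇒moves (agree⇒common kept (oneLine σ) (oneLine τ) (sameSymbols σ τ) agree′)))
  (≤-reflexive (trans (sumTo-tabulate d (σ ⟨$⟩ʳ_) kept (𝟙 ∘ u ∘ seqOf σ) same)
                        (sum-reindex (inverseOn σ) (𝟙 ∘ u))))
  where
  kept : Fin d → Bool
  kept a = not (u (toℕ a))
  same : ∀ i → 𝟙 (not (kept (σ ⟨$⟩ʳ i))) ≡ 𝟙 (u (seqOf σ (toℕ i)))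
  same i rewrite seqOf-toℕ σ i = cong 𝟙 (not-involutive _)
  unkept : ∀ {b} → not b ≡ true → b ≡ false
  unkept {false} _ = refl
  agree′ : Agree kept (oneLine σ) (oneLine τ)
  agree′ {a} {b} ka kb p = pos<⇒Prec τ
    (agree (Fin.toℕ<n a) (Fin.toℕ<n b) (unkept ka) (unkept kb) (Prec⇒pos< σ p))

memb : ∀ {d} → List (Fin d) → ℕ → Bool
memb []      a = false
memb (c ∷ L) a = (a ≡ᵇ toℕ c) ∨ memb L a

count-memb : ∀ {d} (L : List (Fin d)) → count d (memb L) ≤ length L
count-memb {d} []      = ≤-reflexive (sum-zero d)
count-memb {d} (c ∷ L) = begin
  sumTo d (λ a → 𝟙 ((a ≡ᵇ toℕ c) ∨ memb L a))                          ≤⟨ sum-mono d (λ a _ → 𝟙-∨ (a ≡ᵇ toℕ c) (memb L a)) ⟩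
  sumTo d (λ a → 𝟙 (a ≡ᵇ toℕ c) * 1 + 𝟙 (memb L a))                    ≡⟨ sum-+ d (λ a → 𝟙 (a ≡ᵇ toℕ c) * 1) (𝟙 ∘ memb L) ⟩
  sumTo d (λ a → 𝟙 (a ≡ᵇ toℕ c) * 1) + count d (memb L)                ≤⟨ +-mono-≤ (≤-reflexive (sum-pick d (λ _ → 1) (Fin.toℕ<n c))) (count-memb L) ⟩
  suc (length L)                                                       ∎
  where
  open ≤-Reasoning
  𝟙-∨ : ∀ a b → 𝟙 (a ∨ b) ≤ 𝟙 a * 1 + 𝟙 b
  𝟙-∨ true  b = s≤s z≤n
  𝟙-∨ false b = ≤-refl

memb-∉ : ∀ {d} (L : List (Fin d)) {a} → memb L (toℕ a) ≡ false → a ∉ L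
memb-∉ (c ∷ L) {a} eqn (here refl) rewrite ≡ᵇ-true {toℕ a} refl = contradiction eqn λ ()
memb-∉ (c ∷ L) {a} eqn (there a∈L) with toℕ a ≡ᵇ toℕ c
... | false = memb-∉ L eqn a∈L
... | true  = contradiction eqn λ ()

Δ⇒agree : ∀ {d} (σ τ : Permutation′ d) →
          ∃[ u ] count d u ≤ Δ σ τ × AgreeOff d u (posOf σ) (posOf τ)
Δ⇒agree {d} σ τ with moves⇒common-order (Δ σ τ) (Δ-reached σ τ)
... | L , eqn , agree = memb L , ≤-trans (count-memb L) (≤-reflexive eqn) , agree′
  where
  agree′ : AgreeOff d (memb L) (posOf σ) (posOf τ)
  agree′ a<d b<d ua ub a<b with toFin a<d | toFin b<d
  ... | a , refl | b , refl = Prec⇒pos< τ (agree (memb-∉ L ua) (memb-∉ L ub) (pos<⇒Prec σ a<b))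

module _ {d} (p : ℕ → ℕ) (p<d : ∀ {a} → a < d → p a < d)
         (p-inj : ∀ {a b} → a < d → b < d → p a ≡ p b → a ≡ b) where

  private
    f : Fin d → Fin d
    f a = Fin.fromℕ< (p<d (Fin.toℕ<n a))

    toℕ-f : ∀ a → toℕ (f a) ≡ p (toℕ a)
    toℕ-f a = Fin.toℕ-fromℕ< _

    f-inj : ∀ {a b} → f a ≡ f b → a ≡ b
    f-inj {a} {b} eqn = Fin.toℕ-injective (p-inj (Fin.toℕ<n a) (Fin.toℕ<n b)
      (trans (sym (toℕ-f a)) (trans (cong toℕ eqn) (toℕ-f b))))

    -- Pigeonhole: if `i` were missed, punching it out would inject `Fin (suc d)` into `Fin d`.
    surjective : ∀ {d} (f : Fin d → Fin d) → (∀ {a b} → f a ≡ f b → a ≡ b) → ∀ i → ∃[ a ] f a ≡ i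
    surjective {suc d} f f-inj i with Fin.any? (λ a → f a Fin.≟ i)
    ... | yes hit = hit
    ... | no miss = contradiction (Fin.injective⇒≤ {f = λ a → punchOut (i≢ a)}
                      (λ {a} {b} eqn → f-inj (Fin.punchOut-injective (i≢ a) (i≢ b) eqn))) 1+n≰n
      where
      i≢ : ∀ a → i ≢ f a
      i≢ a eqn = miss (a , sym eqn)

    g : Fin d → Fin d
    g i = proj₁ (surjective f f-inj i)

    f∘g : ∀ i → f (g i) ≡ i
    f∘g i = proj₂ (surjective f f-inj i)

  fromPos : Permutation′ d
  fromPos = permutation g f (λ a → f-inj (f∘g (f a))) f∘g

  posOf-fromPos : ∀ {a} → a < d → posOf fromPos a ≡ p a
  posOf-fromPos a<d with toFin a<d
  ... | a , refl = trans (posOf-toℕ fromPos a) (toℕ-f a)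

-- Deleting the cycles of a tournament

infixl 7 _dv_ _md_

-- The total division and remainder of the machine, so that the functions below are literally what
-- the program evaluates.
_dv_ _md_ : ℕ → ℕ → ℕ
_dv_ = apply div
_md_ = apply mod

dv-pair : ∀ a {b m} → b < m → (a * m + b) dv m ≡ a
dv-pair a {b} {suc m} b<m = begin
  (a * suc m + b) ℕ./ suc m            ≡⟨ cong (ℕ._/ suc m) (+-comm (a * suc m) b) ⟩
  (b + a * suc m) ℕ./ suc m            ≡⟨ +-distrib-/-∣ʳ b {n = a * suc m} (divides-refl a) ⟩
  b ℕ./ suc m + a * suc m ℕ./ suc m      ≡⟨ cong₂ _+_ (m<n⇒m/n≡0 b<m) (m*n/n≡m a (suc m)) ⟩
  a                                  ∎
  where
  open ≡-Reasoning

md-pair : ∀ a {b m} → b < m → (a * m + b) md m ≡ b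
md-pair a {b} {suc m} b<m = begin
  (a * suc m + b) % suc m  ≡⟨ cong (_% suc m) (+-comm (a * suc m) b) ⟩
  (b + a * suc m) % suc m  ≡⟨ [m+kn]%n≡m%n b a (suc m) ⟩
  b % suc m                ≡⟨ m<n⇒m%n≡m b<m ⟩
  b                        ∎
  where open ≡-Reasoning

pair< : ∀ {a b m n} → a < n → b < m → a * m + b < n * m
pair< {a} {b} {m} {n} a<n b<m = begin-strict
  a * m + b   <⟨ +-monoʳ-< (a * m) b<m ⟩
  a * m + m   ≡⟨ +-comm (a * m) m ⟩
  suc a * m   ≤⟨ *-monoˡ-≤ m a<n ⟩
  n * m       ∎
  where open ≤-Reasoning

unpair : ∀ {e} n m → e < n * m → ∃[ a ] ∃[ b ] a < n × b < m × e ≡ a * m + b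
unpair {e} n zero    e<nm = contradiction (subst (e <_) (*-zeroʳ n) e<nm) λ ()
unpair {e} n (suc m) e<nm = e ℕ./ suc m , e % suc m , m<n*o⇒m/o<n e<nm , m%n<n e (suc m) ,
  trans (m≡m%n+[m/n]*n e (suc m)) (+-comm (e % suc m) _)

1≢0 : ∀ {A : Set} → 1 ≡ 0 → A
1≢0 ()

t≢f : ∀ {A : Set} {b} → b ≡ true → b ≡ false → A
t≢f refl ()

𝟙≡1 : ∀ {b} → 𝟙 b ≢ 0 → b ≡ true
𝟙≡1 {true}  _ = refl
𝟙≡1 {false} h = contradiction refl h

∏≢0 : ∀ {x y} → x * y ≢ 0 → x ≢ 0 × y ≢ 0
∏≢0 {x} {y} h = (λ { refl → h refl }) , (λ { refl → h (*-zeroʳ x) })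

module Elimination (d : ℕ) (m : ℕ → ℕ → Bool) where

  -- e encodes a pair (a , b) such that t → a → b → t is a cycle of live symbols.
  cyc : (ℕ → ℕ) → ℕ → ℕ → ℕ
  cyc D t e = 𝟙 (e dv d <ᵇ t) * (𝟙 (e md d <ᵇ t) * (𝟙 (D (e dv d) ≡ᵇ 0) * (𝟙 (D (e md d) ≡ᵇ 0) *
              (𝟙 (m t (e dv d)) * (𝟙 (m (e dv d) (e md d)) * 𝟙 (m (e md d) t))))))

  -- 0, or one more than the first such code.
  scanTo : (ℕ → ℕ) → ℕ → ℕ → ℕ
  scanTo D t zero    = 0
  scanTo D t (suc e) = if scanTo D t e ≡ᵇ 0 then cyc D t e * suc e else scanTo D t e

  -- `f` is the outcome of a scan: 0 if there is no cycle, otherwise one more than the code of the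
  -- pair to be deleted together with `t`.
  kill : (ℕ → ℕ) → ℕ → ℕ → ℕ → ℕ
  kill D t f x = if f ≡ᵇ 0 then D x else
                 if x ≡ᵇ (f ∸ 1) dv d then 1 else
                 if x ≡ᵇ (f ∸ 1) md d then 1 else
                 if x ≡ᵇ t then 1 else D x

  -- One pass is enough: step `t` looks for a cycle that `t` closes with smaller live symbols, and
  -- deleting it deletes `t`, so no live cycle is left among the symbols up to `t`.
  dead : ℕ → ℕ → ℕ
  dead zero    x = 0
  dead (suc t) x = kill (dead t) t (scanTo (dead t) t (d * d)) x

  beforeBy : (ℕ → ℕ) → ℕ → ℕ → Bool
  beforeBy D b a = if D b ≡ᵇ 0 then (if D a ≡ᵇ 0 then m b a else true)
                               else (if D a ≡ᵇ 0 then false else b <ᵇ a)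

  before : ℕ → ℕ → Bool
  before = beforeBy (dead d)

  rank : ℕ → ℕ
  rank a = count d (λ b → before b a)

  cyc≤1 : ∀ D t e → cyc D t e ≤ 1
  cyc≤1 D t e = b1 (e dv d <ᵇ t) (b1 (e md d <ᵇ t) (b1 (D (e dv d) ≡ᵇ 0) (b1 (D (e md d) ≡ᵇ 0)
                (b1 (m t (e dv d)) (b1 (m (e dv d) (e md d)) (𝟙≤1 (m (e md d) t)))))))
    where
    b1 : ∀ b {x} → x ≤ 1 → 𝟙 b * x ≤ 1
    b1 true  {x} h = ≤-trans (≤-reflexive (+-identityʳ x)) h
    b1 false     h = z≤n

  scan≤ : ∀ D t e → scanTo D t e ≤ e
  scan≤ D t zero = z≤n
  scan≤ D t (suc e) with scanTo D t e ≡ᵇ 0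
  ... | true  = ≤-trans (*-monoˡ-≤ (suc e) (cyc≤1 D t e)) (≤-reflexive (*-identityˡ (suc e)))
  ... | false = m≤n⇒m≤1+n (scan≤ D t e)

  scan-sound : ∀ D t n {f} → scanTo D t n ≡ suc f → f < n × cyc D t f ≢ 0
  scan-sound D t (suc n) {f} eqn with scanTo D t n in eq′
  ... | suc g with refl ← eqn = let f<n , c = scan-sound D t n eq′ in m<n⇒m<1+n f<n , c
  ... | zero with cyc D t n in eq″
  ...   | zero  with () ← eqn
  ...   | suc c = helper
    where
    c≡0 : c ≡ 0
    c≡0 = ≤-antisym (≤-pred (≤-trans (≤-reflexive (sym eq″)) (cyc≤1 D t n))) z≤n
    helper : f < suc n × cyc D t f ≢ 0
    helper with c≡0
    ... | refl with trans (sym (+-identityʳ (suc n))) eqn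
    ...   | refl = ≤-refl , λ z → 1≢0 (trans (sym eq″) z)

  scan-complete : ∀ D t n → scanTo D t n ≡ 0 → ∀ {e} → e < n → cyc D t e ≡ 0
  scan-complete D t (suc n) eqn {e} e<1+n with scanTo D t n in eq′
  ... | zero with m≤n⇒m<n∨m≡n (≤-pred e<1+n)
  ...   | inj₁ e<n  = scan-complete D t n eq′ e<n
  ...   | inj₂ refl with cyc D t e
  ...     | zero = refl

  record Cycle (D : ℕ → ℕ) (t a b : ℕ) : Set where
    field
      a<t : a < t
      b<t : b < t
      Da  : D a ≡ 0
      Db  : D b ≡ 0
      ta  : m t a ≡ true
      ab  : m a b ≡ true
      bt  : m b t ≡ true

  cyc⇒Cycle : ∀ D t e → cyc D t e ≢ 0 → Cycle D t (e dv d) (e md d)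
  cyc⇒Cycle D t e h with ∏≢0 {𝟙 (e dv d <ᵇ t)} h
  ... | h₁ , h with ∏≢0 {𝟙 (e md d <ᵇ t)} h
  ... | h₂ , h with ∏≢0 {𝟙 (D (e dv d) ≡ᵇ 0)} h
  ... | h₃ , h with ∏≢0 {𝟙 (D (e md d) ≡ᵇ 0)} h
  ... | h₄ , h with ∏≢0 {𝟙 (m t (e dv d))} h
  ... | h₅ , h with ∏≢0 {𝟙 (m (e dv d) (e md d))} h
  ... | h₆ , h₇ = record
    { a<t = <ᵇ-true⁻¹ (𝟙≡1 h₁) ; b<t = <ᵇ-true⁻¹ (𝟙≡1 h₂) ; Da = ≡ᵇ-true⁻¹ (𝟙≡1 h₃)
    ; Db = ≡ᵇ-true⁻¹ (𝟙≡1 h₄) ; ta = 𝟙≡1 h₅ ; ab = 𝟙≡1 h₆ ; bt = 𝟙≡1 h₇ }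

  Cycle⇒cyc : ∀ D t {a b} → b < d → Cycle D t a b → cyc D t (a * d + b) ≢ 0
  Cycle⇒cyc D t {a} {b} b<d C rewrite dv-pair a b<d | md-pair a b<d | <ᵇ-true (Cycle.a<t C)
    | <ᵇ-true (Cycle.b<t C) | Cycle.Da C | Cycle.Db C | Cycle.ta C | Cycle.ab C | Cycle.bt C = λ ()

  module Correct
    (asym  : ∀ {a b} → a < d → b < d → m a b ≡ true → m b a ≡ false)
    (total : ∀ {a b} → a < d → b < d → a ≢ b → m a b ≡ true ⊎ m b a ≡ true) where

    Acyclic : ℕ → (ℕ → ℕ) → Set
    Acyclic t D = ∀ {x y z} → x < t → y < t → z < t → D x ≡ 0 → D y ≡ 0 → D z ≡ 0 →
                  m x y ≡ true → m y z ≡ true → m z x ≡ true → ⊥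

    irrefl : ∀ {a} → a < d → m a a ≡ true → ⊥
    irrefl a<d maa = t≢f maa (asym a<d a<d maa)

    kill≤1 : ∀ D t f x → D x ≤ 1 → kill D t f x ≤ 1
    kill≤1 D t f x h with f ≡ᵇ 0
    ... | true  = h
    ... | false with x ≡ᵇ (f ∸ 1) dv d
    ... | true  = ≤-refl
    ... | false with x ≡ᵇ (f ∸ 1) md d
    ... | true  = ≤-refl
    ... | false with x ≡ᵇ t
    ... | true  = ≤-refl
    ... | false = h

    kill≥ : ∀ D t f x → D x ≤ 1 → D x ≤ kill D t f x
    kill≥ D t f x h with f ≡ᵇ 0
    ... | true  = ≤-refl
    ... | false with x ≡ᵇ (f ∸ 1) dv d
    ... | true  = h
    ... | false with x ≡ᵇ (f ∸ 1) md d
    ... | true  = h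
    ... | false with x ≡ᵇ t
    ... | true  = h
    ... | false = ≤-refl

    dead≤1 : ∀ t x → dead t x ≤ 1
    dead≤1 zero    x = z≤n
    dead≤1 (suc t) x = kill≤1 (dead t) t (scanTo (dead t) t (d * d)) x (dead≤1 t x)

    kill-t : ∀ D t e → kill D t (suc e) t ≡ 1
    kill-t D t e with t ≡ᵇ e dv d
    ... | true  = refl
    ... | false with t ≡ᵇ e md d
    ... | true  = refl
    ... | false rewrite ≡ᵇ-true {t} refl = refl

    kill-a : ∀ D t e → kill D t (suc e) (e dv d) ≡ 1
    kill-a D t e rewrite ≡ᵇ-true {e dv d} refl = refl

    kill-b : ∀ D t e → kill D t (suc e) (e md d) ≡ 1
    kill-b D t e with e md d ≡ᵇ e dv d
    ... | true  = refl
    ... | false rewrite ≡ᵇ-true {e md d} refl = refl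

    zero-below : ∀ {x y} → x ≤ y → y ≡ 0 → x ≡ 0
    zero-below z≤n refl = refl

    -- After a hit `t` is dead, so a live cycle lies below `t` and was live before as well. Without
    -- a hit, a cycle through `t`, rotated so as to start in `t`, would have been found by the
    -- exhaustive scan.
    acyclic : ∀ t → t ≤ d → Acyclic t (dead t)
    acyclic zero    t≤d ()
    acyclic (suc t) t≤d {x} {y} {z} x< y< z< Dx Dy Dz xy yz zx with scanTo (dead t) t (d * d) in found
    ... | suc e = cases (m≤n⇒m<n∨m≡n (≤-pred x<)) (m≤n⇒m<n∨m≡n (≤-pred y<)) (m≤n⇒m<n∨m≡n (≤-pred z<))
      where
      below : ∀ {x} → kill (dead t) t (suc e) x ≡ 0 → dead t x ≡ 0
      below {x} = zero-below (kill≥ (dead t) t (suc e) x (dead≤1 t x))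
      tdead : ∀ {x} → x ≡ t → kill (dead t) t (suc e) x ≡ 0 → ⊥
      tdead refl h = 1≢0 (trans (sym (kill-t (dead t) t e)) h)
      cases : x < t ⊎ x ≡ t → y < t ⊎ y ≡ t → z < t ⊎ z ≡ t → ⊥
      cases (inj₁ x<t) (inj₁ y<t) (inj₁ z<t) =
        acyclic t (<⇒≤ t≤d) x<t y<t z<t (below Dx) (below Dy) (below Dz) xy yz zx
      cases (inj₂ h) _ _ = tdead h Dx
      cases _ (inj₂ h) _ = tdead h Dy
      cases _ _ (inj₂ h) = tdead h Dz
    ... | zero = cases x< y< z< Dx Dy Dz xy yz zx (m≤n⇒m<n∨m≡n (≤-pred x<)) (m≤n⇒m<n∨m≡n (≤-pred y<)) (m≤n⇒m<n∨m≡n (≤-pred z<))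
      where
      earlier : ∀ {x y} → x < suc t → y < suc t → x ≡ t → m x y ≡ true ⊎ m y x ≡ true → y < t
      earlier x< y< refl xy with m≤n⇒m<n∨m≡n (≤-pred y<)
      ... | inj₁ y<t  = y<t
      earlier x< y< refl (inj₁ h) | inj₂ refl = ⊥-elim (irrefl t≤d h)
      earlier x< y< refl (inj₂ h) | inj₂ refl = ⊥-elim (irrefl t≤d h)
      top : ∀ {x y z} → x ≡ t → x < suc t → y < suc t → z < suc t → dead t y ≡ 0 → dead t z ≡ 0 →
            m x y ≡ true → m y z ≡ true → m z x ≡ true → ⊥
      top {x} {y} {z} refl x< y< z< Dy Dz xy yz zx =
        Cycle⇒cyc (dead t) t z<d C
          (scan-complete (dead t) t (d * d) found (pair< (<-trans y<t t≤d) z<d))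
        where
        y<t : y < t
        y<t = earlier x< y< refl (inj₁ xy)
        z<t : z < t
        z<t = earlier x< z< refl (inj₂ zx)
        z<d : z < d
        z<d = <-trans z<t t≤d
        C : Cycle (dead t) t y z
        C = record { a<t = y<t ; b<t = z<t ; Da = Dy ; Db = Dz ; ta = xy ; ab = yz ; bt = zx }
      cases : ∀ {x y z} → x < suc t → y < suc t → z < suc t → dead t x ≡ 0 → dead t y ≡ 0 → dead t z ≡ 0 →
              m x y ≡ true → m y z ≡ true → m z x ≡ true → x < t ⊎ x ≡ t → y < t ⊎ y ≡ t → z < t ⊎ z ≡ t → ⊥
      cases x< y< z< Dx Dy Dz xy yz zx (inj₂ h) _ _ = top h x< y< z< Dy Dz xy yz zx
      cases x< y< z< Dx Dy Dz xy yz zx _ (inj₂ h) _ = top h y< z< x< Dz Dx yz zx xy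
      cases x< y< z< Dx Dy Dz xy yz zx _ _ (inj₂ h) = top h z< x< y< Dx Dy zx xy yz
      cases x< y< z< Dx Dy Dz xy yz zx (inj₁ x<t) (inj₁ y<t) (inj₁ z<t) =
        acyclic t (<⇒≤ t≤d) x<t y<t z<t Dx Dy Dz xy yz zx

    private D = dead d

    before-alive : ∀ {a b} → D a ≡ 0 → D b ≡ 0 → before a b ≡ m a b
    before-alive Da Db rewrite Da | Db = refl

    before-irrefl : ∀ {a} → a < d → before a a ≡ false
    before-irrefl {a} a<d with D a
    ... | suc _ = <ᵇ-false {a} ≤-refl
    ... | zero with m a a in eqn
    ...   | false = refl
    ...   | true  = ⊥-elim (irrefl a<d eqn)

    before-total : ∀ {a b} → a < d → b < d → a ≢ b → before a b ≡ true ⊎ before b a ≡ true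
    before-total {a} {b} a<d b<d a≢b with D a | D b
    ... | zero  | zero  = total a<d b<d a≢b
    ... | zero  | suc _ = inj₁ refl
    ... | suc _ | zero  = inj₂ refl
    ... | suc _ | suc _ with <-cmp a b
    ...   | tri< a<b _ _ = inj₁ (<ᵇ-true a<b)
    ...   | tri≈ _ a≡b _ = contradiction a≡b a≢b
    ...   | tri> _ _ b<a = inj₂ (<ᵇ-true b<a)

    -- For live symbols, this is the fact that a tournament without cycles of length three is
    -- transitive.
    before-trans : ∀ {a b c} → a < d → b < d → c < d →
                   before a b ≡ true → before b c ≡ true → before a c ≡ true
    before-trans {a} {b} {c} a<d b<d c<d with D a in Da | D b in Db | D c in Dc
    ... | zero  | zero  | suc _ = λ _ _ → refl
    ... | zero  | suc _ | suc _ = λ _ _ → refl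
    ... | zero  | suc _ | zero  = λ _ ()
    ... | suc _ | zero  | _     = λ ()
    ... | suc _ | suc _ | zero  = λ _ ()
    ... | suc _ | suc _ | suc _ = λ p q → <ᵇ-true (<-trans (<ᵇ-true⁻¹ {a} {b} p) (<ᵇ-true⁻¹ {b} {c} q))
    ... | zero  | zero  | zero  = live
      where
      live : m a b ≡ true → m b c ≡ true → m a c ≡ true
      live ab bc with a ≟ c
      ... | yes refl = t≢f bc (asym a<d b<d ab)
      ... | no a≢c with total a<d c<d a≢c
      ...   | inj₁ ac = ac
      ...   | inj₂ ca = ⊥-elim (acyclic d ≤-refl a<d b<d c<d Da Db Dc ab bc ca)

    -- The predecessors of `a`, and `a` itself, which is not among them, all precede `b`.
    rank-< : ∀ {a b} → a < d → b < d → before a b ≡ true → rank a < rank b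
    rank-< {a} {b} a<d b<d ab = begin
      1 + rank a                                                     ≡⟨ +-comm 1 (rank a) ⟩
      rank a + 1                                                     ≡⟨ cong (rank a +_) (sym (sum-pick d (λ _ → 1) a<d)) ⟩
      rank a + sumTo d (λ c → 𝟙 (c ≡ᵇ a) * 1)                        ≡⟨ sym (sum-+ d (λ c → 𝟙 (before c a)) _) ⟩
      sumTo d (λ c → 𝟙 (before c a) + 𝟙 (c ≡ᵇ a) * 1)                ≤⟨ sum-mono d pointwise ⟩
      rank b                                                         ∎
      where
      open ≤-Reasoning
      pointwise : ∀ c → c < d → 𝟙 (before c a) + 𝟙 (c ≡ᵇ a) * 1 ≤ 𝟙 (before c b)
      pointwise c c<d with c ≡ᵇ a in c≡a
      ... | true with refl ← ≡ᵇ-true⁻¹ {c} c≡a rewrite before-irrefl a<d | ab = ≤-refl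
      ... | false with before c a in ca
      ...   | false = z≤n
      ...   | true  rewrite before-trans c<d a<d b<d ca ab = ≤-refl

    rank<d : ∀ {a} → a < d → rank a < d
    rank<d {a} a<d = begin
      1 + rank a                                                     ≡⟨ +-comm 1 (rank a) ⟩
      rank a + 1                                                     ≡⟨ cong (rank a +_) (sym (sum-pick d (λ _ → 1) a<d)) ⟩
      rank a + sumTo d (λ c → 𝟙 (c ≡ᵇ a) * 1)                        ≡⟨ sym (sum-+ d (λ c → 𝟙 (before c a)) _) ⟩
      sumTo d (λ c → 𝟙 (before c a) + 𝟙 (c ≡ᵇ a) * 1)                ≤⟨ sum-bound d pointwise ⟩
      d * 1                                                          ≡⟨ *-identityʳ d ⟩
      d                                                              ∎
      where
      open ≤-Reasoning
      pointwise : ∀ c → c < d → 𝟙 (before c a) + 𝟙 (c ≡ᵇ a) * 1 ≤ 1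
      pointwise c c<d with c ≡ᵇ a in c≡a
      ... | true with refl ← ≡ᵇ-true⁻¹ {c} c≡a rewrite before-irrefl a<d = ≤-refl
      ... | false rewrite +-identityʳ (𝟙 (before c a)) = 𝟙≤1 (before c a)

    rank-injective : ∀ {a b} → a < d → b < d → rank a ≡ rank b → a ≡ b
    rank-injective {a} {b} a<d b<d eqn with a ≟ b
    ... | yes a≡b = a≡b
    ... | no a≢b with before-total a<d b<d a≢b
    ...   | inj₁ ab = contradiction eqn (<⇒≢ (rank-< a<d b<d ab))
    ...   | inj₂ ba = contradiction (sym eqn) (<⇒≢ (rank-< b<d a<d ba))

    module Approximate (bad : ℕ → Bool) (q : ℕ → ℕ)
      (q-inj : ∀ {a b} → a < d → b < d → q a ≡ q b → a ≡ b)
      (q⇒m : ∀ {a b} → a < d → b < d → bad a ≡ false → bad b ≡ false → q a < q b → m a b ≡ true) where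

      m⇒q : ∀ {a b} → a < d → b < d → bad a ≡ false → bad b ≡ false → m a b ≡ true → q a < q b
      m⇒q {a} {b} a<d b<d ga gb ab with <-cmp (q a) (q b)
      ... | tri< qa<qb _ _ = qa<qb
      ... | tri≈ _ eqn _ with refl ← q-inj a<d b<d eqn = ⊥-elim (irrefl a<d ab)
      ... | tri> _ _ gt = t≢f ab (asym b<d a<d (q⇒m b<d a<d gb ga gt))

      badDead : ℕ → ℕ
      badDead t = sumTo d (λ x → 𝟙 (bad x) * dead t x)

      kill-≤ : ∀ D t e x → kill D t (suc e) x ≤ D x + (𝟙 (x ≡ᵇ e dv d) * 1 + (𝟙 (x ≡ᵇ e md d) * 1 + 𝟙 (x ≡ᵇ t) * 1))
      kill-≤ D t e x with x ≡ᵇ e dv d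
      ... | true  = ≤-trans (s≤s z≤n) (m≤n+m _ (D x))
      ... | false with x ≡ᵇ e md d
      ... | true  = ≤-trans (s≤s z≤n) (m≤n+m _ (D x))
      ... | false with x ≡ᵇ t
      ... | true  = m≤n+m 1 (D x)
      ... | false = m≤m+n (D x) 0

      -- A cycle of three good symbols would be a cycle of strict inequalities between their
      -- positions `q`.
      some-bad : ∀ {t a b} → t < d → Cycle (dead t) t a b →
                 ∃[ v ] (v ≡ t ⊎ v ≡ a ⊎ v ≡ b) × bad v ≡ true
      some-bad {t} {a} {b} t<d C with bad t in Bt | bad a in Ba | bad b in Bb
      ... | true  | _     | _     = t , inj₁ refl , Bt
      ... | _     | true  | _     = a , inj₂ (inj₁ refl) , Ba
      ... | _     | _     | true  = b , inj₂ (inj₂ refl) , Bb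
      ... | false | false | false = contradiction
        (<-trans (m⇒q t<d (<-trans a<t t<d) Bt Ba ta) (<-trans (m⇒q (<-trans a<t t<d) (<-trans b<t t<d) Ba Bb ab)
          (m⇒q (<-trans b<t t<d) t<d Bb Bt bt))) (<-irrefl refl)
        where open Cycle C

      -- A step kills nothing beyond its own symbol. Hence `t` is alive when its step begins, and
      -- each hit kills three symbols that were all alive, so that the bad one among them is newly
      -- dead.
      fresh : ∀ t x → t ≤ x → dead t x ≡ 0
      fresh zero    x _   = refl
      fresh (suc t) x t<x with scanTo (dead t) t (d * d) in found
      ... | zero  = fresh t x (<⇒≤ t<x)
      ... | suc e with cyc⇒Cycle (dead t) t e (proj₂ (scan-sound (dead t) t (d * d) found))
      ...   | C rewrite ≡ᵇ-false (≢-sym (<⇒≢ (<-trans (Cycle.a<t C) t<x)))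
                      | ≡ᵇ-false (≢-sym (<⇒≢ (<-trans (Cycle.b<t C) t<x)))
                      | ≡ᵇ-false (≢-sym (<⇒≢ t<x)) = fresh t x (<⇒≤ t<x)

      -- Every killed triple contains a bad symbol.
      dead≤3bad : ∀ t → t ≤ d → sumTo d (dead t) ≤ 3 * badDead t
      dead≤3bad zero    _   = ≤-trans (≤-reflexive (sum-zero d)) z≤n
      dead≤3bad (suc t) t<d with scanTo (dead t) t (d * d) in found
      ... | zero  = dead≤3bad t (<⇒≤ t<d)
      ... | suc e = begin
        sumTo d (kill D₀ t (suc e))               ≤⟨ sum-mono d (λ x _ → kill-≤ D₀ t e x) ⟩
        sumTo d (λ x → D₀ x + (δ a x + (δ b x + δ t x)))  ≡⟨ trans (sum-+ d D₀ _) (cong (sumTo d D₀ +_)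
                                                       (trans (sum-+ d (δ a) _) (cong₂ _+_ (sum-pick d (λ _ → 1) a<d)
                                                       (trans (sum-+ d (δ b) _) (cong₂ _+_ (sum-pick d (λ _ → 1) b<d) (sum-pick d (λ _ → 1) t<d)))))) ⟩
        sumTo d D₀ + 3                            ≤⟨ +-monoˡ-≤ 3 (dead≤3bad t (<⇒≤ t<d)) ⟩
        3 * badDead t + 3 * 1                     ≡⟨ sym (*-distribˡ-+ 3 (badDead t) 1) ⟩
        3 * (badDead t + 1)                       ≤⟨ *-monoʳ-≤ 3 more ⟩
        3 * sumTo d (λ x → 𝟙 (bad x) * kill D₀ t (suc e) x)  ∎
        where
        open ≤-Reasoning
        D₀ = dead t
        a = e dv d
        b = e md d
        δ : ℕ → ℕ → ℕ
        δ v x = 𝟙 (x ≡ᵇ v) * 1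
        C : Cycle D₀ t a b
        C = cyc⇒Cycle D₀ t e (proj₂ (scan-sound D₀ t (d * d) found))
        a<d : a < d
        a<d = <-trans (Cycle.a<t C) t<d
        b<d : b < d
        b<d = <-trans (Cycle.b<t C) t<d
        killed : ∀ {v} → (v ≡ t ⊎ v ≡ a ⊎ v ≡ b) → v < d × D₀ v ≡ 0 × kill D₀ t (suc e) v ≡ 1
        killed (inj₁ refl)        = t<d , fresh t t ≤-refl , kill-t D₀ t e
        killed (inj₂ (inj₁ refl)) = a<d , Cycle.Da C , kill-a D₀ t e
        killed (inj₂ (inj₂ refl)) = b<d , Cycle.Db C , kill-b D₀ t e
        more : badDead t + 1 ≤ sumTo d (λ x → 𝟙 (bad x) * kill D₀ t (suc e) x)
        more with some-bad t<d C
        ... | v , which , Bv with killed which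
        ... | v<d , Dv , kv = begin
          badDead t + 1                                             ≡⟨ cong (badDead t +_) (sym (sum-pick d (λ _ → 1) v<d)) ⟩
          badDead t + sumTo d (δ v)                                 ≡⟨ sym (sum-+ d _ (δ v)) ⟩
          sumTo d (λ x → 𝟙 (bad x) * D₀ x + δ v x)                  ≤⟨ sum-mono d (λ x _ → pointwise x) ⟩
          sumTo d (λ x → 𝟙 (bad x) * kill D₀ t (suc e) x)           ∎
          where
          pointwise : ∀ x → 𝟙 (bad x) * D₀ x + δ v x ≤ 𝟙 (bad x) * kill D₀ t (suc e) x
          pointwise x with x ≡ᵇ v in x≡v
          ... | true with refl ← ≡ᵇ-true⁻¹ {x} x≡v rewrite Bv | Dv | kv = ≤-refl
          ... | false = ≤-trans (≤-reflexive (+-identityʳ _)) (*-monoʳ-≤ (𝟙 (bad x)) (kill≥ D₀ t (suc e) x (dead≤1 t x)))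

      unreliable : ℕ → Bool
      unreliable a = bad a ∨ not (D a ≡ᵇ 0)

      -- Unreliable symbols are bad or dead, and there are at most three dead symbols per dead bad
      -- one; hence 4 = 1 + 3.
      count-unreliable : count d unreliable ≤ 4 * count d bad
      count-unreliable = begin
        count d unreliable                     ≤⟨ sum-mono d (λ x _ → pointwise x) ⟩
        sumTo d (λ x → 𝟙 (bad x) + D x)        ≡⟨ sum-+ d (𝟙 ∘ bad) D ⟩
        count d bad + sumTo d D                ≤⟨ +-monoʳ-≤ (count d bad) (dead≤3bad d ≤-refl) ⟩
        count d bad + 3 * badDead d            ≤⟨ +-monoʳ-≤ (count d bad) (*-monoʳ-≤ 3 (sum-mono d (λ x _ →
                                                    ≤-trans (*-monoʳ-≤ (𝟙 (bad x)) (dead≤1 d x)) (≤-reflexive (*-identityʳ _))))) ⟩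
        4 * count d bad                        ∎
        where
        open ≤-Reasoning
        pointwise : ∀ x → 𝟙 (unreliable x) ≤ 𝟙 (bad x) + D x
        pointwise x with bad x
        ... | true  = s≤s z≤n
        ... | false with D x
        ...   | zero  = z≤n
        ...   | suc _ = s≤s z≤n

      reliable : ∀ {a} → unreliable a ≡ false → bad a ≡ false × D a ≡ 0
      reliable {a} h with bad a | D a
      ... | false | zero = refl , refl

      rank-agrees : AgreeOff d unreliable rank q
      rank-agrees {a} {b} a<d b<d ua ub ra<rb with reliable {a} ua | reliable {b} ub
      ... | ga , Da | gb , Db with <-cmp (q a) (q b)
      ... | tri< qa<qb _ _ = qa<qb
      ... | tri≈ _ eqn _ with refl ← q-inj a<d b<d eqn = contradiction ra<rb (<-irrefl refl)
      ... | tri> _ _ gt = contradiction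
              (<-trans ra<rb (rank-< b<d a<d (trans (before-alive Db Da) (q⇒m b<d a<d gb ga gt)))) (<-irrefl refl)

-- Longest increasing subsequences

-- The maximum by truncated subtraction, the form that the program evaluates; `mn` below is the
-- minimum in the same style.
mx : ℕ → ℕ → ℕ
mx a b = (a ∸ b) + b

mx-sel : ∀ a b → mx a b ≡ a ⊎ mx a b ≡ b
mx-sel a b with ≤-total b a
... | inj₁ b≤a = inj₁ (m∸n+n≡m b≤a)
... | inj₂ a≤b = inj₂ (cong (_+ b) (m≤n⇒m∸n≡0 a≤b))

a≤mx : ∀ a b → a ≤ mx a b
a≤mx a b = ≤-trans (m≤n+m∸n a b) (≤-reflexive (+-comm b (a ∸ b)))

b≤mx : ∀ a b → b ≤ mx a b
b≤mx a b = m≤n+m b (a ∸ b)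

∨-elim : ∀ {a b} → a ∨ b ≡ true → a ≡ true ⊎ b ≡ true
∨-elim {true}  _ = inj₁ refl
∨-elim {false} h = inj₂ h

module LIS (d : ℕ) (s : ℕ → ℕ) where

  below : ℕ → ℕ → Bool
  below e i = (i ≡ᵇ d) ∨ (s e <ᵇ s i)

  -- One more than the length of a longest increasing subsequence that uses only indices below
  -- e and values below s i, where s d counts as infinite.
  longest : ℕ → ℕ → ℕ
  longest i zero    = 1
  longest i (suc e) = if below e i then mx (longest i e) (suc (longest e e)) else longest i e

  longest≤ : ∀ i e → longest i e ≤ suc e
  longest≤ i zero    = ≤-refl
  longest≤ i (suc e) with below e i
  ... | false = m≤n⇒m≤1+n (longest≤ i e)
  ... | true with mx-sel (longest i e) (suc (longest e e))
  ...   | inj₁ eqn = ≤-trans (≤-reflexive eqn) (m≤n⇒m≤1+n (longest≤ i e))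
  ...   | inj₂ eqn = ≤-trans (≤-reflexive eqn) (s≤s (longest≤ e e))

  -- `d` minus the length of a longest increasing subsequence; `longest` counts one too many, hence
  -- `suc d`.
  gap : ℕ
  gap = suc d ∸ longest d d

  below-kept : ∀ {u : ℕ → Bool} → (∀ {i j} → i < j → j < d → u i ≡ false → u j ≡ false → s i < s j) →
    ∀ {e i} → e < i → i ≤ d → u e ≡ false → i ≡ d ⊎ u i ≡ false → below e i ≡ true
  below-kept inc {e} {i} e<i i≤d ue (inj₁ refl) rewrite ≡ᵇ-true {i} refl = refl
  below-kept inc {e} {i} e<i i≤d ue (inj₂ ui) with i ≡ᵇ d in i≡d
  ... | true  = refl
  ... | false = <ᵇ-true (inc e<i (≤∧≢⇒< i≤d λ eqn → contradiction (trans (sym i≡d) (≡ᵇ-true eqn)) λ ()) ue ui)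

  -- If `e` is outside `u`, its value lies below that of `i`, and the subsequence below `e` is
  -- extended by `e`; otherwise nothing is to be counted.
  longest-≥ : ∀ {u : ℕ → Bool} → (∀ {i j} → i < j → j < d → u i ≡ false → u j ≡ false → s i < s j) →
    ∀ e i → e ≤ i → i ≤ d → (i ≡ d ⊎ u i ≡ false) → 1 + count e (not ∘ u) ≤ longest i e
  longest-≥ {u} inc zero    i e≤i i≤d _    = ≤-refl
  longest-≥ {u} inc (suc e) i e<i i≤d good with u e in ue
  ... | true = ≤-trans (≤-reflexive (cong suc (+-identityʳ _)))
                 (≤-trans (longest-≥ {u} inc e i (<⇒≤ e<i) i≤d good) mono)
    where
    mono : longest i e ≤ longest i (suc e)
    mono with below e i
    ... | true  = a≤mx (longest i e) (suc (longest e e))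
    ... | false = ≤-refl
  ... | false rewrite below-kept {u} inc e<i i≤d ue good = ≤-trans (≤-reflexive (cong suc (+-comm _ 1)))
        (≤-trans (s≤s (longest-≥ {u} inc e e ≤-refl (≤-trans (<⇒≤ e<i) i≤d) (inj₂ ue))) (b≤mx (longest i e) (suc (longest e e))))

  complement : ∀ e (u : ℕ → Bool) → count e u + count e (not ∘ u) ≡ e
  complement e u = trans (sym (sum-+ e _ _)) (trans (sum-cong e (λ i _ → one (u i)))
                         (trans (sum-const e 1) (*-identityʳ e)))
    where
    one : ∀ b → 𝟙 b + 𝟙 (not b) ≡ 1
    one true  = refl
    one false = refl

  gap-≤ : ∀ {u : ℕ → Bool} → (∀ {i j} → i < j → j < d → u i ≡ false → u j ≡ false → s i < s j) →
          gap ≤ count d u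
  gap-≤ {u} inc = begin
    suc d ∸ longest d d                              ≤⟨ ∸-monoʳ-≤ (suc d) (longest-≥ {u} inc d d ≤-refl ≤-refl (inj₁ refl)) ⟩
    d ∸ count d (not ∘ u)                            ≡⟨ cong (_∸ count d (not ∘ u)) (sym (complement d u)) ⟩
    count d u + count d (not ∘ u) ∸ count d (not ∘ u)  ≡⟨ m+n∸n≡m (count d u) (count d (not ∘ u)) ⟩
    count d u                                        ∎
    where open ≤-Reasoning

  -- A witness for the value `v` of `longest i e`, where `K` is the set of indices used. `last` is
  -- void for the sentinel `i` equal to `d`.
  record Chain (i e v : ℕ) (K : ℕ → Bool) : Set where
    field
      size  : 1 + count e K ≡ v
      bound : ∀ {p} → K p ≡ true → p < e
      inc   : ∀ {p q} → p < q → K p ≡ true → K q ≡ true → s p < s q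
      last  : ∀ {p} → i < d → K p ≡ true → s p < s i

  widen : ∀ {i e v v′ K} → Chain i e v K → v′ ≡ v → Chain i (suc e) v′ K
  widen {i} {e} {K = K} C refl = record
    { size  = trans (cong suc (trans (cong (λ b → count e K + 𝟙 b) off) (+-identityʳ _))) size
    ; bound = λ h → m<n⇒m<1+n (bound h)
    ; inc   = inc
    ; last  = last
    }
    where
    open Chain C
    off : K e ≡ false
    off with K e in Ke
    ... | true  = contradiction (bound Ke) (<-irrefl refl)
    ... | false = refl

  chain : ∀ e i → e ≤ i → i ≤ d → ∃ (Chain i e (longest i e))
  chain zero    i e≤i i≤d = (λ _ → false) , record { size = refl ; bound = λ () ; inc = λ _ () ; last = λ _ () }
  chain (suc e) i e<i i≤d with chain e i (<⇒≤ e<i) i≤d | chain e e ≤-refl (≤-trans (<⇒≤ e<i) i≤d) | below e i in eb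
  ... | K , C | L , C′ | false = K , widen C refl
  ... | K , C | L , C′ | true with mx-sel (longest i e) (suc (longest e e))
  ...   | inj₁ eqn = K , widen C eqn
  ...   | inj₂ eqn = M , record { size = size′ ; bound = bound′ ; inc = inc′ ; last = last′ }
    where
    open Chain C′
    M : ℕ → Bool
    M p = (p ≡ᵇ e) ∨ L p
    e<d : e < d
    e<d = <-≤-trans e<i i≤d
    size′ : suc (count e M + 𝟙 (M e)) ≡ mx (longest i e) (suc (longest e e))
    size′ rewrite ≡ᵇ-true {e} refl = trans (cong suc (+-comm _ 1)) (trans
      (cong (λ c → 2 + c) (sum-cong e λ p p<e → cong (λ b → 𝟙 (b ∨ L p)) (≡ᵇ-false (<⇒≢ p<e))))
      (trans (cong suc size) (sym eqn)))
    cases : ∀ {p} → M p ≡ true → p ≡ e ⊎ L p ≡ true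
    cases {p} h with ∨-elim {p ≡ᵇ e} h
    ... | inj₁ h₁ = inj₁ (≡ᵇ-true⁻¹ h₁)
    ... | inj₂ h₂ = inj₂ h₂
    bound′ : ∀ {p} → M p ≡ true → p < suc e
    bound′ h with cases h
    ... | inj₁ refl = ≤-refl
    ... | inj₂ Lp   = m<n⇒m<1+n (bound Lp)
    inc′ : ∀ {p q} → p < q → M p ≡ true → M q ≡ true → s p < s q
    inc′ p<q Mp Mq with cases Mp | cases Mq
    ... | inj₁ refl | inj₁ refl = contradiction p<q (<-irrefl refl)
    ... | inj₁ refl | inj₂ Lq   = contradiction (<-trans p<q (bound Lq)) (<-irrefl refl)
    ... | inj₂ Lp   | inj₁ refl = last e<d Lp
    ... | inj₂ Lp   | inj₂ Lq   = inc p<q Lp Lq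
    last′ : ∀ {p} → i < d → M p ≡ true → s p < s i
    last′ {p} i<d Mp with ∨-elim {i ≡ᵇ d} eb
    ... | inj₁ h = contradiction (≡ᵇ-true⁻¹ h) (<⇒≢ i<d)
    ... | inj₂ h with cases Mp
    ...   | inj₁ refl = <ᵇ-true⁻¹ h
    ...   | inj₂ Lp   = <-trans (last e<d Lp) (<ᵇ-true⁻¹ h)

  gap-attained : ∃[ K ] count d (not ∘ K) ≡ gap × (∀ {p q} → p < q → K p ≡ true → K q ≡ true → s p < s q)
  gap-attained with chain d d ≤-refl ≤-refl
  ... | K , C = K , eqn , C .Chain.inc
    where
    open ≡-Reasoning
    eqn : count d (not ∘ K) ≡ suc d ∸ longest d d
    eqn = begin
      count d (not ∘ K)                                ≡⟨ sym (m+n∸m≡n (count d K) _) ⟩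
      count d K + count d (not ∘ K) ∸ count d K        ≡⟨ cong (_∸ count d K) (complement d K) ⟩
      suc d ∸ (1 + count d K)                          ≡⟨ cong (suc d ∸_) (C .Chain.size) ⟩
      suc d ∸ longest d d                              ∎

-- The positions `p` increase along `x`, so the symbols outside `u` form an increasing subsequence
-- of `q ∘ x`.
gap-≤-count : ∀ {d x p} → InverseOn d x p → ∀ {u} q → AgreeOff d u p q → LIS.gap d (q ∘ x) ≤ count d u
gap-≤-count {d} {x} {p} I {u} q agree =
  ≤-trans (LIS.gap-≤ d (q ∘ x) {u ∘ x} inc) (≤-reflexive (sum-reindex I (𝟙 ∘ u)))
  where
  inc : ∀ {i j} → i < j → j < d → u (x i) ≡ false → u (x j) ≡ false → q (x i) < q (x j)
  inc {i} {j} i<j j<d ui uj =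
    agree (x< I i<d) (x< I j<d) ui uj (subst₂ _<_ (sym (p∘x I i<d)) (sym (p∘x I j<d)) i<j)
    where
    i<d : i < d
    i<d = <-trans i<j j<d

module _ {d} (σ z : Permutation′ d) (pz : ℕ → ℕ) (pz≡ : ∀ {a} → a < d → posOf z a ≡ pz a) where

  open LIS d (pz ∘ seqOf σ)

  private I = inverseOn σ

  Δ≤gap : Δ σ z ≤ gap
  Δ≤gap with gap-attained
  ... | K , size , inc = ≤-trans (Δ≤count σ z u agree) (≤-reflexive (trans (sym (sum-reindex I (𝟙 ∘ u)))
          (trans (sum-cong d λ i i<d → cong (𝟙 ∘ not ∘ K) (p∘x I i<d)) size)))
    where
    u : ℕ → Bool
    u a = not (K (posOf σ a))
    kept : ∀ {b} → not b ≡ false → b ≡ true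
    kept {true} _ = refl
    agree : AgreeOff d u (posOf σ) (posOf z)
    agree {a} {b} a<d b<d ua ub lt′ = subst₂ _<_ (back a<d) (back b<d) (inc lt′ (kept ua) (kept ub))
      where
      back : ∀ {a} → a < d → pz (seqOf σ (posOf σ a)) ≡ posOf z a
      back {a} a<d = trans (cong pz (x∘p I a<d)) (sym (pz≡ a<d))

-- Averaging and voting

InjectiveOn : ℕ → (ℕ → ℕ) → Set
InjectiveOn d p = ∀ {a b} → a < d → b < d → p a ≡ p b → a ≡ b

-- Agreement would carry a pair that `p` orders the other way to one that `q` orders the other way,
-- and injectivity excludes ties.
AgreeOff-sym : ∀ {d u p q} → InjectiveOn d p → AgreeOff d u p q → AgreeOff d u q p
AgreeOff-sym {p = p} p-inj agree {a} {b} a<d b<d ua ub qa<qb with <-cmp (p a) (p b)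
... | tri< l _ _ = l
... | tri≈ _ e _ with refl ← p-inj a<d b<d e = contradiction qa<qb (<-irrefl refl)
... | tri> _ _ g = contradiction (<-trans qa<qb (agree b<d a<d ub ua g)) (<-irrefl refl)

∨-false : ∀ {a b} → a ∨ b ≡ false → a ≡ false × b ≡ false
∨-false {false} h = refl , h

AgreeOff-trans : ∀ {d u v p q r} → AgreeOff d u p q → AgreeOff d v q r → AgreeOff d (λ a → u a ∨ v a) p r
AgreeOff-trans {u = u} f g {a} {b} a<d b<d ha hb pa<pb =
  g a<d b<d (proj₂ (∨-false {u a} ha)) (proj₂ (∨-false {u b} hb))
    (f a<d b<d (proj₁ (∨-false {u a} ha)) (proj₁ (∨-false {u b} hb)) pa<pb)

count-∨ : ∀ d u v → count d (λ a → u a ∨ v a) ≤ count d u + count d v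
count-∨ d u v = ≤-trans (sum-mono d λ a _ → pointwise (u a) (v a)) (≤-reflexive (sum-+ d _ _))
  where
  pointwise : ∀ a b → 𝟙 (a ∨ b) ≤ 𝟙 a + 𝟙 b
  pointwise true  b = s≤s z≤n
  pointwise false b = ≤-refl

shared : ℕ → (ℕ → Bool) → (ℕ → Bool) → ℕ
shared d u v = sumTo d (λ a → 𝟙 (u a) * 𝟙 (v a))

count-∨-shared : ∀ d u v → count d (λ a → u a ∨ v a) + shared d u v ≡ count d u + count d v
count-∨-shared d u v = trans (sym (sum-+ d _ _)) (trans (sum-cong d λ a _ → pointwise (u a) (v a)) (sum-+ d _ _))
  where
  pointwise : ∀ a b → 𝟙 (a ∨ b) + 𝟙 a * 𝟙 b ≡ 𝟙 a + 𝟙 b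
  pointwise true  true  = refl
  pointwise true  false = refl
  pointwise false b     = +-identityʳ (𝟙 b)

-- `χ` will be the indicator of a cluster; as a weight it lets sums over the cluster range over all
-- indices.
module Weighted (n : ℕ) (χ : ℕ → ℕ) where

  W : (ℕ → ℕ) → ℕ
  W f = sumTo n (λ x → χ x * f x)

  N : ℕ
  N = sumTo n χ

  W-mono : ∀ {f g} → (∀ x → x < n → f x ≤ g x) → W f ≤ W g
  W-mono h = sum-mono n λ x x<n → *-monoʳ-≤ (χ x) (h x x<n)

  W-cong : ∀ {f g} → (∀ x → x < n → f x ≡ g x) → W f ≡ W g
  W-cong h = sum-cong n λ x x<n → cong (χ x *_) (h x x<n)

  W-+ : ∀ f g → W (λ x → f x + g x) ≡ W f + W g
  W-+ f g = trans (sum-cong n λ x _ → *-distribˡ-+ (χ x) (f x) (g x)) (sum-+ n _ _)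

  W-* : ∀ c f → W (λ x → c * f x) ≡ c * W f
  W-* c f = trans (sum-cong n λ x _ → solve* (χ x) c (f x)) (sum-* n c _)
    where
    solve* : ∀ a b c → a * (b * c) ≡ b * (a * c)
    solve* = solve-∀

  W-const : ∀ c → W (λ _ → c) ≡ N * c
  W-const c = trans (sum-cong n λ x _ → *-comm (χ x) c) (trans (sum-* n c χ) (*-comm c N))

  W-sum : ∀ m (f : ℕ → ℕ → ℕ) → W (λ x → sumTo m (λ r → f r x)) ≡ sumTo m (λ r → W (f r))
  W-sum m f = trans (sum-cong n λ x _ → sym (sum-* m (χ x) (λ r → f r x))) (sum-swap n m _)

  W-zero : N ≡ 0 → ∀ f → W f ≡ 0
  W-zero N≡0 f = n≤0⇒n≡0 (≤-trans (sum-mono n λ x x<n → ≤-reflexive (cong (_* f x) (χ≡0 x x<n)))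
                                  (≤-reflexive (sum-zero n)))
    where
    χ≡0 : ∀ x → x < n → χ x ≡ 0
    χ≡0 x x<n = n≤0⇒n≡0 (≤-trans (term≤sum n χ x<n) (≤-reflexive N≡0))

  -- The least value is at most the weighted average. The minimiser may itself have weight 0, so it
  -- need not belong to the cluster.
  average : 1 ≤ n → ∀ f → ∃[ x ] x < n × N * f x ≤ W f
  average 1≤n f with argmin n f 1≤n
  ... | x , x<n , min = x , x<n , ≤-trans (≤-reflexive (sym (W-const (f x)))) (W-mono min)

  module Overlap (g : ℕ → ℕ → ℕ) where

    G : ℕ → ℕ
    G x = W (g x)

    Q : ℕ
    Q = W G

    pairs : ℕ → (ℕ → ℕ) → ℕ
    pairs m x = sumTo m (λ r → sumTo r (λ r′ → g (x r′) (x r)))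

    -- Divided by `N * N`, this is the overlap among the indices chosen so far plus the expected
    -- overlap of one further random index with them.
    E : ℕ → (ℕ → ℕ) → ℕ
    E m x = N * (N * pairs m x) + N * sumTo m (λ r → G (x r))

    -- This is 2^m - 1; `grow 5` is 31.
    grow : ℕ → ℕ
    grow zero    = 0
    grow (suc m) = 2 * grow m + 1

    -- Choosing the next index by averaging at most doubles E, up to Q.
    greedy : 1 ≤ n → ∀ m → ∃[ x ] (∀ {r} → r < m → x r < n) × E m x ≤ grow m * Q
    greedy 1≤n zero = (λ _ → 0) , (λ ()) , ≤-reflexive (zero-E N)
      where
      zero-E : ∀ N → N * (N * 0) + N * 0 ≡ 0
      zero-E = solve-∀
    greedy 1≤n (suc m) with greedy 1≤n m
    ... | x , x<n , Ex with average 1≤n (λ y → N * sumTo m (λ r → g (x r) y) + G y)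
    ... | y , y<n , avg = x′ , x′<n , bound
      where
      x′ : ℕ → ℕ
      x′ r = if r ≡ᵇ m then y else x r
      x′m : x′ m ≡ y
      x′m rewrite ≡ᵇ-true {m} refl = refl
      x′r : ∀ {r} → r < m → x′ r ≡ x r
      x′r r<m rewrite ≡ᵇ-false (<⇒≢ r<m) = refl
      x′<n : ∀ {r} → r < suc m → x′ r < n
      x′<n {r} r<1+m with m≤n⇒m<n∨m≡n (≤-pred r<1+m)
      ... | inj₁ r<m  = subst (_< n) (sym (x′r r<m)) (x<n r<m)
      ... | inj₂ refl = subst (_< n) (sym x′m) y<n
      S = sumTo m (λ r → G (x r))
      s = sumTo m (λ r → g (x r) y)
      pairs≡ : pairs (suc m) x′ ≡ pairs m x + s
      pairs≡ = cong₂ _+_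
        (sum-cong m λ r r<m → sum-cong r λ r′ r′<r → cong₂ g (x′r (<-trans r′<r r<m)) (x′r r<m))
        (sum-cong m λ r r<m → cong₂ g (x′r r<m) x′m)
      sumG≡ : sumTo (suc m) (λ r → G (x′ r)) ≡ S + G y
      sumG≡ = cong₂ _+_ (sum-cong m λ r r<m → cong G (x′r r<m)) (cong G x′m)
      average≡ : W (λ y → N * sumTo m (λ r → g (x r) y) + G y) ≡ N * S + Q
      average≡ = trans (W-+ _ G) (cong (_+ Q) (trans (W-* N _) (cong (N *_) (W-sum m (λ r y → g (x r) y)))))
      rearrange : ∀ N p s S Gy → N * (N * (p + s)) + N * (S + Gy) ≡ (N * (N * p) + N * S) + N * (N * s + Gy)
      rearrange = solve-∀
      last : ∀ N p S Q → (N * (N * p) + N * S) + (N * S + Q) ≤ 2 * (N * (N * p) + N * S) + Q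
      last N p S Q = ≤-trans (+-monoʳ-≤ (N * (N * p) + N * S) (+-monoˡ-≤ Q (m≤n+m (N * S) (N * (N * p)))))
        (≤-reflexive (twice (N * (N * p) + N * S) Q))
        where
        twice : ∀ a Q → a + (a + Q) ≡ 2 * a + Q
        twice = solve-∀
      finish : ∀ c Q → 2 * (c * Q) + Q ≡ (2 * c + 1) * Q
      finish = solve-∀
      bound : E (suc m) x′ ≤ grow (suc m) * Q
      bound = begin
        E (suc m) x′                                                  ≡⟨ cong₂ (λ a b → N * (N * a) + N * b) pairs≡ sumG≡ ⟩
        N * (N * (pairs m x + s)) + N * (S + G y)                     ≡⟨ rearrange N (pairs m x) s S (G y) ⟩
        -- The choice of `y` bounds the new terms by their average, whose first term `N * S` is
        -- again a part of `E m x`.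
        E m x + N * (N * s + G y)                                     ≤⟨ +-monoʳ-≤ (E m x) (≤-trans avg (≤-reflexive average≡)) ⟩
        E m x + (N * S + Q)                                           ≤⟨ last N (pairs m x) S Q ⟩
        2 * E m x + Q                                                 ≤⟨ +-monoˡ-≤ Q (*-monoʳ-≤ 2 Ex) ⟩
        2 * (grow m * Q) + Q                                          ≡⟨ finish (grow m) Q ⟩
        grow (suc m) * Q                                              ∎
        where open ≤-Reasoning

-- Turns the event that a symbol is moved by two voters into pairwise overlaps, which is what
-- `pairs` adds up.
two⇒pair : ∀ m (f : ℕ → ℕ) → (∀ r → f r ≤ 1) →
           𝟙 (1 <ᵇ sumTo m f) ≤ sumTo m (λ r → sumTo r (λ r′ → f r′ * f r))
two⇒pair zero    f f≤1 = z≤n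
two⇒pair (suc m) f f≤1 with f m | f≤1 m
... | zero  | _ rewrite +-identityʳ (sumTo m f) = ≤-trans (two⇒pair m f f≤1) (m≤m+n _ _)
... | suc zero | _ = ≤-trans (atLeast (sumTo m f)) (≤-trans (≤-reflexive (sum-cong m λ r _ → sym (*-identityʳ (f r)))) (m≤n+m _ _))
  where
  atLeast : ∀ S → 𝟙 (1 <ᵇ S + 1) ≤ S
  atLeast zero    = z≤n
  atLeast (suc S) = ≤-trans (𝟙≤1 _) (s≤s z≤n)
... | suc (suc _) | s≤s ()

module Voting (d : ℕ) (P : ℕ → ℕ → ℕ) (x : ℕ → ℕ) where

  vote : ℕ → ℕ → ℕ → ℕ
  vote a b r = 𝟙 (P (x r) a <ᵇ P (x r) b)

  votes : ℕ → ℕ → ℕ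
  votes a b = sumTo 5 (vote a b)

  maj : ℕ → ℕ → Bool
  maj a b = 2 <ᵇ votes a b

  module _ (P-inj : ∀ {r} → r < 5 → InjectiveOn d (P (x r))) where

    -- Injective positions admit no ties, so every voter backs exactly one of the two orders; as
    -- five is odd, the majority is a tournament.
    votes-total : ∀ {a b} → a < d → b < d → a ≢ b → votes a b + votes b a ≡ 5
    votes-total {a} {b} a<d b<d a≢b = trans (sym (sum-+ 5 (vote a b) (vote b a)))
      (sum-cong 5 {f = λ r → vote a b r + vote b a r} {g = λ _ → 1} one)
      where
      one : ∀ r → r < 5 → vote a b r + vote b a r ≡ 1
      one r r<5 with <-cmp (P (x r) a) (P (x r) b)
      ... | tri< l _ _ rewrite <ᵇ-true l | <ᵇ-false (<⇒≤ l) = refl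
      ... | tri≈ _ e _ = contradiction (P-inj r<5 a<d b<d e) a≢b
      ... | tri> _ _ g rewrite <ᵇ-true g | <ᵇ-false (<⇒≤ g) = refl

    maj-asym : ∀ {a b} → a < d → b < d → maj a b ≡ true → maj b a ≡ false
    maj-asym {a} {b} a<d b<d ab with a ≟ b
    ... | yes refl = contradiction (<ᵇ-true⁻¹ {2} {votes a a} ab) (≤⇒≯ (≤-trans (≤-reflexive none) z≤n))
      where
      none : votes a a ≡ 0
      none = trans (sum-cong 5 {f = vote a a} {g = λ _ → 0} λ r _ → cong 𝟙 (<ᵇ-false {P (x r) a} ≤-refl)) (sum-zero 5)
    ... | no a≢b = <ᵇ-false (+-cancelˡ-≤ 3 (votes b a) 2
          (≤-trans (+-monoˡ-≤ (votes b a) (<ᵇ-true⁻¹ {2} {votes a b} ab)) (≤-reflexive (votes-total a<d b<d a≢b))))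

    maj-total : ∀ {a b} → a < d → b < d → a ≢ b → maj a b ≡ true ⊎ maj b a ≡ true
    maj-total {a} {b} a<d b<d a≢b with 2 <? votes a b
    ... | yes l = inj₁ (<ᵇ-true l)
    ... | no ¬l = inj₂ (<ᵇ-true (+-cancelˡ-≤ 2 3 (votes b a)
          (≤-trans (≤-reflexive (sym (votes-total a<d b<d a≢b))) (+-monoˡ-≤ (votes b a) (≮⇒≥ ¬l)))))

  -- A pair of symbols that are each moved in at most one of the five voters is ordered
  -- correctly by at least three of them.
  module _ (u : ℕ → ℕ → Bool) (q : ℕ → ℕ) (agree : ∀ {r} → r < 5 → AgreeOff d (u (x r)) q (P (x r))) where

    moves : ℕ → ℕ → ℕ
    moves a r = 𝟙 (u (x r) a)

    moved : ℕ → ℕ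
    moved a = sumTo 5 (moves a)

    bad : ℕ → Bool
    bad a = 1 <ᵇ moved a

    good⇒maj : ∀ {a b} → a < d → b < d → bad a ≡ false → bad b ≡ false → q a < q b → maj a b ≡ true
    good⇒maj {a} {b} a<d b<d ga gb qa<qb = <ᵇ-true (+-cancelʳ-≤ 2 3 (votes a b) (begin
      5                                    ≡⟨ sym (sum-const 5 1) ⟩
      sumTo 5 (λ _ → 1)                    ≤⟨ sum-mono 5 {f = λ _ → 1} {g = λ r → vote a b r + (moves a r + moves b r)} enough ⟩
      sumTo 5 (λ r → vote a b r + (moves a r + moves b r))
                                           ≡⟨ trans (sum-+ 5 (vote a b) (λ r → moves a r + moves b r)) (cong (votes a b +_) (sum-+ 5 (moves a) (moves b))) ⟩
      votes a b + (moved a + moved b)      ≤⟨ +-monoʳ-≤ (votes a b) (+-mono-≤ (few a ga) (few b gb)) ⟩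
      votes a b + 2                        ∎))
      where
      open ≤-Reasoning
      few : ∀ a → bad a ≡ false → moved a ≤ 1
      few a ga = ≮⇒≥ λ l → t≢f (<ᵇ-true {1} {moved a} l) ga
      enough : ∀ r → r < 5 → 1 ≤ vote a b r + (moves a r + moves b r)
      enough r r<5 with u (x r) a in ua | u (x r) b in ub
      ... | true  | _     = ≤-trans (s≤s z≤n) (m≤n+m _ (vote a b r))
      ... | false | true  = m≤n+m 1 (vote a b r)
      ... | false | false rewrite <ᵇ-true (agree r<5 a<d b<d ua ub qa<qb) = ≤-refl

    count-bad : count d bad ≤ sumTo 5 (λ r → sumTo r (λ r′ → shared d (u (x r′)) (u (x r))))
    count-bad = begin
      count d bad                                                                  ≤⟨ sum-mono d (λ a _ → two⇒pair 5 (moves a) (λ r → 𝟙≤1 (u (x r) a))) ⟩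
      sumTo d (λ a → sumTo 5 (λ r → sumTo r (λ r′ → 𝟙 (u (x r′) a) * 𝟙 (u (x r) a))))  ≡⟨ sum-swap d 5 (λ a r → sumTo r (λ r′ → moves a r′ * moves a r)) ⟩
      sumTo 5 (λ r → sumTo d (λ a → sumTo r (λ r′ → 𝟙 (u (x r′) a) * 𝟙 (u (x r) a))))  ≡⟨ sum-cong 5 {f = λ r → sumTo d (λ a → sumTo r (λ r′ → moves a r′ * moves a r))} {g = λ r → sumTo r (λ r′ → shared d (u (x r′)) (u (x r)))} (λ r _ → sum-swap d r (λ a r′ → moves a r′ * moves a r)) ⟩
      sumTo 5 (λ r → sumTo r (λ r′ → shared d (u (x r′)) (u (x r))))              ∎
      where open ≤-Reasoning

-- Candidates

-- `ix n c r` is digit `r` of `c` in base `n`, least significant first, so that a number below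
-- `n ^ 5` encodes five indices.
quot ix : ℕ → ℕ → ℕ → ℕ
quot n c zero    = c
quot n c (suc r) = quot n c r dv n
ix n c r = quot n c r md n

quot-suc : ∀ n c r → quot n c (suc r) ≡ quot n (c dv n) r
quot-suc n c zero    = refl
quot-suc n c (suc r) = cong (_dv n) (quot-suc n c r)

encode : ∀ n m (x : ℕ → ℕ) → (∀ {r} → r < m → x r < n) →
         ∃[ c ] c < n ^ m × (∀ {r} → r < m → ix n c r ≡ x r)
encode n zero    x x<n = 0 , s≤s z≤n , λ ()
encode n (suc m) x x<n with encode n m (x ∘ suc) (x<n ∘ s≤s)
... | c , c< , ix≡ = c * n + x 0 , subst (c * n + x 0 <_) (*-comm (n ^ m) n) (pair< c< (x<n (s≤s z≤n))) , digit
  where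
  digit : ∀ {r} → r < suc m → ix n (c * n + x 0) r ≡ x r
  digit {zero}  _ = md-pair c (x<n (s≤s z≤n))
  digit {suc r} (s≤s r<m) = trans
    (cong (_md n) (trans (quot-suc n (c * n + x 0) r) (cong (λ z → quot n z r) (dv-pair c (x<n (s≤s z≤n))))))
    (ix≡ r<m)

ix< : ∀ {n} → 1 ≤ n → ∀ c r → ix n c r < n
ix< {suc n} _ c r = m%n<n (quot (suc n) c r) (suc n)

-- The two cases of the approximation argument: N is the weight of a cluster, A its total
-- distance to the centre, Q the total overlap and w the cost of the chosen candidate.
large-overlap : ∀ K L N A Q w → 2 * K ≡ L + 1 → 1 ≤ N →
                N * A ≤ K * Q → N * w + Q ≤ 2 * (N * A) → K * w ≤ L * A
large-overlap K L (suc N) A Q w 2K≡L+1 _ large h = *-cancelˡ-≤ (suc N) (+-cancelʳ-≤ (suc N * A) _ _ (begin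
  -- Adding `suc N * A`, to be cancelled at the end, avoids subtracting the overlap.
  suc N * (K * w) + suc N * A      ≤⟨ +-monoʳ-≤ (suc N * (K * w)) large ⟩
  suc N * (K * w) + K * Q          ≡⟨ e₁ K (suc N) w Q ⟩
  K * (suc N * w + Q)              ≤⟨ *-monoʳ-≤ K h ⟩
  K * (2 * (suc N * A))            ≡⟨ e₂ K (suc N * A) ⟩
  (2 * K) * (suc N * A)            ≡⟨ cong (_* (suc N * A)) 2K≡L+1 ⟩
  (L + 1) * (suc N * A)            ≡⟨ e₃ L (suc N) A ⟩
  suc N * (L * A) + suc N * A      ∎))
  where
  open ≤-Reasoning
  e₁ : ∀ K N w Q → N * (K * w) + K * Q ≡ K * (N * w + Q)
  e₁ = solve-∀
  e₂ : ∀ K s → K * (2 * s) ≡ (2 * K) * s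
  e₂ = solve-∀
  e₃ : ∀ L N s → (L + 1) * (N * s) ≡ N * (L * s) + N * s
  e₃ = solve-∀

small-overlap : ∀ K L C N A Q w → K + C ≤ L → 1 ≤ N →
                K * Q ≤ N * A → N * w ≤ N * A + C * Q → K * w ≤ L * A
small-overlap K L C (suc N) A Q w K+C≤L _ small h = *-cancelˡ-≤ (suc N) (begin
  suc N * (K * w)                          ≡⟨ e₁ (suc N) K w ⟩
  K * (suc N * w)                          ≤⟨ *-monoʳ-≤ K h ⟩
  K * (suc N * A + C * Q)                  ≡⟨ e₂ K (suc N) A C Q ⟩
  suc N * (K * A) + C * (K * Q)            ≤⟨ +-monoʳ-≤ (suc N * (K * A)) (*-monoʳ-≤ C small) ⟩
  suc N * (K * A) + C * (suc N * A)        ≡⟨ e₃ K (suc N) A C ⟩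
  suc N * ((K + C) * A)                    ≤⟨ *-monoʳ-≤ (suc N) (*-monoˡ-≤ A K+C≤L) ⟩
  suc N * (L * A)                          ∎)
  where
  open ≤-Reasoning
  e₁ : ∀ N K w → N * (K * w) ≡ K * (N * w)
  e₁ = solve-∀
  e₂ : ∀ K N s C Q → K * (N * s + C * Q) ≡ N * (K * s) + C * (K * Q)
  e₂ = solve-∀
  e₃ : ∀ K N s C → N * (K * s) + C * (N * s) ≡ N * ((K + C) * s)
  e₃ = solve-∀

module Candidates (n d : ℕ) (X P : ℕ → ℕ → ℕ) where

  majority : ℕ → ℕ → ℕ → Bool
  majority c = Voting.maj d P (ix n c)

  place : ℕ → ℕ → ℕ
  place c = Elimination.rank d (majority c)

  -- Abstract, since normalising it is expensive.
  abstract
    D : ℕ → ℕ → ℕ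
    D j c = LIS.gap d (place c ∘ X j)

    D≡gap : ∀ j c → D j c ≡ LIS.gap d (place c ∘ X j)
    D≡gap j c = refl

  module _ (1≤n : 1 ≤ n) (I : ∀ {x} → x < n → InverseOn d (X x) (P x)) where

    P-inj : ∀ {x} → x < n → InjectiveOn d (P x)
    P-inj x<n = InverseOn-injective (I x<n)

    module MajorityCorrect c = Elimination.Correct d (majority c)
      (Voting.maj-asym d P (ix n c) (λ {r} _ → P-inj (ix< 1≤n c r)))
      (Voting.maj-total d P (ix n c) (λ {r} _ → P-inj (ix< 1≤n c r)))

    -- The order `q` mediates: off `v` it agrees with the input permutation, and off the unreliable
    -- symbols with the candidate.
    D-near : ∀ c (bad : ℕ → Bool) (q : ℕ → ℕ) → InjectiveOn d q →
      (∀ {a b} → a < d → b < d → bad a ≡ false → bad b ≡ false → q a < q b → majority c a b ≡ true) →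
      ∀ {x v} → x < n → AgreeOff d v (P x) q → D x c ≤ count d v + 4 * count d bad
    D-near c bad q q-inj q⇒m {x} {v} x<n agree = begin
      D x c                                  ≡⟨ D≡gap x c ⟩
      LIS.gap d (place c ∘ X x)              ≤⟨ gap-≤-count (I x<n) (place c) (AgreeOff-trans {p = P x} {q} {place c} agree
                                                  (AgreeOff-sym {p = place c} {q} rank-injective rank-agrees)) ⟩
      count d (λ a → v a ∨ unreliable a)     ≤⟨ count-∨ d v unreliable ⟩
      count d v + count d unreliable         ≤⟨ +-monoʳ-≤ (count d v) count-unreliable ⟩
      count d v + 4 * count d bad            ∎
      where
      open ≤-Reasoning
      open MajorityCorrect c
      open Approximate bad q q-inj q⇒m

    module _ (χ : ℕ → ℕ) (q : ℕ → ℕ) (q-inj : InjectiveOn d q) (u : ℕ → ℕ → Bool)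
             (agree : ∀ {x} → x < n → AgreeOff d (u x) (P x) q) where

      open Weighted n χ

      g : ℕ → ℕ → ℕ
      g x y = shared d (u x) (u y)

      open Overlap g

      size : ℕ → ℕ
      size x = count d (u x)

      agree⁻¹ : ∀ {x} → x < n → AgreeOff d (u x) q (P x)
      agree⁻¹ {x} x<n = AgreeOff-sym {p = P x} {q} (P-inj x<n) (agree x<n)

      union : ℕ → ℕ → ℕ
      union x y = count d (λ a → u x a ∨ u y a)

      -- A large average overlap makes some input permutation a good median.
      input-candidate : ∃[ c ] c < n ^ 5 × N * W (λ x → D x c) + Q ≤ 2 * (N * W size)
      input-candidate with average 1≤n (λ y → W (λ x → union y x))
      ... | y , y<n , avg with encode n 5 (λ _ → y) (λ _ → y<n)
      ... | c , c< , ix≡ = c , c< , (begin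
        N * W (λ x → D x c) + Q                              ≤⟨ +-monoˡ-≤ Q (*-monoʳ-≤ N (W-mono near)) ⟩
        N * W (λ x → union y x) + Q                          ≤⟨ +-monoˡ-≤ Q avg ⟩
        W (λ y → W (λ x → union y x)) + Q                    ≡⟨ sym (W-+ _ _) ⟩
        -- Here `Q` is spelled out as a double sum, and each union combines with its overlap by
        -- inclusion and exclusion.
        W (λ y → W (λ x → union y x) + W (λ x → g y x))      ≡⟨ W-cong (λ y _ → trans (sym (W-+ _ _)) (trans (W-cong λ x _ → count-∨-shared d (u y) (u x)) (W-+ (λ _ → size y) size))) ⟩
        W (λ y → W (λ _ → size y) + W size)                  ≡⟨ W-+ _ _ ⟩
        W (λ y → W (λ _ → size y)) + W (λ _ → W size)        ≡⟨ cong₂ _+_ (trans (W-cong λ y _ → W-const (size y)) (W-* N size)) (W-const (W size)) ⟩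
        N * W size + N * W size                              ≡⟨ cong (N * W size +_) (sym (+-identityʳ _)) ⟩
        2 * (N * W size)                                     ∎)
        where
        open ≤-Reasoning
        -- With five equal voters no symbol is bad, and the candidate ranks every pair as `y` does.
        unanimous : ∀ {a b} → a < d → b < d → false ≡ false → false ≡ false → P y a < P y b → majority c a b ≡ true
        unanimous {a} {b} _ _ _ _ l = <ᵇ-true {2} (≤-trans (s≤s (s≤s (s≤s z≤n)))
          (≤-reflexive (sym (sum-cong 5 {f = Voting.vote d P (ix n c) a b} {g = λ _ → 1} λ r r<5 →
            trans (cong (λ z → 𝟙 (P z a <ᵇ P z b)) (ix≡ r<5)) (cong 𝟙 (<ᵇ-true l))))))
        near : ∀ x → x < n → D x c ≤ union y x
        near x x<n = ≤-trans (D-near c (λ _ → false) (P y) (P-inj y<n) unanimous x<n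
                                (AgreeOff-trans {u = u x} {u y} {P x} {q} {P y} (agree x<n) (agree⁻¹ y<n)))
          (≤-reflexive (trans (cong₂ _+_ (sum-cong d λ a _ → cong 𝟙 (∨-comm (u x a) (u y a))) (cong (4 *_) (sum-zero d)))
                              (+-identityʳ _)))

      pairs-cong : ∀ m {x y} → (∀ {r} → r < m → x r ≡ y r) → pairs m x ≡ pairs m y
      pairs-cong m x≡y = sum-cong m λ r r<m → sum-cong r λ r′ r′<r → cong₂ g (x≡y (<-trans r′<r r<m)) (x≡y r<m)

      pairs≤E : ∀ m x → N * (N * pairs m x) ≤ E m x
      pairs≤E m x = m≤m+n _ _

      near-majority : ∀ N w b c S → N * (N * b) ≤ c → S ≤ N * (w + N * (4 * b)) → S ≤ N * w + 4 * c
      near-majority N w b c S h S≤ = ≤-trans S≤ (≤-trans (≤-reflexive (rearrange N w b)) (+-monoʳ-≤ (N * w) (*-monoʳ-≤ 4 h)))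
        where
        rearrange : ∀ N w b → N * (w + N * (4 * b)) ≡ N * w + 4 * (N * (N * b))
        rearrange = solve-∀

      majority-cost : ∀ x c → E 5 x ≤ grow 5 * Q → (∀ {r} → r < 5 → ix n c r ≡ x r) →
                      N * W (λ x → D x c) ≤ N * W size + 4 * (grow 5 * Q)
      majority-cost x c Ex ix≡ = near-majority N (W size) (count d bad) (grow 5 * Q) _ few
        (*-monoʳ-≤ N (≤-trans (W-mono near) (≤-reflexive (trans (W-+ size _) (cong (W size +_) (W-const _))))))
        where
        voters : ∀ {r} → r < 5 → AgreeOff d (u (ix n c r)) q (P (ix n c r))
        voters {r} _ = agree⁻¹ (ix< 1≤n c r)
        bad = Voting.bad d P (ix n c) u q voters
        near : ∀ y → y < n → D y c ≤ size y + 4 * count d bad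
        near y y<n = D-near c bad q q-inj (Voting.good⇒maj d P (ix n c) u q voters) y<n (agree y<n)
        few : N * (N * count d bad) ≤ grow 5 * Q
        few = ≤-trans (*-monoʳ-≤ N (*-monoʳ-≤ N (≤-trans (Voting.count-bad d P (ix n c) u q voters)
                                                         (≤-reflexive (pairs-cong 5 ix≡)))))
                      (≤-trans (pairs≤E 5 x) Ex)

      -- A small average overlap makes the majority of some five input permutations a good median.
      majority-candidate : ∃[ c ] c < n ^ 5 × N * W (λ x → D x c) ≤ N * W size + 4 * (grow 5 * Q)
      majority-candidate =
        let x , x<n , Ex = greedy 1≤n 5
            c , c< , ix≡ = encode n 5 x x<n
        in c , c< , majority-cost x c Ex ix≡

      good-candidate : ∀ K L → 2 * K ≡ L + 1 → K + 4 * grow 5 ≤ L →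
                       ∃[ c ] c < n ^ 5 × K * W (λ x → D x c) ≤ L * W size
      good-candidate K L 2K≡L+1 K+C≤L = cases (N ≟ 0) (≤-total (N * W size) (K * Q))
        where
        cases : Dec (N ≡ 0) → N * W size ≤ K * Q ⊎ K * Q ≤ N * W size →
                ∃[ c ] c < n ^ 5 × K * W (λ x → D x c) ≤ L * W size
        -- An empty cluster costs nothing, so any code will do.
        cases (yes N≡0) _ = 0 , m^n>0 n {{>-nonZero 1≤n}} 5 ,
          ≤-trans (≤-reflexive (trans (cong (K *_) (W-zero N≡0 _)) (*-zeroʳ K))) z≤n
        cases (no N≢0) (inj₁ large) =
          let c , c< , h = input-candidate
          in c , c< , large-overlap K L N (W size) Q _ 2K≡L+1 (n≢0⇒n>0 N≢0) large h
        cases (no N≢0) (inj₂ small) =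
          let c , c< , h = majority-candidate
          in c , c< , small-overlap K L (4 * grow 5) N (W size) Q _ K+C≤L (n≢0⇒n>0 N≢0) small
               (≤-trans h (≤-reflexive (cong (N * W size +_) (sym (*-assoc 4 (grow 5) Q)))))

-- Filling tables on the word RAM

-- Evaluation without overflow.
ev : Store → Expr → ℕ
ev s (lit a)    = a
ev s (reg r)    = regs s r
ev s (load e)   = mem s (ev s e)
ev s (op o e f) = apply o (ev s e) (ev s f)

-- If all stored values are at most V, an expression is at most V to this power. A literal `a`
-- qualifies because V is at least 2; `load` also counts the degree of its address, which must not
-- overflow either.
degree : Expr → ℕ
degree (lit a)    = suc a
degree (reg _)    = 1
degree (load e)   = 1 + degree e
degree (op _ e f) = degree e + degree f

data Cell : Set where
  ret  : Expr → Cell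
  cond : Expr → Cell → Cell → Cell

-- The branches are swapped because `cond e p q` means `p` if `e` is nonzero, while `ifz` has its
-- zero branch first.
cellProg : Expr → Cell → Prog
cellProg ad (ret e)      = store ad e
cellProg ad (cond e p q) = ifz e (cellProg ad q) (cellProg ad p)

branch : ∀ {A : Set} → ℕ → A → A → A
branch zero    x y = y
branch (suc _) x y = x

evC : Store → Cell → ℕ
evC s (ret e)      = ev s e
evC s (cond e p q) = branch (ev s e) (evC s p) (evC s q)

-- A common bound for degrees and running times.
weight : Expr → Cell → ℕ
weight ad (ret e)      = 1 + cost ad + cost e + degree ad + degree e
weight ad (cond e p q) = 1 + cost e + degree e + (weight ad p + weight ad q)

fill : Expr → Expr → Cell → Prog
fill ad len c = 5 ≔ len ⨾ 4 ≔ lit 0 ⨾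
  whilenz (op lt (reg 4) (reg 5)) (cellProg ad c ⨾ 4 ≔ op add (reg 4) (lit 1))

fillWeight : Expr → Expr → Cell → ℕ
fillWeight ad len c = 20 + (cost len + degree len) + weight ad c

infixl 6 _⊕_ _⊖_
infixl 7 _⊗_ _⊘_ _⊛_
infix  5 _⋖_ _≐_

_⊕_ _⊖_ _⊗_ _⊘_ _⊛_ _⋖_ _≐_ : Expr → Expr → Expr
_⊕_ = op add
_⊖_ = op sub
_⊗_ = op mul
_⊘_ = op div
_⊛_ = op mod
_⋖_ = op lt
_≐_ = op eq

-- Sixteen interleaved tables, above the n * d words of the input.
cellAddr : ℕ → Expr → Expr
cellAddr r e = reg 3 ⊕ (e ⊗ lit 16 ⊕ lit r)

rd : ℕ → Expr → Expr
rd r e = load (cellAddr r e)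

fillTable : ℕ → Expr → Cell → Prog
fillTable r = fill (cellAddr r (reg 4))

-- V bounds everything that is ever stored, and K the weight of every piece of the program.
record Fits (n d k w V K : ℕ) : Set where
  field
    V^K<2^w : V ^ K < 2 ^ w
    1≤n     : 1 ≤ n
    1≤d     : 1 ≤ d
    2≤V     : 2 ≤ V
    n≤V     : n ≤ V
    d≤V     : d ≤ V
    k<V     : k < V
    dd≤V    : d * d ≤ V
    nd<V    : n * suc d < V
    nk≤V    : n * k ≤ V
    kdd≤V   : k * d * d ≤ V
    ndd≤V   : n * d * d ≤ V
    n⁵≤V    : n ^ 5 ≤ V
    n⁵dd≤V  : n ^ 5 * d * d ≤ V
    n⁵dQ≤V  : n ^ 5 * d * (d * d + d) ≤ V
    n⁶d²≤V  : n ^ 5 * n * suc d * suc d ≤ V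

  nd≤V : n * d ≤ V
  nd≤V = ≤-trans (*-monoʳ-≤ n (n≤1+n d)) (<⇒≤ nd<V)

  k≤V : k ≤ V
  k≤V = <⇒≤ k<V

module Machine (n d k w V K : ℕ) (fits : Fits n d k w V K) where

  open Fits fits

  private instance
    V≢0 : NonZero V
    V≢0 = >-nonZero (≤-trans (s≤s z≤n) 2≤V)

  record Inv (s : Store) : Set where
    field
      r0    : regs s 0 ≡ n
      r1    : regs s 1 ≡ d
      r2    : regs s 2 ≡ k
      r3    : regs s 3 ≡ n * d
      regs≤ : ∀ r → regs s r ≤ V
      mem≤  : ∀ a → mem s a ≤ V

  record Bounded (s : Store) : Set where
    field
      regs≤ : ∀ r → regs s r ≤ V
      mem≤  : ∀ a → mem s a ≤ V

  bounded : ∀ {s} → Inv s → Bounded s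
  bounded I = record { regs≤ = Inv.regs≤ I ; mem≤ = Inv.mem≤ I }

  degree≥1 : ∀ e → 1 ≤ degree e
  degree≥1 (lit _)    = s≤s z≤n
  degree≥1 (reg _)    = s≤s z≤n
  degree≥1 (load _)   = s≤s z≤n
  degree≥1 (op _ e f) = ≤-trans (degree≥1 e) (m≤m+n _ _)

  V≤V^ : ∀ {m} → 1 ≤ m → V ≤ V ^ m
  V≤V^ {m} 1≤m = ≤-trans (≤-reflexive (sym (*-identityʳ V))) (^-monoʳ-≤ V 1≤m)

  a<V^a : ∀ a → suc a ≤ V ^ a
  a<V^a zero    = ≤-refl
  a<V^a (suc a) = begin
    1 + suc a        ≤⟨ +-mono-≤ (≤-trans (s≤s z≤n) (a<V^a a)) (a<V^a a) ⟩
    V ^ a + V ^ a    ≡⟨ cong (V ^ a +_) (sym (+-identityʳ _)) ⟩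
    2 * V ^ a        ≤⟨ *-monoˡ-≤ (V ^ a) 2≤V ⟩
    V ^ suc a        ∎
    where open ≤-Reasoning

  sum≤product : ∀ {a b} → 2 ≤ a → 2 ≤ b → a + b ≤ a * b
  sum≤product {suc (suc a)} {suc (suc b)} _ _ = ≤-trans (m≤m+n _ (a * b + a + b)) (≤-reflexive (expand a b))
    where
    expand : ∀ a b → (2 + a) + (2 + b) + (a * b + a + b) ≡ (2 + a) * (2 + b)
    expand = solve-∀
  sum≤product {suc zero} (s≤s ())
  sum≤product {suc (suc a)} {suc zero} _ (s≤s ())

  -- Even a sum is at most the product of the two bounds, since both are at least 2; so degrees add
  -- for every operation.
  apply≤ : ∀ o a b {x y} → 1 ≤ x → 1 ≤ y → a ≤ V ^ x → b ≤ V ^ y → apply o a b ≤ V ^ (x + y)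
  apply≤ o a b {x} {y} 1≤x 1≤y a≤ b≤ = go o
    where
    left : ∀ {z} → z ≤ a → z ≤ V ^ (x + y)
    left z≤a = ≤-trans z≤a (≤-trans a≤ (^-monoʳ-≤ V (m≤m+n x y)))
    small : ∀ {z} → z ≤ 1 → z ≤ V ^ (x + y)
    small z≤1 = ≤-trans z≤1 (m^n>0 V (x + y))
    go : ∀ o → apply o a b ≤ V ^ (x + y)
    go add = ≤-trans (+-mono-≤ a≤ b≤) (≤-trans (sum≤product (≤-trans 2≤V (V≤V^ 1≤x)) (≤-trans 2≤V (V≤V^ 1≤y)))
               (≤-reflexive (sym (^-distribˡ-+-* V x y))))
    go sub = left (m∸n≤m a b)
    go mul = ≤-trans (*-mono-≤ a≤ b≤) (≤-reflexive (sym (^-distribˡ-+-* V x y)))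
    go div = quotient b
      where
      quotient : ∀ b → apply div a b ≤ V ^ (x + y)
      quotient zero    = z≤n
      quotient (suc b) = left (m/n≤m a (suc b))
    go mod = remainder b
      where
      remainder : ∀ b → apply mod a b ≤ V ^ (x + y)
      remainder zero    = z≤n
      remainder (suc b) = left (m%n≤m a (suc b))
    go lt = small (𝟙≤1 (a <ᵇ b))
    go eq = small (𝟙≤1 (a ≡ᵇ b))

  module _ {s} (B : Bounded s) where
    open Bounded B

    ev≤ : ∀ e → ev s e ≤ V ^ degree e
    ev≤ (lit a)    = ≤-trans (n≤1+n a) (≤-trans (a<V^a a) (^-monoʳ-≤ V (n≤1+n a)))
    ev≤ (reg r)    = ≤-trans (regs≤ r) (V≤V^ {1} ≤-refl)
    ev≤ (load e)   = ≤-trans (mem≤ _) (V≤V^ {1 + degree e} (s≤s z≤n))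
    ev≤ (op o e f) = apply≤ o (ev s e) (ev s f) (degree≥1 e) (degree≥1 f) (ev≤ e) (ev≤ f)

    wrap-id : ∀ {a m} → a ≤ V ^ m → m ≤ K → wrap w a ≡ a
    wrap-id a≤ m≤K = m<n⇒m%n≡m {{m^n≢0 2 w}} (≤-<-trans (≤-trans a≤ (^-monoʳ-≤ V m≤K)) V^K<2^w)

    eval≡ev : ∀ e → degree e ≤ K → eval w s e ≡ ev s e
    eval≡ev (lit a)    h = wrap-id {m = suc a} (ev≤ (lit a)) h
    eval≡ev (reg r)    h = refl
    eval≡ev (load e)   h = cong (mem s) (eval≡ev e (≤-trans (n≤1+n _) h))
    eval≡ev (op o e f) h rewrite eval≡ev e (≤-trans (m≤m+n _ _) h) | eval≡ev f (≤-trans (m≤n+m _ (degree e)) h) =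
      wrap-id (ev≤ (op o e f)) h

    cell-run : ∀ ad c → weight ad c ≤ K →
               ∃[ t ] t ≤ weight ad c × Run w (cellProg ad c) s t (setMem (ev s ad) (evC s c) s)
    cell-run ad (ret e) h = 1 + cost ad + cost e ,
      ≤-trans (m≤m+n _ (degree ad)) (m≤m+n _ (degree e)) ,
      subst₂ (λ a v → Run w (store ad e) s (1 + cost ad + cost e) (setMem a v s))
        (eval≡ev ad (≤-trans (m≤n+m _ (1 + cost ad + cost e)) (≤-trans (m≤m+n _ (degree e)) h)))
        (eval≡ev e (≤-trans (m≤n+m _ (1 + cost ad + cost e + degree ad)) h))
        store
    cell-run ad (cond e p q) h with ev s e in eqn
    ... | zero with cell-run ad q (≤-trans (m≤n+m _ (weight ad p)) (≤-trans (m≤n+m _ (1 + cost e + degree e)) h))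
    ...   | t , t≤ , run = 1 + cost e + t ,
      +-mono-≤ (m≤m+n (1 + cost e) (degree e)) (≤-trans t≤ (m≤n+m _ (weight ad p))) ,
      if-zero (trans (eval≡ev e (≤-trans (m≤n+m _ (1 + cost e)) (≤-trans (m≤m+n _ _) h))) eqn) run
    cell-run ad (cond e p q) h | suc v with cell-run ad p (≤-trans (m≤m+n _ (weight ad q)) (≤-trans (m≤n+m _ (1 + cost e + degree e)) h))
    ...   | t , t≤ , run = 1 + cost e + t ,
      +-mono-≤ (m≤m+n (1 + cost e) (degree e)) (≤-trans t≤ (m≤m+n _ (weight ad q))) ,
      if-nonzero (λ z → 1+n≢0 (trans (sym eqn) (trans (sym (eval≡ev e (≤-trans (m≤n+m _ (1 + cost e)) (≤-trans (m≤m+n _ _) h)))) z))) run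

  update≤ : ∀ {f : ℕ → ℕ} {a v} → (∀ b → f b ≤ V) → v ≤ V → ∀ b → (f [ a ↦ v ]) b ≤ V
  update≤ {a = a} f≤ v≤ b with a ≡ᵇ b
  ... | true  = v≤
  ... | false = f≤ b

  update-same : ∀ (f : ℕ → ℕ) {a b} v → a ≡ b → (f [ a ↦ v ]) b ≡ v
  update-same f {a} v a≡b rewrite ≡ᵇ-true a≡b = refl

  update-other : ∀ (f : ℕ → ℕ) {a b} v → a ≢ b → (f [ a ↦ v ]) b ≡ f b
  update-other f {a} v a≢b rewrite ≡ᵇ-false a≢b = refl

  Inv-setReg : ∀ {s} r v → Inv s → v ≤ V → Inv (setReg (4 + r) v s)
  Inv-setReg {s} r v I v≤ = record { r0 = r0 ; r1 = r1 ; r2 = r2 ; r3 = r3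
    ; regs≤ = update≤ {regs s} {4 + r} regs≤ v≤ ; mem≤ = mem≤ }
    where open Inv I

  Inv-setMem : ∀ {s} a v → Inv s → v ≤ V → Inv (setMem a v s)
  Inv-setMem {s} a v I v≤ = record { r0 = r0 ; r1 = r1 ; r2 = r2 ; r3 = r3
    ; regs≤ = regs≤ ; mem≤ = update≤ {mem s} {a} mem≤ v≤ }
    where open Inv I

  assign-run : ∀ {s} r e → Bounded s → degree e ≤ K → Run w (r ≔ e) s (1 + cost e) (setReg r (ev s e) s)
  assign-run {s} r e B h = subst (λ v → Run w (r ≔ e) s (1 + cost e) (setReg r v s)) (eval≡ev B e h) assign

  module Fill (ad len : Expr) (c : Cell) (small : fillWeight ad len c ≤ K)
    (α : ℕ → ℕ) (ad≡ : ∀ {s} → Inv s → ev s ad ≡ α (regs s 4)) (α-inj : ∀ {i j} → α i ≡ α j → i ≡ j)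
    (L : ℕ) (L≤V : L ≤ V) (len≡ : ∀ {s} → Inv s → ev s len ≡ L)
    (F : ℕ → ℕ) (F≤ : ∀ {i} → i < L → F i ≤ V) (s₀ : Store) where

    record Partial (i : ℕ) (s : Store) : Set where
      field
        new : ∀ {j} → j < i → mem s (α j) ≡ F j
        old : ∀ {b} → (∀ {j} → j < i → b ≢ α j) → mem s b ≡ mem s₀ b

    wt : ℕ
    wt = weight ad c

    wt≤K : wt ≤ K
    wt≤K = ≤-trans (m≤n+m _ (20 + (cost len + degree len))) small

    20≤K : 20 ≤ K
    20≤K = ≤-trans (m≤m+n 20 _) (≤-trans (m≤m+n _ wt) small)

    module _ (cell : ∀ {i s} → i < L → Inv s → regs s 4 ≡ i → Partial i s → evC s c ≡ F i) where

      step : ∀ {i s} → i < L → Inv s → regs s 4 ≡ i → regs s 5 ≡ L → Partial i s →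
        ∃[ t ] ∃[ s′ ] Run w (cellProg ad c ⨾ 4 ≔ op add (reg 4) (lit 1)) s t s′ × t ≤ wt + 4 ×
          Inv s′ × regs s′ 4 ≡ suc i × regs s′ 5 ≡ L × Partial (suc i) s′
      step {i} {s} i<L I refl r5 p with cell-run (bounded I) ad c wt≤K
      ... | t , t≤ , run = t + 4 , s′ , seq run (assign-run 4 _ (bounded I₁) (≤-trans (≤ᵇ⇒≤ 3 20 _) 20≤K)) ,
        +-monoˡ-≤ 4 t≤ , Inv-setReg 0 _ I₁ (≤-trans (≤-reflexive (+-comm _ 1)) (≤-trans i<L L≤V)) ,
        +-comm _ 1 , r5 , record { new = new′ ; old = old′ }
        where
        open Partial p
        v≡ : evC s c ≡ F i
        v≡ = cell i<L I refl p
        s₁ = setMem (ev s ad) (evC s c) s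
        I₁ : Inv s₁
        I₁ = Inv-setMem (ev s ad) (evC s c) I (subst (_≤ V) (sym v≡) (F≤ i<L))
        s′ = setReg 4 (i + 1) s₁
        new′ : ∀ {j} → j < suc i → mem s′ (α j) ≡ F j
        new′ {j} j≤i with m≤n⇒m<n∨m≡n (≤-pred j≤i)
        ... | inj₂ refl = trans (update-same (mem s) _ (ad≡ I)) v≡
        ... | inj₁ j<i  = trans (update-other (mem s) _ λ e → <⇒≢ j<i (sym (α-inj (trans (sym (ad≡ I)) e)))) (new j<i)
        old′ : ∀ {b} → (∀ {j} → j < suc i → b ≢ α j) → mem s′ b ≡ mem s₀ b
        old′ {b} h = trans (update-other (mem s) _ λ e → h ≤-refl (trans (sym e) (ad≡ I))) (old (h ∘ m<n⇒m<1+n))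

      -- `m` cells are left; each takes 4 steps for the test and 4 for the counter besides its own.
      loop : ∀ m {i s} → i + m ≡ L → Inv s → regs s 4 ≡ i → regs s 5 ≡ L → Partial i s →
        ∃[ t ] ∃[ s′ ] Run w (whilenz (op lt (reg 4) (reg 5)) (cellProg ad c ⨾ 4 ≔ op add (reg 4) (lit 1))) s t s′ ×
          t ≤ m * (wt + 8) + 4 × Inv s′ × Partial L s′
      loop zero {i} {s} e I r4 r5 p with trans (sym (+-identityʳ i)) e
      ... | refl = 4 , s , while-zero (trans (eval≡ev (bounded I) (reg 4 ⋖ reg 5) (≤-trans (≤ᵇ⇒≤ 2 20 _) 20≤K))
                     (cong 𝟙 (<ᵇ-false (≤-reflexive (trans r5 (sym r4)))))) , ≤-refl , I , p
      loop (suc m) {i} {s} e I r4 r5 p with step i<L I r4 r5 p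
        where
        i<L : i < L
        i<L = subst (i <_) e (m<m+n i (s≤s z≤n))
      ... | t₁ , s₁ , run₁ , t₁≤ , I₁ , r4₁ , r5₁ , p₁ with loop m (trans (sym (+-suc i m)) e) I₁ r4₁ r5₁ p₁
      ... | t₂ , s₂ , run₂ , t₂≤ , I₂ , p₂ = 4 + t₁ + t₂ , s₂ , while-nonzero
              (λ z → 1≢0 (trans (sym (cong 𝟙 (<ᵇ-true (subst₂ _<_ (sym r4) (sym r5) (subst (i <_) e (m<m+n i (s≤s z≤n)))))))
                 (trans (sym (eval≡ev (bounded I) (reg 4 ⋖ reg 5) (≤-trans (≤ᵇ⇒≤ 2 20 _) 20≤K))) z))) run₁ run₂ ,
              ≤-trans (+-mono-≤ (+-monoʳ-≤ 4 t₁≤) t₂≤) (≤-reflexive (time wt (m * (wt + 8)))) , I₂ , p₂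
        where
        time : ∀ a b → 4 + (a + 4) + (b + 4) ≡ (a + 8 + b) + 4
        time = solve-∀

      fill-run : Inv s₀ → ∃[ t ] ∃[ s′ ] Run w (fill ad len c) s₀ t s′ × t ≤ K * suc L × Inv s′ × Partial L s′
      fill-run I = (1 + cost len) + (2 + t) , s′ ,
        seq (assign-run 5 len (bounded I) (≤-trans (m≤n+m _ (cost len)) (≤-trans (m≤n+m _ 20) (≤-trans (m≤m+n _ wt) small))))
        (seq (assign-run 4 (lit 0) (bounded I₁) (≤-trans (≤ᵇ⇒≤ 1 20 _) 20≤K)) run) ,
        bound , I′ , p′
        where
        s₁ = setReg 5 (ev s₀ len) s₀
        I₁ : Inv s₁
        I₁ = Inv-setReg 1 _ I (subst (_≤ V) (sym (len≡ I)) L≤V)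
        s₂ = setReg 4 0 s₁
        I₂ : Inv s₂
        I₂ = Inv-setReg 0 _ I₁ z≤n
        result = loop L refl I₂ refl (len≡ I) (record { new = λ () ; old = λ _ → refl })
        t = proj₁ result
        s′ = proj₁ (proj₂ result)
        run = proj₁ (proj₂ (proj₂ result))
        t≤ = proj₁ (proj₂ (proj₂ (proj₂ result)))
        I′ = proj₁ (proj₂ (proj₂ (proj₂ (proj₂ result))))
        p′ = proj₂ (proj₂ (proj₂ (proj₂ (proj₂ result))))
        time : ∀ c b l → 1 + c + (2 + (l * (b + 8) + 4)) + (13 + l * 12 + l * c + b) ≡ (20 + c + b) * suc l
        time = solve-∀
        bound : (1 + cost len) + (2 + t) ≤ K * suc L
        bound = begin
          (1 + cost len) + (2 + t)                                       ≤⟨ +-monoʳ-≤ (1 + cost len) (+-monoʳ-≤ 2 t≤) ⟩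
          1 + cost len + (2 + (L * (wt + 8) + 4))                        ≤⟨ m≤m+n _ _ ⟩
          1 + cost len + (2 + (L * (wt + 8) + 4)) + (13 + L * 12 + L * cost len + wt)  ≡⟨ time (cost len) wt L ⟩
          (20 + cost len + wt) * suc L                                   ≤⟨ *-monoˡ-≤ (suc L) (≤-trans (+-monoˡ-≤ wt (+-monoʳ-≤ 20 (m≤m+n (cost len) (degree len)))) small) ⟩
          K * suc L                                                      ∎
          where open ≤-Reasoning

  -- The layout of the tables

  loc : ℕ → ℕ → ℕ
  loc r j = n * d + (j * 16 + r)

  -- Relative to `n * d`, the residue of an address modulo 16 tells the table. The interleaving thus
  -- keeps the tables disjoint whatever their lengths.
  loc-region : ∀ {r r′ i j} → r < 16 → r′ < 16 → loc r i ≡ loc r′ j → r ≡ r′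
  loc-region {r} {r′} {i} {j} r< r′< e = begin
    r                    ≡⟨ sym (m<n⇒m%n≡m r<) ⟩
    r % 16               ≡⟨ sym ([m+kn]%n≡m%n r i 16) ⟩
    (r + i * 16) % 16    ≡⟨ cong (_% 16) (+-comm r (i * 16)) ⟩
    (i * 16 + r) % 16    ≡⟨ cong (_% 16) (+-cancelˡ-≡ (n * d) _ _ e) ⟩
    (j * 16 + r′) % 16   ≡⟨ cong (_% 16) (+-comm (j * 16) r′) ⟩
    (r′ + j * 16) % 16   ≡⟨ [m+kn]%n≡m%n r′ j 16 ⟩
    r′ % 16              ≡⟨ m<n⇒m%n≡m r′< ⟩
    r′                   ∎
    where open ≡-Reasoning

  loc-inj : ∀ {r i j} → loc r i ≡ loc r j → i ≡ j
  loc-inj {r} {i} {j} e = *-cancelʳ-≡ i j 16 (+-cancelʳ-≡ r (i * 16) (j * 16) (+-cancelˡ-≡ (n * d) _ _ e))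

  -- The known length and contents of each table.
  Tables : Set
  Tables = ℕ → ℕ × (ℕ → ℕ)

  _⟪_↦_,_⟫ : Tables → ℕ → ℕ → (ℕ → ℕ) → Tables
  (Γ ⟪ r ↦ L , F ⟫) r′ = if r ≡ᵇ r′ then (L , F) else Γ r′

  Reads : Store → ℕ → ℕ × (ℕ → ℕ) → Set
  Reads s r (L , F) = ∀ {j} → j < L → mem s (loc r j) ≡ F j

  -- The side condition is a Boolean equation so that `refl` settles it for each numeral.
  Holds : Tables → Store → Set
  Holds Γ s = ∀ r → (r <ᵇ 16) ≡ true → Reads s r (Γ r)

  -- What the i-th cell of table r may rely on while the table is being filled.
  record Ready (Γ : Tables) (low : ℕ → ℕ) (r : ℕ) (F : ℕ → ℕ) (i : ℕ) (s : Store) : Set where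
    field
      inv    : Inv s
      idx    : regs s 4 ≡ i
      others : ∀ r′ → (r ≡ᵇ r′) ≡ false → (r′ <ᵇ 16) ≡ true → Reads s r′ (Γ r′)
      self   : Reads s r (i , F)
      -- For tables that are refilled in place: cell `i` still holds its former value.
      old    : ∀ {j} → i ≤ j → j < proj₁ (Γ r) → mem s (loc r j) ≡ proj₂ (Γ r) j
      low≡   : ∀ {b} → b < n * d → mem s b ≡ low b

  fillTable-run : ∀ r len c → fillWeight (cellAddr r (reg 4)) len c ≤ K → (r <ᵇ 16) ≡ true →
    ∀ L → L ≤ V → (∀ {s} → Inv s → ev s len ≡ L) → ∀ F → (∀ {i} → i < L → F i ≤ V) →
    ∀ {Γ low s₀} → Inv s₀ → Holds Γ s₀ → (∀ {b} → b < n * d → mem s₀ b ≡ low b) →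
    (∀ {i s} → i < L → Ready Γ low r F i s → evC s c ≡ F i) →
    ∃[ t ] ∃[ s ] Run w (fillTable r len c) s₀ t s × t ≤ K * suc L × Inv s ×
      Holds (Γ ⟪ r ↦ L , F ⟫) s × (∀ {b} → b < n * d → mem s b ≡ low b)
  fillTable-run r len c small r<ᵇ L L≤V len≡ F F≤ {Γ} {low} {s₀} I₀ H₀ low₀ cell =
    let t , s , run , t≤ , I , p = fill-run cell′ I₀ in t , s , run , t≤ , I , holds p , low′ p
    where
    open Fill (cellAddr r (reg 4)) len c small (loc r) (λ {s} I → cong (_+ (regs s 4 * 16 + r)) (Inv.r3 I)) (loc-inj {r})
              L L≤V len≡ F F≤ s₀
    r< = <ᵇ-true⁻¹ {r} r<ᵇ
    low′ : ∀ {i s} → Partial i s → ∀ {b} → b < n * d → mem s b ≡ low b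
    low′ p {b} b< = trans (Partial.old p λ {j} _ e → <⇒≢ (<-≤-trans b< (m≤m+n (n * d) _)) e) (low₀ b<)
    outside : ∀ {i s} → Partial i s → ∀ r′ → (r ≡ᵇ r′) ≡ false → (r′ <ᵇ 16) ≡ true → Reads s r′ (Γ r′)
    outside p r′ r≢ r′<ᵇ {j} j< = trans
      (Partial.old p λ {j′} _ e → t≢f (≡ᵇ-true (loc-region {r} {r′} {j′} {j} r< (<ᵇ-true⁻¹ {r′} r′<ᵇ) (sym e))) r≢)
      (H₀ r′ r′<ᵇ j<)
    cell′ : ∀ {i s} → i < L → Inv s → regs s 4 ≡ i → Partial i s → evC s c ≡ F i
    cell′ {i} {s} i<L I r4 p = cell i<L (record
      { inv = I ; idx = r4 ; others = outside p ; self = Partial.new p ; low≡ = low′ p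
      ; old = λ {j} i≤j j< → trans (Partial.old p λ {j′} j′<i e → <⇒≢ (<-≤-trans j′<i i≤j) (sym (loc-inj {r} e))) (H₀ r r<ᵇ j<)
      })
    holds : ∀ {s} → Partial L s → Holds (Γ ⟪ r ↦ L , F ⟫) s
    holds p r′ r′<ᵇ {j} with r ≡ᵇ r′ in e
    ... | true with refl ← ≡ᵇ-true⁻¹ {r} e = Partial.new p
    ... | false = outside p r′ e r′<ᵇ

  -- The output overwrites the input from address 0. As it fits into the `n * d` words below the
  -- tables, these stay readable meanwhile.
  fillLow-run : ∀ len c → fillWeight (reg 4) len c ≤ K → ∀ L → L ≤ n * d →
    (∀ {s} → Inv s → ev s len ≡ L) → ∀ F → (∀ {i} → i < L → F i ≤ V) →
    ∀ {Γ s₀} → Inv s₀ → Holds Γ s₀ →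
    (∀ {i s} → i < L → Inv s → regs s 4 ≡ i → Holds Γ s → evC s c ≡ F i) →
    ∃[ t ] ∃[ s ] Run w (fill (reg 4) len c) s₀ t s × t ≤ K * suc L × Inv s × (∀ {j} → j < L → mem s j ≡ F j)
  fillLow-run len c small L L≤nd len≡ F F≤ {Γ} {s₀} I₀ H₀ cell =
    let t , s , run , t≤ , I , p = fill-run cell′ I₀ in t , s , run , t≤ , I , Partial.new p
    where
    open Fill (reg 4) len c small (λ i → i) (λ _ → refl) (λ e → e) L (≤-trans L≤nd nd≤V) len≡ F F≤ s₀
    cell′ : ∀ {i s} → i < L → Inv s → regs s 4 ≡ i → Partial i s → evC s c ≡ F i
    cell′ i<L I r4 p = cell i<L I r4 λ r r<ᵇ j< → trans
      (Partial.old p λ {j′} j′<i e → <⇒≢ (<-≤-trans (<-≤-trans (<-trans j′<i i<L) L≤nd) (m≤m+n (n * d) _)) (sym e))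
      (H₀ r r<ᵇ j<)

-- The program

tab2 : ℕ → (ℕ → ℕ → ℕ) → ℕ → ℕ
tab2 m f i = f (i dv m) (i md m)

tab3 : ℕ → ℕ → (ℕ → ℕ → ℕ → ℕ) → ℕ → ℕ
tab3 m₁ m₂ f i = f (i dv m₂ dv m₁) (i dv m₂ md m₁) (i md m₂)

tab2-at : ∀ {m} f a {b} → b < m → tab2 m f (a * m + b) ≡ f a b
tab2-at f a b< = cong₂ f (dv-pair a b<) (md-pair a b<)

tab3-at : ∀ {m₁ m₂} f c {a b} → a < m₁ → b < m₂ → tab3 m₁ m₂ f ((c * m₁ + a) * m₂ + b) ≡ f c a b
tab3-at {m₁} {m₂} f c {a} {b} a< b<
  rewrite dv-pair (c * m₁ + a) b< | md-pair (c * m₁ + a) b< | dv-pair c a< | md-pair c a< = refl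

unpair3 : ∀ {i} A m₁ m₂ → i < A * m₁ * m₂ →
  ∃[ c ] ∃[ a ] ∃[ b ] c < A × a < m₁ × b < m₂ × i ≡ (c * m₁ + a) * m₂ + b
unpair3 A m₁ m₂ i< with unpair (A * m₁) m₂ i<
... | q , b , q< , b< , refl with unpair A m₁ q<
... | c , a , c< , a< , refl = c , a , b , c< , a< , b< , refl

-- The last i′ ≤ i with x i′ = a, and 0 if there is none.
search : (ℕ → ℕ) → ℕ → ℕ → ℕ
search x a zero    = 0
search x a (suc i) = if x (suc i) ≡ᵇ a then suc i else search x a i

search≤ : ∀ x a i → search x a i ≤ i
search≤ x a zero = z≤n
search≤ x a (suc i) with x (suc i) ≡ᵇ a
... | true  = ≤-refl
... | false = m≤n⇒m≤1+n (search≤ x a i)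

search-finds : ∀ {d x p} → InverseOn d x p → ∀ {a} i → i < d → a < d → p a ≤ i → search x a i ≡ p a
-- The untested default 0 is right here because `p a` is at most 0.
search-finds I zero i<d a<d p≤ = sym (n≤0⇒n≡0 p≤)
search-finds {x = x} {p} I {a} (suc i) i<d a<d p≤ with x (suc i) ≡ᵇ a in e
... | true  with refl ← ≡ᵇ-true⁻¹ {x (suc i)} e = sym (p∘x I i<d)
... | false with m≤n⇒m<n∨m≡n p≤
...   | inj₁ (s≤s p≤i) = search-finds I i (<⇒≤ i<d) a<d p≤i
...   | inj₂ p≡ = t≢f (≡ᵇ-true (trans (cong x (sym p≡)) (x∘p I a<d))) e

search-cong : ∀ {x y : ℕ → ℕ} {a} i → (∀ j → j ≤ i → x j ≡ y j) → search x a i ≡ search y a i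
search-cong zero    h = refl
search-cong {a = a} (suc i) h rewrite h (suc i) ≤-refl | search-cong {a = a} i (λ j j≤ → h j (m≤n⇒m≤1+n j≤)) = refl

-- Registers 0, 1, 2 and 3 hold n, d, k and n * d; registers 4 and 5 are the counter and the
-- bound of the loop that fills a table.
N# D# K# I# : Expr
N# = reg 0
D# = reg 1
K# = reg 2
I# = reg 4

at2 : Expr → Expr → Expr → Expr
at2 a m b = a ⊗ m ⊕ b

at3 : Expr → Expr → Expr → Expr → Expr → Expr
at3 c m₁ a m₂ b = at2 (at2 c m₁ a) m₂ b

lo : Expr → Expr
lo m = I# ⊛ m

mid hi : Expr → Expr → Expr
mid m₁ m₂ = I# ⊘ m₂ ⊛ m₁
hi  m₁ m₂ = I# ⊘ m₂ ⊘ m₁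

prev : ℕ → Expr
prev r = rd r (I# ⊖ lit 1)

-- Tables: 0 copies the input, 1 searches for the positions of the symbols, 2 holds the majority
-- tournaments, 3 the deletion of cycles, 4 prefix counts whose totals are the ranks of the
-- candidates, 5 longest increasing subsequences; 7 the current tuple of candidates, 8 the best
-- one so far, 9 a bound on its cost, 10 the loop flag, 11 and 12 prefix minima and sums for the
-- cost of the current tuple, 13 the carries of the odometer, 14 the inverses of the ranks.
len0 len1 len2 len3 len4 len5 n5# Q# dd# d1# : Expr
cell0 cell1 cell2 cell3 cell4 cell5 : Cell

len0  = N# ⊗ D#
cell0 = ret (load I#)

len1  = N# ⊗ D# ⊗ D#
cell1 = cond (rd 0 (at2 (hi D# D#) D# (lo D#)) ≐ mid D# D#) (ret (lo D#))
             (cond (lo D#) (ret (prev 1)) (ret (lit 0)))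

-- The last entry of a row of table 1 is the result of the search through the whole sequence.
pos# : Expr → Expr → Expr
pos# j a = rd 1 (at3 j D# a D# (D# ⊖ lit 1))

-- Written as `n ^ 5` unfolds, so that the two agree by computation.
n5# = N# ⊗ (N# ⊗ (N# ⊗ (N# ⊗ (N# ⊗ lit 1))))

quot# ix# : Expr → ℕ → Expr
quot# c zero    = c
quot# c (suc r) = quot# c r ⊘ N#
ix# c r = quot# c r ⊛ N#

votes# : Expr → Expr → Expr → ℕ → Expr
votes# c a b zero    = lit 0
votes# c a b (suc r) = votes# c a b r ⊕ (pos# (ix# c r) a ⋖ pos# (ix# c r) b)

len2  = n5# ⊗ D# ⊗ D#
cell2 = ret (lit 2 ⋖ votes# (hi D# D#) (mid D# D#) (lo D#) 5)

maj# : Expr → Expr → Expr → Expr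
maj# c a b = rd 2 (at3 c D# a D# b)

dd# = D# ⊗ D#
Q#  = dd# ⊕ D#

-- Table 3: for each candidate and each step t, the d * d results of the scan for a cycle
-- through t, then the d flags of the symbols that are dead after the step.
module _ (c t s : Expr) where

  -- `I# ⊖ s` is the start of the current row; the `D#` entries before it are the flags after the
  -- previous step.
  oldDead# : Expr → Expr
  oldDead# a = rd 3 (I# ⊖ s ⊖ D# ⊕ a)

  cyc# : Expr
  cyc# = (s ⊘ D# ⋖ t) ⊗ ((s ⊛ D# ⋖ t) ⊗ ((oldDead# (s ⊘ D#) ≐ lit 0) ⊗ ((oldDead# (s ⊛ D#) ≐ lit 0) ⊗
         (maj# c t (s ⊘ D#) ⊗ (maj# c (s ⊘ D#) (s ⊛ D#) ⊗ maj# c (s ⊛ D#) t)))))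

  found# : Expr
  found# = rd 3 (I# ⊖ s ⊕ dd# ⊖ lit 1)

  -- For `t` equal to 0 the preceding row is not one of this candidate. No symbol is smaller than 0,
  -- so the scan finds nothing and nothing is dead.
  fresh# scan# old# kill# : Cell
  fresh# = cond t (ret (cyc# ⊗ (lit 1 ⊕ s))) (ret (lit 0))
  scan#  = cond s (cond (prev 3) (ret (prev 3)) fresh#) fresh#
  old#   = cond t (ret (oldDead# (s ⊖ dd#))) (ret (lit 0))
  kill#  = cond found# (cond (s ⊖ dd# ≐ (found# ⊖ lit 1) ⊘ D#) (ret (lit 1))
                       (cond (s ⊖ dd# ≐ (found# ⊖ lit 1) ⊛ D#) (ret (lit 1))
                       (cond (s ⊖ dd# ≐ t) (ret (lit 1)) old#))) old#

len3  = n5# ⊗ D# ⊗ Q#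
cell3 = cond (lo Q# ⋖ dd#) (scan# (hi D# Q#) (mid D# Q#) (lo Q#)) (kill# (hi D# Q#) (mid D# Q#) (lo Q#))

dead# : Expr → Expr → Expr
dead# c a = rd 3 (at3 c D# (D# ⊖ lit 1) Q# (dd# ⊕ a))

-- At the start of a row the factor 0 discards the last entry of the previous row.
prefix# : ℕ → Expr → Expr
prefix# r b = (lit 0 ⋖ b) ⊗ prev r

len4  = n5# ⊗ D# ⊗ D#
cell4 = cond (dead# c b)
          (cond (dead# c a) (ret (prefix# 4 b ⊕ (b ⋖ a))) (ret (prefix# 4 b ⊕ lit 0)))
          (cond (dead# c a) (ret (prefix# 4 b ⊕ lit 1)) (ret (prefix# 4 b ⊕ maj# c b a)))
  where
  c = hi D# D#
  a = mid D# D#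
  b = lo D#

place# : Expr → Expr → Expr
place# c a = rd 4 (at3 c D# a D# (D# ⊖ lit 1))

d1# = lit 1 ⊕ D#

-- Table 5: for the candidate c and the input permutation j, row c * n + j.
len5  = n5# ⊗ N# ⊗ d1# ⊗ d1#
cell5 = cond (i ⋖ e) (ret (lit 0))
        -- For `i` equal to `d`, `value i` reads a meaningless word, but the first summand already
        -- makes the test nonzero.
        (cond e (cond ((i ≐ D#) ⊕ (value (e ⊖ lit 1) ⋖ value i))
                      (ret ((prev 5 ⊖ (lit 1 ⊕ diagonal)) ⊕ (lit 1 ⊕ diagonal)))
                      (ret (prev 5)))
                (ret (lit 1)))
  where
  row = hi d1# d1#
  i = mid d1# d1#
  e = lo d1#
  value : Expr → Expr
  value p = place# (row ⊘ N#) (rd 0 (at2 (row ⊛ N#) D# p))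
  diagonal = rd 5 (at3 row d1# (e ⊖ lit 1) d1# (e ⊖ lit 1))

gap# : Expr → Expr → Expr
gap# j c = d1# ⊖ rd 5 (at3 (at2 c N# j) d1# D# d1# D#)

branch≡ : ∀ {v w x y z : ℕ} → v ≡ w → (w ≡ 0 → y ≡ z) → (∀ {w′} → w ≡ suc w′ → x ≡ z) → branch v x y ≡ z
branch≡ {zero}  refl hy hx = hy refl
branch≡ {suc _} refl hy hx = hx refl

branch𝟙 : ∀ {v x y z : ℕ} {b} → v ≡ 𝟙 b → (b ≡ false → y ≡ z) → (b ≡ true → x ≡ z) → branch v x y ≡ z
branch𝟙 {b = true}  refl hy hx = hx refl
branch𝟙 {b = false} refl hy hx = hy refl

module _ {s : Store} where

  at3≡ : ∀ c m₁ a m₂ b {c′ n₁ a′ n₂ b′} → ev s c ≡ c′ → ev s m₁ ≡ n₁ → ev s a ≡ a′ → ev s m₂ ≡ n₂ → ev s b ≡ b′ →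
         ev s (at3 c m₁ a m₂ b) ≡ (c′ * n₁ + a′) * n₂ + b′
  at3≡ _ _ _ _ _ refl refl refl refl refl = refl

  module Coordinates {c a b m₁ m₂} (M₁ M₂ : Expr) (e₁ : ev s M₁ ≡ m₁) (e₂ : ev s M₂ ≡ m₂)
    (idx : regs s 4 ≡ (c * m₁ + a) * m₂ + b) (a< : a < m₁) (b< : b < m₂) where

    lo≡ : ev s (lo M₂) ≡ b
    lo≡ = trans (cong₂ _md_ idx e₂) (md-pair (c * m₁ + a) b<)

    row≡ : ev s (I# ⊘ M₂) ≡ c * m₁ + a
    row≡ = trans (cong₂ _dv_ idx e₂) (dv-pair (c * m₁ + a) b<)

    mid≡ : ev s (mid M₁ M₂) ≡ a
    mid≡ = trans (cong₂ _md_ row≡ e₁) (md-pair c a<)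

    hi≡ : ev s (hi M₁ M₂) ≡ c
    hi≡ = trans (cong₂ _dv_ row≡ e₁) (dv-pair c a<)

pred-pair : ∀ q b m → q * m + suc b ∸ 1 ≡ q * m + b
pred-pair q b m rewrite +-suc (q * m) b = refl

if≡branch : ∀ f (x y : ℕ) → (if f ≡ᵇ 0 then y else x) ≡ branch f x y
if≡branch zero    x y = refl
if≡branch (suc f) x y = refl

if≡branch𝟙 : ∀ b (x y : ℕ) → (if b then x else y) ≡ branch (𝟙 b) x y
if≡branch𝟙 true  x y = refl
if≡branch𝟙 false x y = refl

branch-cong : ∀ {v v′ x x′ y y′ : ℕ} → v ≡ v′ → x ≡ x′ → y ≡ y′ → branch v x y ≡ branch v′ x′ y′
branch-cong refl refl refl = refl

kill≡branch : ∀ d m D t f x → Elimination.kill d m D t f x ≡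
  branch f (branch (𝟙 (x ≡ᵇ (f ∸ 1) dv d)) 1 (branch (𝟙 (x ≡ᵇ (f ∸ 1) md d)) 1 (branch (𝟙 (x ≡ᵇ t)) 1 (D x)))) (D x)
kill≡branch d m D t zero    x = refl
kill≡branch d m D t (suc f) x with x ≡ᵇ f dv d
... | true  = refl
... | false with x ≡ᵇ f md d
... | true  = refl
... | false with x ≡ᵇ t
... | true  = refl
... | false = refl

dv< : ∀ {e m} n → e < n * m → e dv m < n
dv< {e} {zero}  n e< = contradiction (subst (e <_) (*-zeroʳ n) e<) λ ()
dv< {e} {suc m} n e< = m<n*o⇒m/o<n e<

md< : ∀ e {m} → 1 ≤ m → e md m < m
md< e {suc m} _ = m%n<n e (suc m)

-- Minima and the enumeration of tuples

mn : ℕ → ℕ → ℕ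
mn a b = a ∸ (a ∸ b)

mn≤a : ∀ a b → mn a b ≤ a
mn≤a a b = m∸n≤m a (a ∸ b)

mn-sel : ∀ a b → (a ≤ b × mn a b ≡ a) ⊎ (b ≤ a × mn a b ≡ b)
mn-sel a b with ≤-total a b
... | inj₁ a≤b = inj₁ (a≤b , cong (a ∸_) (m≤n⇒m∸n≡0 a≤b))
... | inj₂ b≤a = inj₂ (b≤a , m∸[m∸n]≡n b≤a)

mn≤b : ∀ a b → mn a b ≤ b
mn≤b a b with mn-sel a b
... | inj₁ (a≤b , e) = ≤-trans (≤-reflexive e) a≤b
... | inj₂ (b≤a , e) = ≤-reflexive e

minTo : (ℕ → ℕ) → ℕ → ℕ
minTo g zero    = g 0
minTo g (suc i) = mn (minTo g i) (g (suc i))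

minTo-≤ : ∀ g i {j} → j ≤ i → minTo g i ≤ g j
minTo-≤ g zero    z≤n = ≤-refl
minTo-≤ g (suc i) j≤ with m≤n⇒m<n∨m≡n j≤
... | inj₁ j<   = ≤-trans (mn≤a (minTo g i) (g (suc i))) (minTo-≤ g i (≤-pred j<))
... | inj₂ refl = mn≤b (minTo g i) (g (suc i))

minTo-attained : ∀ g i → ∃[ j ] j ≤ i × minTo g i ≡ g j
minTo-attained g zero = 0 , z≤n , refl
minTo-attained g (suc i) with mn-sel (minTo g i) (g (suc i)) | minTo-attained g i
... | inj₁ (_ , e) | j , j≤ , e′ = j , m≤n⇒m≤1+n j≤ , trans e e′
... | inj₂ (_ , e) | _ = suc i , ≤-refl , e

minTo-cong : ∀ {g h : ℕ → ℕ} i → (∀ j → j ≤ i → g j ≡ h j) → minTo g i ≡ minTo h i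
minTo-cong zero    e = e 0 z≤n
minTo-cong (suc i) e = cong₂ mn (minTo-cong i λ j j≤ → e j (m≤n⇒m≤1+n j≤)) (e (suc i) ≤-refl)

module Odometer (N : ℕ) (1≤N : 1 ≤ N) where

  Digits : ℕ → (ℕ → ℕ) → Set
  Digits k t = ∀ {i} → i < k → t i < N

  val : ℕ → (ℕ → ℕ) → ℕ
  val zero    t = 0
  val (suc k) t = t k * N ^ k + val k t

  carry : (ℕ → ℕ) → ℕ → ℕ
  carry t zero    = 1
  carry t (suc i) = carry t i * 𝟙 (t i ≡ᵇ N ∸ 1)

  next : (ℕ → ℕ) → ℕ → ℕ
  next t i = branch (carry t i) (branch (𝟙 (t i ≡ᵇ N ∸ 1)) 0 (suc (t i))) (t i)

  carry≤1 : ∀ t i → carry t i ≤ 1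
  carry≤1 t zero    = ≤-refl
  carry≤1 t (suc i) = *-mono-≤ (carry≤1 t i) (𝟙≤1 (t i ≡ᵇ N ∸ 1))

  next-digit : ∀ t i → t i < N → next t i + N * carry t (suc i) ≡ t i + carry t i × next t i < N
  next-digit t i t< with carry t i | carry≤1 t i
  ... | zero  | _ = cong (t i +_) (*-zeroʳ N) , t<
  ... | suc (suc _) | s≤s ()
  ... | suc zero | _ with t i ≡ᵇ N ∸ 1 in e
  ...   | true  = trans (*-identityʳ N) (trans (sym (m∸n+n≡m 1≤N)) (cong (_+ 1) (sym (≡ᵇ-true⁻¹ {t i} e)))) , 1≤N
  ...   | false = trans (cong (suc (t i) +_) (*-zeroʳ N)) (trans (+-identityʳ _) (+-comm 1 (t i))) ,
                  ≤∧≢⇒< t< λ e′ → t≢f (≡ᵇ-true (cong (_∸ 1) e′)) e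

  -- Addition of 1 digit by digit; the carry out of the last digit is worth `N ^ k`, so it signals
  -- that the enumeration is complete.
  val-next : ∀ k t → Digits k t → val k (next t) + N ^ k * carry t k ≡ val k t + 1
  val-next zero    t t< = refl
  val-next (suc k) t t< = begin
    (next t k * M + val k (next t)) + N * M * carry t (suc k)   ≡⟨ e₁ (next t k) M (val k (next t)) N (carry t (suc k)) ⟩
    M * (next t k + N * carry t (suc k)) + val k (next t)       ≡⟨ cong (λ z → M * z + val k (next t)) (proj₁ (next-digit t k (t< ≤-refl))) ⟩
    M * (t k + carry t k) + val k (next t)                      ≡⟨ e₂ M (t k) (carry t k) (val k (next t)) ⟩
    t k * M + (val k (next t) + M * carry t k)                  ≡⟨ cong (t k * M +_) (val-next k t (t< ∘ m<n⇒m<1+n)) ⟩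
    t k * M + (val k t + 1)                                     ≡⟨ sym (+-assoc (t k * M) _ 1) ⟩
    t k * M + val k t + 1                                       ∎
    where
    open ≡-Reasoning
    M = N ^ k
    e₁ : ∀ x M v N c → (x * M + v) + N * M * c ≡ M * (x + N * c) + v
    e₁ = solve-∀
    e₂ : ∀ M t c v → M * (t + c) + v ≡ t * M + (v + M * c)
    e₂ = solve-∀

  val< : ∀ k t → Digits k t → val k t < N ^ k
  val< zero    t t< = s≤s z≤n
  val< (suc k) t t< = pair< (t< ≤-refl) (val< k t (t< ∘ m<n⇒m<1+n))

  -- Division by `N ^ k` recovers the last digit and the remainder the others. Hence the search
  -- deals with every tuple when the odometer shows its value.
  val-injective : ∀ k t t′ → Digits k t → Digits k t′ → val k t ≡ val k t′ → ∀ {i} → i < k → t i ≡ t′ i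
  val-injective (suc k) t t′ t< t′< e {i} i< with m≤n⇒m<n∨m≡n (≤-pred i<)
  ... | inj₁ i<k  = val-injective k t t′ (t< ∘ m<n⇒m<1+n) (t′< ∘ m<n⇒m<1+n)
        (trans (sym (md-pair (t k) (val< k t (t< ∘ m<n⇒m<1+n)))) (trans (cong (_md N ^ k) e) (md-pair (t′ k) (val< k t′ (t′< ∘ m<n⇒m<1+n))))) i<k
  ... | inj₂ refl = trans (sym (dv-pair (t k) (val< k t (t< ∘ m<n⇒m<1+n)))) (trans (cong (_dv N ^ k) e) (dv-pair (t′ k) (val< k t′ (t′< ∘ m<n⇒m<1+n))))

val-zero : ∀ N 1≤N k → Odometer.val N 1≤N k (λ _ → 0) ≡ 0
val-zero N 1≤N zero    = refl
val-zero N 1≤N (suc k) = val-zero N 1≤N k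

len9 len11 len12 len13 len14 lenOut total# best# : Expr
cell7₀ cell9₀ cell10₀ cell7 cell8 cell9 cell10 cell11 cell12 cell13 cell14 cellOut : Cell

cell7₀  = ret (lit 0)
len9    = lit 1
-- At least the cost of any tuple, since every `D j c` is at most `suc d`.
cell9₀  = ret (N# ⊗ d1#)
cell10₀ = ret (lit 1)

len11  = N# ⊗ K#
cell11 = cond (lo K#) (ret (prev 11 ⊖ (prev 11 ⊖ g))) (ret g)
  where g = gap# (I# ⊘ K#) (rd 7 (lo K#))

len12  = N#
cell12 = ret (prefix# 12 I# ⊕ rd 11 (at2 I# K# (K# ⊖ lit 1)))

total# = rd 12 (N# ⊖ lit 1)
best#  = rd 9 (lit 0)

cell8  = cond (total# ⋖ best#) (ret (rd 7 I#)) (ret (rd 8 I#))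
cell9  = ret (best# ⊖ (best# ⊖ total#))

len13  = lit 1 ⊕ K#
cell13 = cond I# (ret (prev 13 ⊗ (rd 7 (I# ⊖ lit 1) ≐ n5# ⊖ lit 1))) (ret (lit 1))

cell7  = cond (rd 13 I#) (cond (rd 7 I# ≐ n5# ⊖ lit 1) (ret (lit 0)) (ret (lit 1 ⊕ rd 7 I#))) (ret (rd 7 I#))
cell10 = ret (lit 1 ⊖ rd 13 K#)

len14  = K# ⊗ D# ⊗ D#
cell14 = cond (place# (rd 8 (hi D# D#)) (lo D#) ≐ mid D# D#) (ret (lo D#)) (cond (lo D#) (ret (prev 14)) (ret (lit 0)))

lenOut  = K# ⊗ D#
cellOut = ret (rd 14 (at2 I# D# (D# ⊖ lit 1)))

tableOf : ℕ → Expr × Cell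
tableOf 0 = len0 , cell0
tableOf 1 = len1 , cell1
tableOf 2 = len2 , cell2
tableOf 3 = len3 , cell3
tableOf 4 = len4 , cell4
tableOf 5 = len5 , cell5
tableOf 7 = K# , cell7
tableOf 8 = K# , cell8
tableOf 9 = len9 , cell9
tableOf 10 = len9 , cell10
tableOf 11 = len11 , cell11
tableOf 12 = len12 , cell12
tableOf 13 = len13 , cell13
tableOf 14 = len14 , cell14
tableOf _ = lit 0 , ret (lit 0)

table : ℕ → Prog
table r = fillTable r (proj₁ (tableOf r)) (proj₂ (tableOf r))

preparation initialise round : Prog
preparation = table 0 ⨾ table 1 ⨾ table 2 ⨾ table 3 ⨾ table 4 ⨾ table 5
initialise  = fillTable 7 K# cell7₀ ⨾ fillTable 8 K# cell7₀ ⨾ fillTable 9 len9 cell9₀ ⨾ fillTable 10 len9 cell10₀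
round       = table 11 ⨾ table 12 ⨾ table 8 ⨾ table 9 ⨾ table 13 ⨾ table 7 ⨾ table 10

weightOf : ℕ → ℕ
weightOf r = fillWeight (cellAddr r (reg 4)) (proj₁ (tableOf r)) (proj₂ (tableOf r))

main : Prog
main = preparation ⨾ initialise ⨾ whilenz (rd 10 (lit 0)) round ⨾ table 14 ⨾
       fill (reg 4) lenOut cellOut ⨾ 0 ≔ K# ⨾ 1 ≔ lit 0

-- Correctness of the program

module Correctness (n d k w V K : ℕ) (fits : Fits n d k w V K) (1≤k : 1 ≤ k) (k≤n : k ≤ n) (heavy : 2000 ≤ K)
                   (X P : ℕ → ℕ → ℕ) (I : ∀ {x} → x < n → InverseOn d (X x) (P x))
                   (low : ℕ → ℕ) (low≡X : ∀ {j a} → j < n → a < d → low (j * d + a) ≡ X j a) where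

  open Fits fits
  open Machine n d k w V K fits
  open Candidates n d X P using (majority; place; D; D≡gap; module MajorityCorrect)

  d-1<d : d ∸ 1 < d
  d-1<d = ∸-monoʳ-< {d} ≤-refl 1≤d

  ∸1-suc : suc (d ∸ 1) ≡ d
  ∸1-suc = m+[n∸m]≡n 1≤d

  -- The intended contents of tables 1 to 5. A row of `f3` holds the results of the scan and then
  -- the flags after the step.
  f1 f2 f3 f4 f5 : ℕ → ℕ → ℕ → ℕ
  f1 j a i = search (X j) a i
  f2 c a b = 𝟙 (majority c a b)
  f3 c t e = if e <ᵇ d * d then scanTo (dead t) t (suc e) else dead (suc t) (e ∸ d * d)
    where open Elimination d (majority c)
  f4 c a b = sumTo (suc b) (λ b′ → 𝟙 (Elimination.before d (majority c) b′ a))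
  f5 q i e = if i <ᵇ e then 0 else LIS.longest d (place (q dv n) ∘ X (q md n)) i e

  F1 F2 F3 F4 F5 : ℕ → ℕ
  F1 = tab3 d d f1
  F2 = tab3 d d f2
  F3 = tab3 d (d * d + d) f3
  F4 = tab3 d d f4
  F5 = tab3 (suc d) (suc d) f5

  module At {s} (J : Inv s) where
    open Inv J public using (r0; r1; r2; r3)

    rd≡ : ∀ r e {L F j} → Reads s r (L , F) → ev s e ≡ j → j < L → ev s (rd r e) ≡ F j
    rd≡ r e reads e≡ j< = trans (cong₂ (λ b j → mem s (b + (j * 16 + r))) r3 e≡) (reads j<)

    rd2≡ : ∀ r {A m} f a M b {a′ b′} → Reads s r (A * m , tab2 m f) → ev s M ≡ m → ev s a ≡ a′ → ev s b ≡ b′ →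
           a′ < A → b′ < m → ev s (rd r (at2 a M b)) ≡ f a′ b′
    rd2≡ r f a M b {a′} reads M≡ a≡ b≡ a< b< =
      trans (rd≡ r (at2 a M b) reads (cong₂ _+_ (cong₂ _*_ a≡ M≡) b≡) (pair< a< b<)) (tab2-at f a′ b<)

    rd3≡ : ∀ r {A m₁ m₂} f c M₁ a M₂ b {c′ a′ b′} → Reads s r (A * m₁ * m₂ , tab3 m₁ m₂ f) →
           ev s M₁ ≡ m₁ → ev s M₂ ≡ m₂ → ev s c ≡ c′ → ev s a ≡ a′ → ev s b ≡ b′ →
           c′ < A → a′ < m₁ → b′ < m₂ → ev s (rd r (at3 c M₁ a M₂ b)) ≡ f c′ a′ b′
    rd3≡ r f c M₁ a M₂ b {c′} reads M₁≡ M₂≡ c≡ a≡ b≡ c< a< b< =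
      trans (rd≡ r (at3 c M₁ a M₂ b) reads (at3≡ c M₁ a M₂ b c≡ M₁≡ a≡ M₂≡ b≡) (pair< (pair< c< a<) b<))
            (tab3-at f c′ a< b<)

    pos≡ : ∀ j a {j′ a′} → Reads s 1 (n * d * d , F1) → ev s j ≡ j′ → ev s a ≡ a′ → j′ < n → a′ < d →
           ev s (pos# j a) ≡ P j′ a′
    pos≡ j a {j′} {a′} reads j≡ a≡ j< a< = trans
      (rd3≡ 1 f1 j D# a D# (D# ⊖ lit 1) reads r1 r1 j≡ a≡ (cong (_∸ 1) r1) j< a< d-1<d)
      (search-finds (I j<) {a′} (d ∸ 1) d-1<d a< (≤-pred (≤-trans (p< (I j<) a<) (≤-reflexive (sym ∸1-suc)))))

    quot≡ : ∀ c {c′} → ev s c ≡ c′ → ∀ r → ev s (quot# c r) ≡ quot n c′ r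
    quot≡ c e zero    = e
    quot≡ c e (suc r) = cong₂ _dv_ (quot≡ c e r) r0

    ix≡ : ∀ c {c′} → ev s c ≡ c′ → ∀ r → ev s (ix# c r) ≡ ix n c′ r
    ix≡ c e r = cong₂ _md_ (quot≡ c e r) r0

    votes≡ : ∀ c a b {c′ a′ b′} → Reads s 1 (n * d * d , F1) → ev s c ≡ c′ → ev s a ≡ a′ → ev s b ≡ b′ →
             a′ < d → b′ < d → ∀ r → ev s (votes# c a b r) ≡ sumTo r (Voting.vote d P (ix n c′) a′ b′)
    votes≡ c a b reads c≡ a≡ b≡ a< b< zero    = refl
    votes≡ c a b {c′} reads c≡ a≡ b≡ a< b< (suc r) = cong₂ _+_ (votes≡ c a b reads c≡ a≡ b≡ a< b< r)
      (cong₂ (apply lt) (pos≡ (ix# c r) a reads (ix≡ c c≡ r) a≡ (ix< 1≤n c′ r) a<)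
                        (pos≡ (ix# c r) b reads (ix≡ c c≡ r) b≡ (ix< 1≤n c′ r) b<))

    maj≡ : ∀ c a b {c′ a′ b′} → Reads s 2 (n ^ 5 * d * d , F2) → ev s c ≡ c′ → ev s a ≡ a′ → ev s b ≡ b′ →
           c′ < n ^ 5 → a′ < d → b′ < d → ev s (maj# c a b) ≡ 𝟙 (majority c′ a′ b′)
    maj≡ c a b reads c≡ a≡ b≡ = rd3≡ 2 {n ^ 5} f2 c D# a D# b reads r1 r1 c≡ a≡ b≡

  cell0≡ : ∀ {low Γ i s} → (∀ {j a} → j < n → a < d → low (j * d + a) ≡ X j a) → i < n * d →
           Ready Γ low 0 (tab2 d X) i s → evC s cell0 ≡ tab2 d X i
  cell0≡ {low} {i = i} {s} low≡X i< R with unpair n d i<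
  ... | j , a , j< , a< , refl = begin
    mem s (regs s 4)                ≡⟨ cong (mem s) idx ⟩
    mem s (j * d + a)               ≡⟨ low≡ i< ⟩
    low (j * d + a)                 ≡⟨ low≡X j< a< ⟩
    X j a                           ≡⟨ sym (tab2-at X j a<) ⟩
    tab2 d X (j * d + a)            ∎
    where
    open Ready R
    open ≡-Reasoning

  cell1≡ : ∀ {low Γ i s} → Γ 0 ≡ (n * d , tab2 d X) → i < n * d * d → Ready Γ low 1 F1 i s → evC s cell1 ≡ F1 i
  cell1≡ {Γ = Γ} {i} {s} Γ0 i< R with unpair3 n d d i<
  ... | j , a , i , j< , a< , i<d , refl = trans (value i i<d refl) (sym (tab3-at f1 j a< i<d))
    where
    open Ready R
    open At inv
    open Coordinates {s} {j} {a} {i} D# D# r1 r1 idx a< i<d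
    x≡ : ev s (rd 0 (at2 (hi D# D#) D# (lo D#)) ≐ mid D# D#) ≡ 𝟙 (X j i ≡ᵇ a)
    x≡ = cong₂ (apply eq) (rd2≡ 0 {n} X (hi D# D#) D# (lo D#) (subst (Reads s 0) Γ0 (others 0 refl refl)) r1 hi≡ lo≡ j< i<d) mid≡
    value : ∀ i′ → i′ < d → i′ ≡ i → evC s cell1 ≡ search (X j) a i′
    value zero _ refl = branch𝟙 x≡ (λ _ → branch≡ lo≡ (λ _ → refl) λ ()) (λ _ → lo≡)
    value (suc i′) i< refl with X j i ≡ᵇ a in e
    ... | true  = branch𝟙 (trans x≡ (cong 𝟙 e)) (λ ()) (λ _ → lo≡)
    ... | false = branch𝟙 (trans x≡ (cong 𝟙 e))
      (λ _ → branch≡ lo≡ (λ ()) λ _ → trans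
        (rd≡ 1 (I# ⊖ lit 1) {F = F1} self (trans (cong (_∸ 1) idx) (pred-pair (j * d + a) i′ d)) (+-monoʳ-< ((j * d + a) * d) ≤-refl))
        (tab3-at f1 j a< (<⇒≤ i<))) (λ ())

  cell2≡ : ∀ {low Γ i s} → Γ 1 ≡ (n * d * d , F1) → i < n ^ 5 * d * d → Ready Γ low 2 F2 i s → evC s cell2 ≡ F2 i
  cell2≡ {Γ = Γ} {i} {s} Γ1 i< R with unpair3 (n ^ 5) d d i<
  ... | c , a , b , c< , a< , b< , refl = trans
      (cong (apply lt 2) (votes≡ (hi D# D#) (mid D# D#) (lo D#) (subst (Reads s 1) Γ1 (others 1 refl refl)) hi≡ mid≡ lo≡ a< b< 5))
      (sym (tab3-at f2 c a< b<))
    where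
    open Ready R
    open At inv
    open Coordinates {s} {c} {a} {b} D# D# r1 r1 idx a< b<

  dd : ℕ
  dd = d * d

  Q : ℕ
  Q = dd + d

  1≤dd : 1 ≤ dd
  1≤dd = *-mono-≤ 1≤d 1≤d

  module _ (c : ℕ) where
    open Elimination d (majority c)

    f3-scan : ∀ t e → e < dd → f3 c t e ≡ scanTo (dead t) t (suc e)
    f3-scan t e e< rewrite <ᵇ-true e< = refl

    f3-dead : ∀ t a → f3 c t (dd + a) ≡ dead (suc t) a
    f3-dead t a rewrite <ᵇ-false (m≤m+n dd a) | m+n∸m≡n dd a = refl

  module Cell3 {Γ low s} {c t e : ℕ} (c< : c < n ^ 5) (t<d : t < d) (e<Q : e < Q)
               (reads2 : Reads s 2 (n ^ 5 * d * d , F2))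
               (R : Ready Γ low 3 F3 ((c * d + t) * Q + e) s) where

    open Ready R
    open At inv
    open Elimination d (majority c)

    dd≡ : ev s dd# ≡ dd
    dd≡ = cong₂ _*_ r1 r1

    Q≡ : ev s Q# ≡ Q
    Q≡ = cong₂ _+_ dd≡ r1

    open Coordinates {s} {c} {t} {e} D# Q# r1 Q≡ idx t<d e<Q

    c# t# e# : Expr
    c# = hi D# Q#
    t# = mid D# Q#
    e# = lo Q#

    base : ℕ
    base = (c * d + t) * Q

    base≡ : ev s (I# ⊖ e#) ≡ base
    base≡ = trans (cong₂ _∸_ idx lo≡) (m+n∸n≡m base e)

    previous-row : ∀ t′ a′ → (c * d + suc t′) * Q ∸ d + a′ ≡ (c * d + t′) * Q + (dd + a′)
    previous-row t′ a′ = begin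
      (c * d + suc t′) * Q ∸ d + a′      ≡⟨ cong (λ z → z * Q ∸ d + a′) (+-suc (c * d) t′) ⟩
      (dd + d + Y) ∸ d + a′              ≡⟨ cong (λ z → z ∸ d + a′) (trans (+-comm (dd + d) Y) (sym (+-assoc Y dd d))) ⟩
      (Y + dd + d) ∸ d + a′              ≡⟨ cong (_+ a′) (m+n∸n≡m (Y + dd) d) ⟩
      Y + dd + a′                        ≡⟨ +-assoc Y dd a′ ⟩
      Y + (dd + a′)                      ∎
      where
      open ≡-Reasoning
      Y = (c * d + t′) * Q

    oldDead≡ : ∀ a {a′ t′} → t ≡ suc t′ → ev s a ≡ a′ → a′ < d → ev s (oldDead# c# t# e# a) ≡ dead t a′
    oldDead≡ a {a′} {t′} refl a≡ a< = trans
      (rd≡ 3 (I# ⊖ e# ⊖ D# ⊕ a) {F = F3} self (trans (cong₂ _+_ (cong₂ _∸_ base≡ r1) a≡) (previous-row t′ a′)) earlier)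
      (trans (tab3-at f3 c (<⇒≤ t<d) (+-monoʳ-< dd a<)) (f3-dead c t′ a′))
      where
      earlier : (c * d + t′) * Q + (dd + a′) < base + e
      earlier = <-≤-trans (pair< {c * d + t′} {n = c * d + suc t′} (+-monoʳ-< (c * d) ≤-refl) (+-monoʳ-< dd a<)) (m≤m+n base e)

    module _ (e<dd : e < dd) where

      x<d : e dv d < d
      x<d = dv< d e<dd

      y<d : e md d < d
      y<d = md< e 1≤d

      x≡ : ev s (e# ⊘ D#) ≡ e dv d
      x≡ = cong₂ _dv_ lo≡ r1

      y≡ : ev s (e# ⊛ D#) ≡ e md d
      y≡ = cong₂ _md_ lo≡ r1

      cyc≡ : ∀ {t′} → t ≡ suc t′ → ev s (cyc# c# t# e#) ≡ cyc (dead t) t e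
      cyc≡ t≡ = cong₂ _*_ (cong₂ (apply lt) x≡ mid≡) (cong₂ _*_ (cong₂ (apply lt) y≡ mid≡)
        (cong₂ _*_ (cong (λ z → apply eq z 0) (oldDead≡ (e# ⊘ D#) t≡ x≡ x<d))
        (cong₂ _*_ (cong (λ z → apply eq z 0) (oldDead≡ (e# ⊛ D#) t≡ y≡ y<d))
        (cong₂ _*_ (maj≡ c# t# (e# ⊘ D#) reads2 hi≡ mid≡ x≡ c< t<d x<d)
        (cong₂ _*_ (maj≡ c# (e# ⊘ D#) (e# ⊛ D#) reads2 hi≡ x≡ y≡ c< x<d y<d)
                   (maj≡ c# (e# ⊛ D#) t# reads2 hi≡ y≡ mid≡ c< y<d t<d))))))

      fresh≡ : evC s (fresh# c# t# e#) ≡ cyc (dead t) t e * suc e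
      fresh≡ = branch≡ mid≡ (λ { refl → refl }) (λ t≡ → cong₂ _*_ (cyc≡ t≡) (cong suc lo≡))

      scan≡ : ∀ e′ → e′ ≡ e → evC s (scan# c# t# e#) ≡ scanTo (dead t) t (suc e′)
      scan≡ zero refl = branch≡ lo≡ (λ _ → fresh≡) λ ()
      scan≡ (suc e′) refl = branch≡ lo≡ (λ ()) λ _ →
        trans (branch-cong prev≡ prev≡ fresh≡) (sym (if≡branch (scanTo (dead t) t (suc e′)) _ _))
        where
        prev≡ : ev s (prev 3) ≡ scanTo (dead t) t (suc e′)
        prev≡ = trans (rd≡ 3 (I# ⊖ lit 1) {F = F3} self (trans (cong (_∸ 1) idx) (pred-pair (c * d + t) e′ Q)) (+-monoʳ-< base ≤-refl))
          (trans (tab3-at f3 c t<d (<-trans ≤-refl e<Q)) (f3-scan c t e′ (<⇒≤ e<dd)))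

    module _ (a : ℕ) (a<d : a < d) (e≡ : e ≡ dd + a) where

      a≡ : ev s (e# ⊖ dd#) ≡ a
      a≡ = trans (cong₂ _∸_ (trans lo≡ e≡) dd≡) (m+n∸m≡n dd a)

      found≡ : ev s (found# c# t# e#) ≡ scanTo (dead t) t dd
      found≡ = trans (rd≡ 3 (I# ⊖ e# ⊕ dd# ⊖ lit 1) {F = F3} self
          (trans (cong (_∸ 1) (cong₂ _+_ base≡ dd≡)) (+-∸-assoc base 1≤dd))
          (+-monoʳ-< base (<-≤-trans dd-1< (≤-trans (m≤m+n dd a) (≤-reflexive (sym e≡))))))
        (trans (tab3-at f3 c t<d (<-≤-trans dd-1< (m≤m+n dd d)))
          (trans (f3-scan c t (dd ∸ 1) dd-1<) (cong (scanTo (dead t) t) (m+[n∸m]≡n 1≤dd))))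
        where
        dd-1< : dd ∸ 1 < dd
        dd-1< = ∸-monoʳ-< {dd} ≤-refl 1≤dd

      old≡ : evC s (old# c# t# e#) ≡ dead t a
      old≡ = branch≡ mid≡ (λ { refl → refl }) (λ t≡ → oldDead≡ (e# ⊖ dd#) t≡ a≡ a<d)

      kill≡ : evC s (kill# c# t# e#) ≡ dead (suc t) a
      kill≡ = trans
        (branch-cong found≡
          (branch-cong (cong₂ (apply eq) a≡ (cong₂ _dv_ (cong (_∸ 1) found≡) r1)) refl
          (branch-cong (cong₂ (apply eq) a≡ (cong₂ _md_ (cong (_∸ 1) found≡) r1)) refl
          (branch-cong (cong₂ (apply eq) a≡ mid≡) refl old≡))) old≡)
        (sym (kill≡branch d (majority c) (dead t) t (scanTo (dead t) t dd) a))

    cell : evC s cell3 ≡ f3 c t e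
    cell with e <? dd
    ... | yes e<dd = trans (branch𝟙 {b = true} (trans (cong₂ (apply lt) lo≡ dd≡) (cong 𝟙 (<ᵇ-true e<dd))) (λ ()) (λ _ → scan≡ e<dd e refl))
                           (sym (f3-scan c t e e<dd))
    ... | no e≮dd = trans (branch𝟙 {b = false} (trans (cong₂ (apply lt) lo≡ dd≡) (cong 𝟙 (<ᵇ-false (≮⇒≥ e≮dd))))
                                   (λ _ → kill≡ (e ∸ dd) a<d e≡) (λ ()))
                          (trans (sym (f3-dead c t (e ∸ dd))) (cong (f3 c t) (sym e≡)))
      where
      e≡ : e ≡ dd + (e ∸ dd)
      e≡ = sym (m+[n∸m]≡n (≮⇒≥ e≮dd))
      a<d : e ∸ dd < d
      a<d = +-cancelˡ-< dd _ _ (subst (_< Q) e≡ e<Q)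

  cell3≡ : ∀ {low Γ i s} → Γ 2 ≡ (n ^ 5 * d * d , F2) → i < n ^ 5 * d * Q → Ready Γ low 3 F3 i s → evC s cell3 ≡ F3 i
  cell3≡ {i = i} {s} Γ2 i< R with unpair3 (n ^ 5) d Q i<
  ... | c , t , e , c< , t< , e< , refl =
    trans (Cell3.cell c< t< e< (subst (Reads s 2) Γ2 (Ready.others R 2 refl refl)) R) (sym (tab3-at f3 c t< e<))

  module Place {s} (J : Inv s) where
    open At J

    dead≡ : ∀ c a {c′ a′} → Reads s 3 (n ^ 5 * d * Q , F3) → ev s c ≡ c′ → ev s a ≡ a′ → c′ < n ^ 5 → a′ < d →
            ev s (dead# c a) ≡ Elimination.dead d (majority c′) d a′
    dead≡ c a {c′} {a′} reads c≡ a≡ c< a< = trans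
      (rd3≡ 3 {n ^ 5} f3 c D# (D# ⊖ lit 1) Q# (dd# ⊕ a) reads r1 (cong₂ _+_ (cong₂ _*_ r1 r1) r1) c≡ (cong (_∸ 1) r1)
        (cong₂ _+_ (cong₂ _*_ r1 r1) a≡) c< d-1<d (+-monoʳ-< dd a<))
      (trans (f3-dead c′ (d ∸ 1) a′) (cong (λ t → Elimination.dead d (majority c′) t a′) ∸1-suc))

    place≡ : ∀ c a {c′ a′} → Reads s 4 (n ^ 5 * d * d , F4) → ev s c ≡ c′ → ev s a ≡ a′ → c′ < n ^ 5 → a′ < d →
             ev s (place# c a) ≡ place c′ a′
    place≡ c a {c′} {a′} reads c≡ a≡ c< a< = trans
      (rd3≡ 4 {n ^ 5} f4 c D# a D# (D# ⊖ lit 1) reads r1 r1 c≡ a≡ (cong (_∸ 1) r1) c< a< d-1<d)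
      (cong (λ m → sumTo m (λ b′ → 𝟙 (Elimination.before d (majority c′) b′ a′))) ∸1-suc)

  before-cases : ∀ c D a b x → branch (D b) (branch (D a) (x + 𝟙 (b <ᵇ a)) (x + 0)) (branch (D a) (x + 1) (x + 𝟙 (majority c b a)))
                 ≡ x + 𝟙 (Elimination.beforeBy d (majority c) D b a)
  before-cases c D a b x with D b | D a
  ... | zero  | zero  = refl
  ... | zero  | suc _ = refl
  ... | suc _ | zero  = refl
  ... | suc _ | suc _ = refl

  cell4≡ : ∀ {low Γ i s} → Γ 2 ≡ (n ^ 5 * d * d , F2) → Γ 3 ≡ (n ^ 5 * d * Q , F3) → i < n ^ 5 * d * d →
           Ready Γ low 4 F4 i s → evC s cell4 ≡ F4 i
  cell4≡ {i = i} {s} Γ2 Γ3 i< R with unpair3 (n ^ 5) d d i<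
  ... | c , a , b , c< , a< , b< , refl = trans
    (trans (branch-cong (deadAt b# lo≡ b<)
        (branch-cong (deadAt a# mid≡ a<) (cong₂ _+_ prefix≡ (cong₂ (apply lt) lo≡ mid≡)) (cong (_+ 0) prefix≡))
        (branch-cong (deadAt a# mid≡ a<) (cong (_+ 1) prefix≡)
          (cong₂ _+_ prefix≡ (maj≡ c# b# a# (subst (Reads s 2) Γ2 (others 2 refl refl)) hi≡ lo≡ mid≡ c< b< a<))))
      (before-cases c (Elimination.dead d (majority c) d) a b (sumTo b g)))
    (sym (tab3-at f4 c a< b<))
    where
    open Ready R
    open At inv
    open Place inv
    open Coordinates {s} {c} {a} {b} D# D# r1 r1 idx a< b<
    c# = hi D# D#
    a# = mid D# D#
    b# = lo D#
    g : ℕ → ℕ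
    g b = 𝟙 (Elimination.before d (majority c) b a)
    deadAt : ∀ x {x′} → ev s x ≡ x′ → x′ < d → ev s (dead# c# x) ≡ Elimination.dead d (majority c) d x′
    deadAt x x≡ x< = dead≡ c# x (subst (Reads s 3) Γ3 (others 3 refl refl)) hi≡ x≡ c< x<
    prefix≡ : ev s (prefix# 4 b#) ≡ sumTo b g
    prefix≡ = trans (cong (λ z → 𝟙 (0 <ᵇ z) * ev s (prev 4)) lo≡) (cases b refl)
      where
      cases : ∀ b′ → b′ ≡ b → 𝟙 (0 <ᵇ b′) * ev s (prev 4) ≡ sumTo b′ g
      cases zero _ = refl
      cases (suc b′) refl = trans (+-identityʳ _) (trans
        (rd≡ 4 (I# ⊖ lit 1) {F = F4} self (trans (cong (_∸ 1) idx) (pred-pair (c * d + a) b′ d)) (+-monoʳ-< ((c * d + a) * d) ≤-refl))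
        (tab3-at f4 c a< (<⇒≤ b<)))

  module Cell5 {Γ low s} {q i e : ℕ} (q< : q < n ^ 5 * n) (i≤d : i < suc d) (e≤d : e < suc d)
               (reads0 : Reads s 0 (n * d , tab2 d X)) (reads4 : Reads s 4 (n ^ 5 * d * d , F4))
               (R : Ready Γ low 5 F5 ((q * suc d + i) * suc d + e) s) where

    open Ready R
    open At inv
    open Place inv

    d1≡ : ev s d1# ≡ suc d
    d1≡ = cong suc r1

    open Coordinates {s} {q} {i} {e} d1# d1# d1≡ d1≡ idx i≤d e≤d

    open LIS d (place (q dv n) ∘ X (q md n))

    row# i# e# : Expr
    row# = hi d1# d1#
    i# = mid d1# d1#
    e# = lo d1#

    value# : Expr → Expr
    value# p = place# (row# ⊘ N#) (rd 0 (at2 (row# ⊛ N#) D# p))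

    val : ℕ → ℕ
    val p = place (q dv n) (X (q md n) p)

    value≡ : ∀ p {p′} → ev s p ≡ p′ → p′ < d → ev s (value# p) ≡ val p′
    value≡ p {p′} p≡ p< = place≡ (row# ⊘ N#) (rd 0 (at2 (row# ⊛ N#) D# p)) reads4
      (cong₂ _dv_ hi≡ r0) (rd2≡ 0 {n} X (row# ⊛ N#) D# p reads0 r1 (cong₂ _md_ hi≡ r0) p≡ (md< q 1≤n) p<)
      (dv< (n ^ 5) q<) (x< (I (md< q 1≤n)) p<)

    cases : ∀ e′ → e′ ≡ e → e′ ≤ i → evC s cell5 ≡ longest i e′
    cases zero refl e≤i = branch𝟙 {b = false} (trans (cong₂ (apply lt) mid≡ lo≡) (cong 𝟙 (<ᵇ-false e≤i)))
      (λ _ → branch≡ lo≡ (λ _ → refl) λ ()) (λ ())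
    cases (suc e′) refl e<i = branch𝟙 {b = false} (trans (cong₂ (apply lt) mid≡ lo≡) (cong 𝟙 (<ᵇ-false e<i)))
      (λ _ → branch≡ lo≡ (λ ()) λ _ → inner) (λ ())
      where
      e′< : e′ < suc d
      e′< = <⇒≤ e≤d
      prev≡ : ev s (prev 5) ≡ longest i e′
      prev≡ = trans (rd≡ 5 (I# ⊖ lit 1) {F = F5} self (trans (cong (_∸ 1) idx) (pred-pair (q * suc d + i) e′ (suc d)))
                       (+-monoʳ-< ((q * suc d + i) * suc d) ≤-refl))
        (trans (tab3-at f5 q i≤d e′<) (cong (λ b → if b then 0 else longest i e′) (<ᵇ-false (<⇒≤ e<i))))
      diagonal≡ : ev s (rd 5 (at3 row# d1# (e# ⊖ lit 1) d1# (e# ⊖ lit 1))) ≡ longest e′ e′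
      diagonal≡ = trans (rd≡ 5 (at3 row# d1# (e# ⊖ lit 1) d1# (e# ⊖ lit 1)) {F = F5} self
          (at3≡ {s} row# d1# (e# ⊖ lit 1) d1# (e# ⊖ lit 1) hi≡ d1≡ (cong (_∸ 1) lo≡) d1≡ (cong (_∸ 1) lo≡))
          (+-mono-≤-< (*-monoˡ-≤ (suc d) (+-monoʳ-≤ (q * suc d) (<⇒≤ e<i))) ≤-refl))
        (trans (tab3-at f5 q e′< e′<) (cong (λ b → if b then 0 else longest e′ e′) (<ᵇ-false {e′} ≤-refl)))
      inner : branch (𝟙 (ev s i# ≡ᵇ ev s D#) + 𝟙 (ev s (value# (e# ⊖ lit 1)) <ᵇ ev s (value# i#)))
                     (mx (ev s (prev 5)) (suc (ev s (rd 5 (at3 row# d1# (e# ⊖ lit 1) d1# (e# ⊖ lit 1))))))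
                     (ev s (prev 5)) ≡ longest i (suc e′)
      inner with i ≡ᵇ d in i≡d
      ... | true  = trans (branch-cong (cong (_+ later) (trans (cong₂ (apply eq) mid≡ r1) (cong 𝟙 i≡d)))
                     (cong₂ _+_ (cong₂ _∸_ prev≡ (cong suc diagonal≡)) (cong suc diagonal≡)) refl) refl
        where
        later : ℕ
        later = 𝟙 (ev s (value# (e# ⊖ lit 1)) <ᵇ ev s (value# i#))
      ... | false = trans (branch-cong (cong₂ _+_ (trans (cong₂ (apply eq) mid≡ r1) (cong 𝟙 i≡d))
                       (cong₂ (apply lt) (value≡ (e# ⊖ lit 1) (cong (_∸ 1) lo≡) (≤-trans e<i (≤-pred i≤d))) (value≡ i# mid≡ i<d)))
                     (cong₂ _+_ (cong₂ _∸_ prev≡ (cong suc diagonal≡)) (cong suc diagonal≡)) prev≡)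
                   (sym (if≡branch𝟙 (val e′ <ᵇ val i) (mx (longest i e′) (suc (longest e′ e′))) (longest i e′)))
        where
        i<d : i < d
        i<d = ≤∧≢⇒< (≤-pred i≤d) λ i≡ → t≢f (≡ᵇ-true i≡) i≡d

    cell : evC s cell5 ≡ f5 q i e
    cell with i <? e
    ... | yes i<e = trans (branch𝟙 {b = true} (trans (cong₂ (apply lt) mid≡ lo≡) (cong 𝟙 (<ᵇ-true i<e))) (λ ()) (λ _ → refl))
                          (cong (λ b → if b then 0 else longest i e) (sym (<ᵇ-true i<e)))
    ... | no i≮e  = trans (cases e refl (≮⇒≥ i≮e)) (cong (λ b → if b then 0 else longest i e) (sym (<ᵇ-false (≮⇒≥ i≮e))))

  cell5≡ : ∀ {low Γ i s} → Γ 0 ≡ (n * d , tab2 d X) → Γ 4 ≡ (n ^ 5 * d * d , F4) →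
           i < n ^ 5 * n * suc d * suc d → Ready Γ low 5 F5 i s → evC s cell5 ≡ F5 i
  cell5≡ {i = i} {s} Γ0 Γ4 i< R with unpair3 (n ^ 5 * n) (suc d) (suc d) i<
  ... | q , i , e , q< , i<′ , e< , refl = trans
    (Cell5.cell q< i<′ e< (subst (Reads s 0) Γ0 (Ready.others R 0 refl refl)) (subst (Reads s 4) Γ4 (Ready.others R 4 refl refl)) R)
    (sym (tab3-at f5 q i<′ e<))

  module Gap {s} (J : Inv s) where
    open At J

    gap≡ : ∀ j c {j′ c′} → Reads s 5 (n ^ 5 * n * suc d * suc d , F5) → ev s j ≡ j′ → ev s c ≡ c′ →
           j′ < n → c′ < n ^ 5 → ev s (gap# j c) ≡ D j′ c′
    gap≡ j c {j′} {c′} reads j≡ c≡ j< c< = trans (cong₂ _∸_ (cong suc r1) (trans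
      (rd3≡ 5 {n ^ 5 * n} f5 (at2 c N# j) d1# D# d1# D# reads (cong suc r1) (cong suc r1)
         (cong₂ _+_ (cong₂ _*_ c≡ r0) j≡) r1 r1 (pair< c< j<) ≤-refl ≤-refl)
      (trans (cong (λ b → if b then 0 else LIS.longest d (place (q dv n) ∘ X (q md n)) d d) (<ᵇ-false {d} ≤-refl))
             (cong₂ (λ c j → LIS.longest d (place c ∘ X j) d d) (dv-pair c′ j<) (md-pair c′ j<))))) (sym (D≡gap j′ c′))
      where
      q = c′ * n + j′

  -- Every weight is a closed numeral, so the implicit argument is found by evaluation; 2000 exceeds
  -- them all.
  small : ∀ x → {T (x ≤ᵇ 2000)} → x ≤ K
  small x {x≤} = ≤-trans (≤ᵇ⇒≤ x 2000 x≤) heavy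

  St : Tables → Store → Set
  St Γ s = Inv s × Holds Γ s × (∀ {b} → b < n * d → mem s b ≡ low b)

  -- A Hoare triple with a time bound, composed by `_then_`.
  Step : Prog → Tables → Tables → ℕ → Set
  Step P Γ Γ′ T = ∀ {s} → St Γ s → ∃[ t ] ∃[ s′ ] Run w P s t s′ × t ≤ T × St Γ′ s′

  infixr 5 _then_

  _then_ : ∀ {P Q Γ Γ′ Γ″ T T′} → Step P Γ Γ′ T → Step Q Γ′ Γ″ T′ → Step (P ⨾ Q) Γ Γ″ (T + T′)
  (f then g) st =
    let t , s , run , t≤ , st₁ = f st
        t′ , s′ , run′ , t′≤ , st₂ = g st₁
    in t + t′ , s′ , seq run run′ , +-mono-≤ t≤ t′≤ , st₂

  fillStep : ∀ r len c → fillWeight (cellAddr r (reg 4)) len c ≤ K → (r <ᵇ 16) ≡ true →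
    ∀ L → L ≤ V → (∀ {s} → Inv s → ev s len ≡ L) → ∀ F → (∀ {i} → i < L → F i ≤ V) →
    ∀ Γ → (∀ {i s} → i < L → Ready Γ low r F i s → evC s c ≡ F i) →
    Step (fillTable r len c) Γ (Γ ⟪ r ↦ L , F ⟫) (K * suc L)
  fillStep r len c light r< L L≤V len≡ F F≤ Γ cell (J , H , low₀) =
    let t , s , run , t≤ , J′ , H′ , low′ = fillTable-run r len c light r< L L≤V len≡ F F≤ {low = low} J H low₀ cell
    in t , s , run , t≤ , J′ , H′ , low′

  Γ₀ Γ₁ Γ₂ Γ₃ Γ₄ Γ₅ Γ₆ : Tables
  Γ₀ _ = 0 , λ _ → 0
  Γ₁ = Γ₀ ⟪ 0 ↦ n * d , tab2 d X ⟫
  Γ₂ = Γ₁ ⟪ 1 ↦ n * d * d , F1 ⟫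
  Γ₃ = Γ₂ ⟪ 2 ↦ n ^ 5 * d * d , F2 ⟫
  Γ₄ = Γ₃ ⟪ 3 ↦ n ^ 5 * d * Q , F3 ⟫
  Γ₅ = Γ₄ ⟪ 4 ↦ n ^ 5 * d * d , F4 ⟫
  Γ₆ = Γ₅ ⟪ 5 ↦ n ^ 5 * n * suc d * suc d , F5 ⟫

  n5≡ : ∀ {s} → Inv s → ev s n5# ≡ n ^ 5
  n5≡ J rewrite Inv.r0 J = refl

  1≤V : 1 ≤ V
  1≤V = ≤-trans (s≤s z≤n) 2≤V

  md<d : ∀ i → i md d < d
  md<d i = md< i 1≤d

  F3≤ : ∀ {i} → i < n ^ 5 * d * Q → F3 i ≤ V
  F3≤ {i} i< with unpair3 (n ^ 5) d Q i<
  ... | c , t , e , c< , t< , e< , refl = ≤-trans (≤-reflexive (tab3-at f3 c t< e<)) (bound (e <? dd))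
    where
    open Elimination d (majority c)
    bound : Dec (e < dd) → f3 c t e ≤ V
    bound (yes e<dd) = ≤-trans (≤-reflexive (f3-scan c t e e<dd)) (≤-trans (scan≤ (dead t) t (suc e)) (≤-trans e<dd dd≤V))
    bound (no e≮dd)  = ≤-trans (≤-reflexive (trans (cong (f3 c t) (sym (m+[n∸m]≡n (≮⇒≥ e≮dd)))) (f3-dead c t (e ∸ dd))))
      (≤-trans (MajorityCorrect.dead≤1 1≤n I c (suc t) (e ∸ dd)) 1≤V)

  F5≤ : ∀ {i} → F5 i ≤ V
  F5≤ {i} = go (i dv suc d dv suc d) (i dv suc d md suc d) (i md suc d) (≤-pred (md< i (s≤s z≤n)))
    where
    go : ∀ q i e → e ≤ d → f5 q i e ≤ V
    go q i e e≤d with i <ᵇ e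
    ... | true  = z≤n
    ... | false = ≤-trans (LIS.longest≤ d _ i e) (≤-trans (s≤s e≤d)
      (≤-trans (≤-trans (≤-reflexive (sym (*-identityˡ (suc d)))) (*-monoˡ-≤ (suc d) 1≤n)) (<⇒≤ nd<V)))

  T₀ : ℕ
  T₀ = K * suc (n * d) + (K * suc (n * d * d) + (K * suc (n ^ 5 * d * d) + (K * suc (n ^ 5 * d * Q) +
       (K * suc (n ^ 5 * d * d) + K * suc (n ^ 5 * n * suc d * suc d)))))

  preparation-step : Step preparation Γ₀ Γ₆ T₀
  preparation-step =
    fillStep 0 len0 cell0 (small (weightOf 0)) refl (n * d) nd≤V (λ J → cong₂ _*_ (Inv.r0 J) (Inv.r1 J)) (tab2 d X)
      (λ {i} i< → ≤-trans (<⇒≤ (x< (I (dv< n i<)) (md<d i))) d≤V) Γ₀ (cell0≡ low≡X)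
    then fillStep 1 len1 cell1 (small (weightOf 1)) refl (n * d * d) ndd≤V (λ J → cong₂ _*_ (cong₂ _*_ (Inv.r0 J) (Inv.r1 J)) (Inv.r1 J)) F1
      (λ {i} _ → ≤-trans (search≤ _ _ (i md d)) (≤-trans (<⇒≤ (md<d i)) d≤V)) Γ₁ (cell1≡ refl)
    then fillStep 2 len2 cell2 (small (weightOf 2)) refl (n ^ 5 * d * d) n⁵dd≤V (λ J → cong₂ _*_ (cong₂ _*_ (n5≡ J) (Inv.r1 J)) (Inv.r1 J)) F2
      (λ {i} _ → ≤-trans (𝟙≤1 (majority (i dv d dv d) (i dv d md d) (i md d))) 1≤V) Γ₂ (cell2≡ refl)
    then fillStep 3 len3 cell3 (small (weightOf 3)) refl (n ^ 5 * d * Q) n⁵dQ≤V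
      (λ J → cong₂ _*_ (cong₂ _*_ (n5≡ J) (Inv.r1 J)) (cong₂ _+_ (cong₂ _*_ (Inv.r1 J) (Inv.r1 J)) (Inv.r1 J))) F3 F3≤ Γ₃ (cell3≡ refl)
    then fillStep 4 len4 cell4 (small (weightOf 4)) refl (n ^ 5 * d * d) n⁵dd≤V (λ J → cong₂ _*_ (cong₂ _*_ (n5≡ J) (Inv.r1 J)) (Inv.r1 J)) F4
      (λ {i} _ → ≤-trans (sum-bound (suc (i md d)) {c = 1} (λ b _ → 𝟙≤1 (Elimination.before d (majority (i dv d dv d)) b (i dv d md d))))
                 (≤-trans (≤-reflexive (*-identityʳ _)) (≤-trans (md<d i) d≤V))) Γ₄ (cell4≡ refl refl)
    then fillStep 5 len5 cell5 (small (weightOf 5)) refl (n ^ 5 * n * suc d * suc d) n⁶d²≤V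
      (λ J → cong₂ _*_ (cong₂ _*_ (cong₂ _*_ (n5≡ J) (Inv.r0 J)) (cong suc (Inv.r1 J))) (cong suc (Inv.r1 J))) F5 (λ {i} _ → F5≤ {i}) Γ₅ (cell5≡ refl refl)

  -- The search through all tuples of candidates

  N : ℕ
  N = n ^ 5

  1≤N : 1 ≤ N
  1≤N = m^n>0 n {{>-nonZero 1≤n}} 5

  open Odometer N 1≤N

  costs : (ℕ → ℕ) → ℕ → ℕ
  costs t j = minTo (λ i → D j (t i)) (k ∸ 1)

  total : (ℕ → ℕ) → ℕ
  total t = sumTo n (costs t)

  k-1<k : k ∸ 1 < k
  k-1<k = ∸-monoʳ-< {k} ≤-refl 1≤k

  n-1<n : n ∸ 1 < n
  n-1<n = ∸-monoʳ-< {n} ≤-refl 1≤n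

  D≤ : ∀ j c → D j c ≤ suc d
  D≤ j c = ≤-trans (≤-reflexive (D≡gap j c)) (m∸n≤m (suc d) (LIS.longest d (place c ∘ X j) d d))

  sd≤V : suc d ≤ V
  sd≤V = ≤-trans (≤-trans (≤-reflexive (sym (*-identityˡ (suc d)))) (*-monoˡ-≤ (suc d) 1≤n)) (<⇒≤ nd<V)

  costs≤ : ∀ (t : ℕ → ℕ) i j → minTo (λ i → D j (t i)) i ≤ suc d
  costs≤ t i j = ≤-trans (minTo-≤ (λ i → D j (t i)) i ≤-refl) (D≤ j (t i))

  total≤ : ∀ t → total t ≤ n * suc d
  total≤ t = sum-bound n λ j _ → costs≤ t (k ∸ 1) j

  costs-cong : ∀ {t u : ℕ → ℕ} → (∀ {i} → i < k → t i ≡ u i) → ∀ j → costs t j ≡ costs u j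
  costs-cong e j = minTo-cong (k ∸ 1) λ i i≤ → cong (D j) (e (≤-<-trans i≤ k-1<k))

  total-cong : ∀ {t u : ℕ → ℕ} → (∀ {i} → i < k → t i ≡ u i) → total t ≡ total u
  total-cong {t} {u} e = sum-cong n λ j _ → costs-cong {t} {u} e j

  Γl : (ℕ → ℕ) → (ℕ → ℕ) → ℕ → ℕ → Tables
  Γl dig best bc flag = (((Γ₆ ⟪ 7 ↦ k , dig ⟫) ⟪ 8 ↦ k , best ⟫) ⟪ 9 ↦ 1 , (λ _ → bc) ⟫) ⟪ 10 ↦ 1 , (λ _ → flag) ⟫

  Γ₇ Γ₈ Γ₉ : Tables
  Γ₇ = Γ₆ ⟪ 7 ↦ k , (λ _ → 0) ⟫
  Γ₈ = Γ₇ ⟪ 8 ↦ k , (λ _ → 0) ⟫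
  Γ₉ = Γ₈ ⟪ 9 ↦ 1 , (λ _ → n * suc d) ⟫

  T₁ : ℕ
  T₁ = K * suc k + (K * suc k + (K * 2 + K * 2))

  initialise-step : Step initialise Γ₆ (Γl (λ _ → 0) (λ _ → 0) (n * suc d) 1) T₁
  initialise-step =
    fillStep 7 K# cell7₀ (small (fillWeight (cellAddr 7 (reg 4)) K# cell7₀)) refl k k≤V Inv.r2 (λ _ → 0) (λ _ → z≤n) Γ₆ (λ _ _ → refl)
    then fillStep 8 K# cell7₀ (small (fillWeight (cellAddr 8 (reg 4)) K# cell7₀)) refl k k≤V Inv.r2 (λ _ → 0) (λ _ → z≤n) Γ₇ (λ _ _ → refl)
    then fillStep 9 len9 cell9₀ (small (fillWeight (cellAddr 9 (reg 4)) len9 cell9₀)) refl 1 1≤V (λ _ → refl)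
      (λ _ → n * suc d) (λ _ → <⇒≤ nd<V) Γ₈ (λ _ R → cong₂ _*_ (Inv.r0 (Ready.inv R)) (cong suc (Inv.r1 (Ready.inv R))))
    then fillStep 10 len9 cell10₀ (small (fillWeight (cellAddr 10 (reg 4)) len9 cell10₀)) refl 1 1≤V (λ _ → refl)
      (λ _ → 1) (λ _ → 1≤V) Γ₉ (λ _ _ → refl)

  T₂ : ℕ
  T₂ = K * suc (n * k) + (K * suc n + (K * suc k + (K * 2 + (K * suc (suc k) + (K * suc k + K * 2)))))

  module Round (dig best : ℕ → ℕ) (bc : ℕ) (dig< : Digits k dig) (best< : Digits k best) (bc≤ : bc ≤ n * suc d) where

    best′ : ℕ → ℕ
    best′ i = branch (𝟙 (total dig <ᵇ bc)) (dig i) (best i)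

    bc′ : ℕ
    bc′ = mn bc (total dig)

    f11 : ℕ → ℕ → ℕ
    f11 j i = minTo (λ i → D j (dig i)) i

    F12 : ℕ → ℕ
    F12 j = sumTo (suc j) (costs dig)

    Γa Γb Γc Γd Γe Γf Γg Γh : Tables
    Γa = Γl dig best bc 1
    Γb = Γa ⟪ 11 ↦ n * k , tab2 k f11 ⟫
    Γc = Γb ⟪ 12 ↦ n , F12 ⟫
    Γd = Γc ⟪ 8 ↦ k , best′ ⟫
    Γe = Γd ⟪ 9 ↦ 1 , (λ _ → bc′) ⟫
    Γf = Γe ⟪ 13 ↦ suc k , carry dig ⟫
    Γg = Γf ⟪ 7 ↦ k , next dig ⟫
    Γh = Γg ⟪ 10 ↦ 1 , (λ _ → 1 ∸ carry dig k) ⟫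

    bc′≤ : bc′ ≤ n * suc d
    bc′≤ = ≤-trans (mn≤a bc (total dig)) bc≤

    best′< : Digits k best′
    best′< i< with total dig <ᵇ bc
    ... | true  = dig< i<
    ... | false = best< i<

    next< : Digits k (next dig)
    next< {i} i< = proj₂ (next-digit dig i (dig< i<))

    cell11≡ : ∀ {i s} → i < n * k → Ready Γa low 11 (tab2 k f11) i s → evC s cell11 ≡ tab2 k f11 i
    cell11≡ {s = s} i< R with unpair n k i<
    ... | j , i , j< , i<k , refl = trans (value i refl) (sym (tab2-at f11 j i<k))
      where
      open Ready R
      open At inv
      open Gap inv
      lo≡ : ev s (lo K#) ≡ i
      lo≡ = trans (cong₂ _md_ idx r2) (md-pair j i<k)
      j≡ : ev s (I# ⊘ K#) ≡ j
      j≡ = trans (cong₂ _dv_ idx r2) (dv-pair j i<k)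
      g = gap# (I# ⊘ K#) (rd 7 (lo K#))
      g≡ : ev s g ≡ D j (dig i)
      g≡ = gap≡ (I# ⊘ K#) (rd 7 (lo K#)) (others 5 refl refl) j≡
             (rd≡ 7 (lo K#) {F = dig} (others 7 refl refl) lo≡ i<k) j< (dig< i<k)
      value : ∀ i′ → i′ ≡ i → evC s cell11 ≡ f11 j i′
      value zero refl = branch≡ lo≡ (λ _ → g≡) λ ()
      value (suc i′) refl = branch≡ lo≡ (λ ()) λ _ → cong₂ mn prev≡ g≡
        where
        prev≡ : ev s (prev 11) ≡ f11 j i′
        prev≡ = trans (rd≡ 11 (I# ⊖ lit 1) {F = tab2 k f11} self (trans (cong (_∸ 1) idx) (pred-pair j i′ k)) (+-monoʳ-< (j * k) ≤-refl))
                      (tab2-at f11 j (<⇒≤ i<k))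

    cell12≡ : ∀ {i s} → i < n → Ready Γb low 12 F12 i s → evC s cell12 ≡ F12 i
    cell12≡ {i} {s} i< R = cong₂ _+_ (trans (cong (λ z → 𝟙 (0 <ᵇ z) * ev s (prev 12)) idx) (prefix i refl))
      (rd2≡ 11 {n} f11 I# K# (K# ⊖ lit 1) (others 11 refl refl) r2 idx (cong (_∸ 1) r2) i< k-1<k)
      where
      open Ready R
      open At inv
      prefix : ∀ i′ → i′ ≡ i → 𝟙 (0 <ᵇ i′) * ev s (prev 12) ≡ sumTo i′ (costs dig)
      prefix zero _ = refl
      prefix (suc i′) refl = trans (+-identityʳ _) (rd≡ 12 (I# ⊖ lit 1) {F = F12} self (cong (_∸ 1) idx) ≤-refl)

    total≡ : ∀ {s} → Inv s → Reads s 12 (n , F12) → ev s total# ≡ total dig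
    total≡ J reads = trans (At.rd≡ J 12 (N# ⊖ lit 1) {F = F12} reads (cong (_∸ 1) (Inv.r0 J)) n-1<n)
                           (cong (λ m → sumTo m (costs dig)) (m+[n∸m]≡n 1≤n))

    cell8≡ : ∀ {i s} → i < k → Ready Γc low 8 best′ i s → evC s cell8 ≡ best′ i
    cell8≡ {i} {s} i< R = branch-cong
      (cong₂ (apply lt) (total≡ inv (others 12 refl refl)) (rd≡ 9 (lit 0) {F = λ _ → bc} (others 9 refl refl) refl (s≤s z≤n)))
      (rd≡ 7 I# {F = dig} (others 7 refl refl) idx i<)
      (trans (cong₂ (λ b j → mem s (b + (j * 16 + 8))) r3 idx) (old ≤-refl i<))
      where
      open Ready R
      open At inv

    cell9≡ : ∀ {i s} → i < 1 → Ready Γd low 9 (λ _ → bc′) i s → evC s cell9 ≡ bc′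
    cell9≡ {zero} {s} _ R = cong₂ mn bc≡ (total≡ inv (others 12 refl refl))
      where
      open Ready R
      open At inv
      bc≡ : ev s best# ≡ bc
      bc≡ = trans (cong (λ b → mem s (b + 9)) r3) (old z≤n (s≤s z≤n))
    cell9≡ {suc _} (s≤s ())

    cell13≡ : ∀ {i s} → i < suc k → Ready Γe low 13 (carry dig) i s → evC s cell13 ≡ carry dig i
    cell13≡ {zero} {s} _ R = branch≡ (Ready.idx R) (λ _ → refl) λ ()
    cell13≡ {suc i} {s} (s≤s i<) R = branch≡ idx (λ ()) λ _ → cong₂ _*_
      (rd≡ 13 (I# ⊖ lit 1) {F = carry dig} self (cong (_∸ 1) idx) ≤-refl)
      (cong₂ (apply eq) (rd≡ 7 (I# ⊖ lit 1) {F = dig} (others 7 refl refl) (cong (_∸ 1) idx) i<) (cong (_∸ 1) (n5≡ inv)))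
      where
      open Ready R
      open At inv

    cell7≡ : ∀ {i s} → i < k → Ready Γf low 7 (next dig) i s → evC s cell7 ≡ next dig i
    cell7≡ {i} {s} i< R = branch-cong (rd≡ 13 I# {F = carry dig} (others 13 refl refl) idx (<-trans i< ≤-refl))
      (branch-cong (cong₂ (apply eq) dig≡ (cong (_∸ 1) (n5≡ inv))) refl (cong suc dig≡)) dig≡
      where
      open Ready R
      open At inv
      dig≡ : ev s (rd 7 I#) ≡ dig i
      dig≡ = trans (cong₂ (λ b j → mem s (b + (j * 16 + 7))) r3 idx) (old ≤-refl i<)

    cell10≡ : ∀ {i s} → i < 1 → Ready Γg low 10 (λ _ → 1 ∸ carry dig k) i s → evC s cell10 ≡ 1 ∸ carry dig k
    cell10≡ _ R = cong (1 ∸_) (rd≡ 13 K# {F = carry dig} (others 13 refl refl) r2 ≤-refl)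
      where
      open Ready R
      open At inv

    step11 : Step (table 11) Γa Γb (K * suc (n * k))
    step11 = fillStep 11 len11 cell11 (small (weightOf 11)) refl (n * k) nk≤V (λ J → cong₂ _*_ (Inv.r0 J) (Inv.r2 J)) (tab2 k f11)
        (λ {i} _ → ≤-trans (costs≤ dig (i md k) (i dv k)) sd≤V) Γa cell11≡

    step12 : Step (table 12) Γb Γc (K * suc n)
    step12 = fillStep 12 len12 cell12 (small (weightOf 12)) refl n n≤V Inv.r0 F12
        (λ {j} j< → ≤-trans (sum-bound (suc j) λ j _ → costs≤ dig (k ∸ 1) j) (≤-trans (*-monoˡ-≤ (suc d) j<) (<⇒≤ nd<V))) Γb cell12≡

    step8 : Step (table 8) Γc Γd (K * suc k)
    step8 = fillStep 8 K# cell8 (small (weightOf 8)) refl k k≤V Inv.r2 best′ (λ i< → ≤-trans (<⇒≤ (best′< i<)) n⁵≤V) Γc cell8≡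

    step9 : Step (table 9) Γd Γe (K * 2)
    step9 = fillStep 9 len9 cell9 (small (weightOf 9)) refl 1 1≤V (λ _ → refl) (λ _ → bc′) (λ _ → ≤-trans bc′≤ (<⇒≤ nd<V)) Γd cell9≡

    step13 : Step (table 13) Γe Γf (K * suc (suc k))
    step13 = fillStep 13 len13 cell13 (small (weightOf 13)) refl (suc k) k<V (λ J → cong suc (Inv.r2 J)) (carry dig)
        (λ {i} _ → ≤-trans (carry≤1 dig i) 1≤V) Γe cell13≡

    step7 : Step (table 7) Γf Γg (K * suc k)
    step7 = fillStep 7 K# cell7 (small (weightOf 7)) refl k k≤V Inv.r2 (next dig) (λ i< → ≤-trans (<⇒≤ (next< i<)) n⁵≤V) Γf cell7≡

    step10 : Step (table 10) Γg Γh (K * 2)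
    step10 = fillStep 10 len9 cell10 (small (weightOf 10)) refl 1 1≤V (λ _ → refl) (λ _ → 1 ∸ carry dig k)
        (λ _ → ≤-trans (m∸n≤m 1 (carry dig k)) 1≤V) Γg cell10≡

    all-fills : Step round Γa Γh T₂
    all-fills = step11 then step12 then step8 then step9 then step13 then step7 then step10

    forget : ∀ {s} → Holds Γh s → Holds (Γl (next dig) best′ bc′ (1 ∸ carry dig k)) s
    forget H 0 = H 0
    forget H 1 = H 1
    forget H 2 = H 2
    forget H 3 = H 3
    forget H 4 = H 4
    forget H 5 = H 5
    forget H 6 = H 6
    forget H 7 = H 7
    forget H 8 = H 8
    forget H 9 = H 9
    forget H 10 = H 10
    forget H (suc (suc (suc (suc (suc (suc (suc (suc (suc (suc (suc r))))))))))) _ ()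

    round-step : Step round Γa (Γl (next dig) best′ bc′ (1 ∸ carry dig k)) T₂
    round-step st = let t , s , run , t≤ , J , H , low₁ = all-fills st in t , s , run , t≤ , J , forget {s} H , low₁

  -- The loop invariant once the tuples of value below `v` are tried. `reach` is an inequality
  -- because the initial bound need not be attained.
  record Best (v : ℕ) (best : ℕ → ℕ) (bc : ℕ) : Set where
    field
      best<  : Digits k best
      bc≤    : bc ≤ n * suc d
      reach  : total best ≤ bc
      lower  : ∀ {t} → Digits k t → val k t < v → bc ≤ total t

  Best-round : ∀ {dig best bc} (dig< : Digits k dig) (B : Best (val k dig) best bc) →
    let open Round dig best bc dig< (Best.best< B) (Best.bc≤ B) in Best (suc (val k dig)) best′ bc′
  Best-round {dig} {best} {bc} dig< B = record
    { best< = best′< ; bc≤ = bc′≤ ; reach = reach′ (total dig <ᵇ bc) refl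
    ; lower = λ {t} t< v< → earlier t t< (m≤n⇒m<n∨m≡n (≤-pred v<)) }
    where
    open Best B
    open Round dig best bc dig< best< bc≤
    reach′ : ∀ b → (total dig <ᵇ bc) ≡ b → total best′ ≤ bc′
    reach′ true  e with mn-sel bc (total dig)
    ... | inj₁ (bc≤total , _) = contradiction (<ᵇ-true⁻¹ {total dig} e) (≤⇒≯ bc≤total)
    ... | inj₂ (_ , bc′≡)     = ≤-reflexive (trans (total-cong {best′} {dig} λ {i} _ → cong (λ b → branch (𝟙 b) (dig i) (best i)) e) (sym bc′≡))
    reach′ false e with mn-sel bc (total dig)
    ... | inj₂ (total≤bc , bc′≡) = ≤-trans (≤-trans unchanged reach)
            (≤-trans (≮⇒≥ λ l → t≢f (<ᵇ-true l) e) (≤-reflexive (sym bc′≡)))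
      where
      unchanged : total best′ ≤ total best
      unchanged = ≤-reflexive (total-cong {best′} {best} λ {i} _ → cong (λ b → branch (𝟙 b) (dig i) (best i)) e)
    ... | inj₁ (_ , bc′≡) = ≤-trans (≤-reflexive (total-cong {best′} {best} λ {i} _ → cong (λ b → branch (𝟙 b) (dig i) (best i)) e))
            (≤-trans reach (≤-reflexive (sym bc′≡)))
    earlier : ∀ t → Digits k t → val k t < val k dig ⊎ val k t ≡ val k dig → bc′ ≤ total t
    earlier t t< (inj₁ v<) = ≤-trans (mn≤a bc (total dig)) (lower t< v<)
    earlier t t< (inj₂ v≡) = ≤-trans (mn≤b bc (total dig)) (≤-reflexive (total-cong {dig} {t} (val-injective k dig t dig< t< (sym v≡))))

  flag≡ : ∀ {s dig best bc flag} → St (Γl dig best bc flag) s → eval w s (rd 10 (lit 0)) ≡ flag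
  flag≡ {flag = flag} (J , H , _) = trans (eval≡ev (bounded J) (rd 10 (lit 0)) (small (degree (rd 10 (lit 0)))))
    (At.rd≡ J 10 (lit 0) {F = λ _ → flag} (H 10 refl) refl (s≤s z≤n))

  search-loop : Prog
  search-loop = whilenz (rd 10 (lit 0)) round

  -- Testing the flag takes 9 steps, in every round and once at the end.
  Finished : Store → ℕ → ℕ → Set
  Finished s rounds t = ∃[ s′ ] ∃[ dig ] ∃[ best ] ∃[ bc ] Run w search-loop s t s′ × t ≤ rounds * (T₂ + 9) + 9 ×
    St (Γl dig best bc 0) s′ × Best (N ^ k) best bc

  -- `suc m` tuples are left. The carry out of the last digit clears the flag, and by `val-next` it
  -- occurs only when no further tuple remains.
  loop : ∀ m {s dig best bc} → St (Γl dig best bc 1) s → Digits k dig → val k dig + suc m ≡ N ^ k →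
         Best (val k dig) best bc → ∃ (Finished s (suc m))
  loop m {s} {dig} {best} {bc} st dig< left B =
    continue (round-step st) (carry dig k) refl
    where
    open Round dig best bc dig< (Best.best< B) (Best.bc≤ B)
    v = val k dig
    B′ : Best (suc v) best′ bc′
    B′ = Best-round dig< B
    nonzero : eval w s (rd 10 (lit 0)) ≢ 0
    nonzero z = 1≢0 (trans (sym (flag≡ {dig = dig} {best} {bc} st)) z)
    v′ : val k (next dig) + N ^ k * carry dig k ≡ suc v
    v′ = trans (val-next k dig dig<) (+-comm v 1)
    time : ∀ t₁ t₂ r → t₁ ≤ T₂ → t₂ ≤ r → 9 + t₁ + t₂ ≤ (T₂ + 9) + r
    time t₁ t₂ r h₁ h₂ = +-mono-≤ (≤-trans (+-monoʳ-≤ 9 h₁) (≤-reflexive (+-comm 9 T₂))) h₂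
    continue : (∃[ t ] ∃[ s′ ] Run w round s t s′ × t ≤ T₂ × St (Γl (next dig) best′ bc′ (1 ∸ carry dig k)) s′) →
               ∀ c → carry dig k ≡ c → ∃ (Finished s (suc m))
    continue (t₁ , s₁ , run₁ , t₁≤ , st₁) (suc (suc c)) e = contradiction (≤-trans (≤-reflexive (sym e)) (carry≤1 dig k)) λ { (s≤s ()) }
    continue (t₁ , s₁ , run₁ , t₁≤ , st₁) (suc zero) e = 9 + t₁ + 9 , s₁ , next dig , best′ , bc′ ,
      while-nonzero nonzero run₁ (while-zero (flag≡ {dig = next dig} {best′} {bc′} st₂)) ,
      ≤-trans (time t₁ 9 9 t₁≤ ≤-refl) (≤-trans (+-monoʳ-≤ (T₂ + 9) (m≤n+m 9 (m * (T₂ + 9))))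
                                                (≤-reflexive (sym (+-assoc (T₂ + 9) (m * (T₂ + 9)) 9)))) ,
      st₂ , record { best< = Best.best< B′ ; bc≤ = Best.bc≤ B′ ; reach = Best.reach B′
                   ; lower = λ t< v< → Best.lower B′ t< (<-≤-trans v< last) }
      where
      st₂ : St (Γl (next dig) best′ bc′ 0) s₁
      st₂ = subst (λ c → St (Γl (next dig) best′ bc′ (1 ∸ c)) s₁) e st₁
      last : N ^ k ≤ suc v
      last = ≤-trans (≤-reflexive (trans (sym (*-identityʳ (N ^ k))) (cong (N ^ k *_) (sym e)))) (≤-trans (m≤n+m _ (val k (next dig))) (≤-reflexive v′))
    continue (t₁ , s₁ , run₁ , t₁≤ , st₁) zero e = again m left
      where
      st₂ : St (Γl (next dig) best′ bc′ 1) s₁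
      st₂ = subst (λ c → St (Γl (next dig) best′ bc′ (1 ∸ c)) s₁) e st₁
      v″ : val k (next dig) ≡ suc v
      v″ = trans (sym (trans (cong (val k (next dig) +_) (trans (cong (N ^ k *_) e) (*-zeroʳ (N ^ k)))) (+-identityʳ _))) v′
      again : ∀ m → v + suc m ≡ N ^ k → ∃ (Finished s (suc m))
      -- Without a carry the next value would have to be `N ^ k`, which digits below `N` cannot
      -- represent.
      again zero left = contradiction (val< k (next dig) next<) (≤⇒≯ (≤-reflexive (trans (sym left) (trans (+-comm v 1) (sym v″)))))
      again (suc m) left =
        let t₂ , s₂ , dig₂ , best₂ , bc₂ , run₂ , t₂≤ , st₃ , B₂ =
              loop m st₂ next< (trans (cong (_+ suc m) v″) (trans (sym (+-suc v (suc m))) left)) (subst (λ v → Best v best′ bc′) (sym v″) B′)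
        in 9 + t₁ + t₂ , s₂ , dig₂ , best₂ , bc₂ , while-nonzero nonzero run₁ run₂ ,
           ≤-trans (time t₁ t₂ _ t₁≤ t₂≤) (≤-reflexive (sym (+-assoc (T₂ + 9) (suc m * (T₂ + 9)) 9))) , st₃ , B₂

  module Output (dig best : ℕ → ℕ) (bc : ℕ) (best< : Digits k best) where

    -- `place` maps symbols to positions; the output lists symbols by position, so the ranking is
    -- inverted by search.
    f14 : ℕ → ℕ → ℕ → ℕ
    f14 i p a = search (place (best i)) p a

    Γp Γq : Tables
    Γp = Γl dig best bc 0
    Γq = Γp ⟪ 14 ↦ k * d * d , tab3 d d f14 ⟫

    cell14≡ : ∀ {i s} → i < k * d * d → Ready Γp low 14 (tab3 d d f14) i s → evC s cell14 ≡ tab3 d d f14 i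
    cell14≡ {s = s} i< R with unpair3 k d d i<
    ... | i , p , a , i<k , p< , a< , refl = trans (value a a< refl) (sym (tab3-at f14 i p< a<))
      where
      open Ready R
      open At inv
      open Place inv
      open Coordinates {s} {i} {p} {a} D# D# r1 r1 idx p< a<
      hit≡ : ev s (place# (rd 8 (hi D# D#)) (lo D#) ≐ mid D# D#) ≡ 𝟙 (place (best i) a ≡ᵇ p)
      hit≡ = cong₂ (apply eq) (place≡ (rd 8 (hi D# D#)) (lo D#) (others 4 refl refl)
               (rd≡ 8 (hi D# D#) {F = best} (others 8 refl refl) hi≡ i<k) lo≡ (best< i<k) a<) mid≡
      value : ∀ a′ → a′ < d → a′ ≡ a → evC s cell14 ≡ f14 i p a′
      value zero _ refl = branch𝟙 hit≡ (λ _ → branch≡ lo≡ (λ _ → refl) λ ()) (λ _ → lo≡)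
      value (suc a′) a< refl = trans (branch-cong hit≡ lo≡ (branch≡ lo≡ (λ ()) (λ _ → trans
          (rd≡ 14 (I# ⊖ lit 1) {F = tab3 d d f14} self (trans (cong (_∸ 1) idx) (pred-pair (i * d + p) a′ d)) (+-monoʳ-< ((i * d + p) * d) ≤-refl))
          (tab3-at f14 i p< (<⇒≤ a<)))))
        (sym (if≡branch𝟙 (place (best i) (suc a′) ≡ᵇ p) (suc a′) (f14 i p a′)))

    table14 : Step (table 14) Γp Γq (K * suc (k * d * d))
    table14 = fillStep 14 len14 cell14 (small (weightOf 14)) refl (k * d * d) kdd≤V
      (λ J → cong₂ _*_ (cong₂ _*_ (Inv.r2 J) (Inv.r1 J)) (Inv.r1 J)) (tab3 d d f14)
      (λ {i} _ → ≤-trans (search≤ _ _ (i md d)) (≤-trans (<⇒≤ (md<d i)) d≤V)) Γp cell14≡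

    fOut : ℕ → ℕ → ℕ
    fOut i p = f14 i p (d ∸ 1)

    cellOut≡ : ∀ {i s} → i < k * d → Inv s → regs s 4 ≡ i → Holds Γq s → evC s cellOut ≡ tab2 d fOut i
    cellOut≡ {s = s} i< J idx H with unpair k d i<
    ... | i , p , i<k , p< , refl = trans
      (trans (rd≡ 14 (at2 I# D# (D# ⊖ lit 1)) {F = tab3 d d f14} (H 14 refl) (cong₂ _+_ (cong₂ _*_ idx r1) (cong (_∸ 1) r1)) (pair< i< d-1<d))
             (tab3-at f14 i p< d-1<d))
      (sym (tab2-at fOut i p<))
      where open At J

    written : ∀ {s} → St Γp s → ∃[ t ] ∃[ s′ ] Run w (table 14 ⨾ fill (reg 4) lenOut cellOut) s t s′ ×
              t ≤ K * suc (k * d * d) + K * suc (k * d) × Inv s′ × (∀ {i p} → i < k → p < d → mem s′ (i * d + p) ≡ fOut i p)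
    written st =
      let t₁ , s₁ , run₁ , t₁≤ , J₁ , H₁ , _ = table14 st
          t₂ , s₂ , run₂ , t₂≤ , J₂ , out = fillLow-run lenOut cellOut (small (fillWeight (reg 4) lenOut cellOut)) (k * d) (*-monoˡ-≤ d k≤n)
            (λ J → cong₂ _*_ (Inv.r2 J) (Inv.r1 J)) (tab2 d fOut)
            (λ {i} _ → ≤-trans (search≤ _ _ (d ∸ 1)) (≤-trans (<⇒≤ d-1<d) d≤V)) {Γq} J₁ H₁ cellOut≡
      in t₁ + t₂ , s₂ , seq run₁ run₂ , +-mono-≤ t₁≤ t₂≤ , J₂ , λ {i} {p} i< p< → trans (out (pair< i< p<)) (tab2-at fOut i p<)

  T₃ T-main : ℕ
  T₃     = (K * suc (k * d * d) + K * suc (k * d)) + 4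
  T-main = T₀ + (T₁ + ((N ^ k * (T₂ + 9) + 9) + T₃))

  record Solution (P : Prog) (s : Store) (T : ℕ) : Set where
    field
      {t}   : ℕ
      {s′}  : Store
      best  : ℕ → ℕ
      run   : Run w P s t s′
      t≤    : t ≤ T
      size  : regs s′ 0 ≡ k
      zero-start : regs s′ 1 ≡ 0
      out   : ∀ {i p} → i < k → p < d → mem s′ (i * d + p) ≡ search (place (best i)) p (d ∸ 1)
      best< : Digits k best
      opt   : ∀ {t} → Digits k t → total best ≤ total t

  zero-run : ∀ s → Run w (1 ≔ lit 0) s 2 (setReg 1 0 s)
  zero-run s = subst (λ v → Run w (1 ≔ lit 0) s 2 (setReg 1 v s)) (m<n⇒m%n≡m {{m^n≢0 2 w}} (m^n>0 2 w)) assign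

  reassoc : ∀ {P Q R s s₁ s₂ t t′} → Run w (P ⨾ Q) s t s₁ → Run w R s₁ t′ s₂ → Run w (P ⨾ Q ⨾ R) s (t + t′) s₂
  reassoc {P} {Q} {R} {s} {s₂ = s₂} {t′ = t′} (seq {t = a} {t′ = b} p q) r =
    subst (λ t → Run w (P ⨾ Q ⨾ R) s t s₂) (sym (+-assoc a b t′)) (seq p (seq q r))

  writing : Prog
  writing = table 14 ⨾ fill (reg 4) lenOut cellOut ⨾ 0 ≔ K# ⨾ 1 ≔ lit 0

  write : ∀ {s dig best bc} → St (Γl dig best bc 0) s → Best (N ^ k) best bc → Solution writing s T₃
  write {s} {dig} {best} {bc} st B = conclude (Output.written dig best bc (Best.best< B) st)
    where
    conclude : (∃[ t ] ∃[ s′ ] Run w (table 14 ⨾ fill (reg 4) lenOut cellOut) s t s′ ×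
      t ≤ K * suc (k * d * d) + K * suc (k * d) × Inv s′ ×
      (∀ {i p} → i < k → p < d → mem s′ (i * d + p) ≡ search (place (best i)) p (d ∸ 1))) → Solution writing s T₃
    conclude (t , s′ , run , t≤ , J , out) = record
      { best = best ; run = reassoc run (seq assign (zero-run _)) ; t≤ = +-monoˡ-≤ 4 t≤
      ; size = Inv.r2 J ; zero-start = refl ; out = out ; best< = Best.best< B
      ; opt = λ {u} u< → ≤-trans (Best.reach B) (Best.lower B u< (val< k u u<)) }

  after : ∀ {P Q s t s₁ T U} → Run w P s t s₁ → t ≤ T → Solution Q s₁ U → Solution (P ⨾ Q) s (T + U)
  after run t≤ S = record
    { best = best ; run = seq run S.run ; t≤ = +-mono-≤ t≤ S.t≤ ; size = size ; zero-start = zero-start ; out = out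
    ; best< = best< ; opt = opt }
    where
    module S = Solution S
    open S using (best; size; zero-start; out; best<; opt)

  searched : ∀ {s} → St (Γl (λ _ → 0) (λ _ → 0) (n * suc d) 1) s → Solution (search-loop ⨾ writing) s ((N ^ k * (T₂ + 9) + 9) + T₃)
  searched {s} st = conclude (loop (N ^ k ∸ 1) {dig = λ _ → 0} st (λ _ → 1≤N) start first)
    where
    rounds : suc (N ^ k ∸ 1) ≡ N ^ k
    rounds = m+[n∸m]≡n (m^n>0 N {{>-nonZero 1≤N}} k)
    start : val k (λ _ → 0) + suc (N ^ k ∸ 1) ≡ N ^ k
    start = trans (cong (_+ suc (N ^ k ∸ 1)) (val-zero N 1≤N k)) rounds
    first : Best (val k (λ _ → 0)) (λ _ → 0) (n * suc d)
    first = record { best< = λ _ → 1≤N ; bc≤ = ≤-refl ; reach = total≤ (λ _ → 0)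
                   ; lower = λ {t} _ v< → contradiction (<-≤-trans v< (≤-reflexive (val-zero N 1≤N k))) λ () }
    conclude : ∃ (Finished s (suc (N ^ k ∸ 1))) → Solution (search-loop ⨾ writing) s ((N ^ k * (T₂ + 9) + 9) + T₃)
    conclude (t , s′ , dig , best , bc , run , t≤ , st′ , B) =
      after run (subst (λ r → t ≤ r * (T₂ + 9) + 9) rounds t≤) (write {dig = dig} st′ B)

  main-run : ∀ {s} → St Γ₀ s → Solution main s T-main
  main-run {s} st₀ = first (preparation-step st₀)
    where
    second : ∀ {s} → (∃[ t ] ∃[ s′ ] Run w initialise s t s′ × t ≤ T₁ × St (Γl (λ _ → 0) (λ _ → 0) (n * suc d) 1) s′) →
             Solution (initialise ⨾ search-loop ⨾ writing) s (T₁ + ((N ^ k * (T₂ + 9) + 9) + T₃))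
    second (t , s′ , run , t≤ , st) = after run t≤ (searched st)
    first : (∃[ t ] ∃[ s′ ] Run w preparation s t s′ × t ≤ T₀ × St Γ₆ s′) → Solution main s T-main
    first (t , s′ , run , t≤ , st) = after run t≤ (second (initialise-step st))

-- An optimal solution exists: the permutations form a finite set up to _≈_.

Minimizable : (X : Set) → (X → X → Set) → Set
Minimizable X _~_ = ∀ (f : X → ℕ) → (∀ {x y} → x ~ y → f x ≡ f y) → ∃[ x ] ∀ y → f x ≤ f y

Fin-minimizable : ∀ {d} (f : Fin (suc d) → ℕ) → ∃[ i ] ∀ j → f i ≤ f j
Fin-minimizable {zero}  f = zero , λ { zero → ≤-refl }
Fin-minimizable {suc d} f with Fin-minimizable (f ∘ suc)
... | i , min with ≤-total (f zero) (f (suc i))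
... | inj₁ le = zero , λ { zero → ≤-refl ; (suc j) → ≤-trans le (min j) }
... | inj₂ ge = suc i , λ { zero → ge ; (suc j) → min j }

insert-cong : ∀ {d} j {π ρ : Permutation′ d} → π ≈ ρ → insert zero j π ≈ insert zero j ρ
insert-cong j π≈ρ zero    = refl
insert-cong j {π} {ρ} π≈ρ (suc i) = trans (insert-punchIn zero j π i)
  (trans (cong (Fin.punchIn j) (π≈ρ i)) (sym (insert-punchIn zero j ρ i)))

-- Up to `_≈_`, a permutation is the image of `zero` together with a permutation of the rest:
-- minimise over the rest for each image, then over the images.
Permutation-minimizable : ∀ d → Minimizable (Permutation′ d) _≈_
Permutation-minimizable zero    f f-cong = Perm.id , λ π → ≤-reflexive (f-cong λ ())
Permutation-minimizable (suc d) f f-cong = insert zero j (rest j) , λ π →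
  ≤-trans (j-min (π ⟨$⟩ʳ zero)) (≤-trans (rest-min (π ⟨$⟩ʳ zero) (remove zero π))
    (≤-reflexive (f-cong {insert zero (π ⟨$⟩ʳ zero) (remove zero π)} {π} (insert-remove zero π))))
  where
  rests : ∀ j → ∃[ π ] ∀ ρ → f (insert zero j π) ≤ f (insert zero j ρ)
  rests j = Permutation-minimizable d (λ π → f (insert zero j π))
    (λ {π} {ρ} e → f-cong {insert zero j π} {insert zero j ρ} (insert-cong j {π} {ρ} e))
  rest : Fin (suc d) → Permutation′ d
  rest j = proj₁ (rests j)
  rest-min : ∀ j ρ → f (insert zero j (rest j)) ≤ f (insert zero j ρ)
  rest-min j = proj₂ (rests j)
  first : ∃[ i ] ∀ j → f (insert zero i (rest i)) ≤ f (insert zero j (rest j))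
  first = Fin-minimizable (λ j → f (insert zero j (rest j)))
  j = proj₁ first
  j-min = proj₂ first

Vec-minimizable : ∀ {X _~_} → (∀ {x} → x ~ x) → Minimizable X _~_ → ∀ m → Minimizable (Vec X m) (Pointwise _~_)
Vec-minimizable ~-refl min zero f f-cong = [] , λ { [] → ≤-refl }
Vec-minimizable {X} {_~_} ~-refl min (suc m) f f-cong =
  x ∷ rest x , λ { (y ∷ ys) → ≤-trans (x-min y) (rest-min y ys) }
  where
  ≋-refl : ∀ {m} {xs : Vec X m} → Pointwise _~_ xs xs
  ≋-refl = Pointwise.refl ~-refl
  tails : ∀ x → ∃[ ys ] ∀ zs → f (x ∷ ys) ≤ f (x ∷ zs)
  tails x = Vec-minimizable ~-refl min m (f ∘ (x ∷_)) (λ e → f-cong (~-refl ∷ e))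
  rest : X → Vec X m
  rest x = proj₁ (tails x)
  rest-min : ∀ x zs → f (x ∷ rest x) ≤ f (x ∷ zs)
  rest-min x = proj₂ (tails x)
  -- The tails chosen for `x` and `y` may differ, but each is minimal, so their values agree.
  g-cong : ∀ {x y} → x ~ y → f (x ∷ rest x) ≡ f (y ∷ rest y)
  g-cong {x} {y} e = ≤-antisym
    (≤-trans (rest-min x (rest y)) (≤-reflexive (f-cong (e ∷ ≋-refl))))
    (≤-trans (rest-min y (rest x)) (≤-reflexive (sym (f-cong (e ∷ ≋-refl)))))
  x = proj₁ (min (λ x → f (x ∷ rest x)) g-cong)
  x-min = proj₂ (min (λ x → f (x ∷ rest x)) g-cong)

Δ-congʳ : ∀ {d} (σ : Permutation′ d) {τ ρ : Permutation′ d} → τ ≈ ρ → Δ σ τ ≡ Δ σ ρ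
Δ-congʳ {d} σ e = cong (λ y → least (λ m → moves? m (oneLine σ) y) d) (tabulate-cong e)

dist-cong : ∀ {d m} x {Y Z : Vec (Permutation′ d) (suc m)} → Pointwise _≈_ Y Z → dist x Y ≡ dist x Z
dist-cong x Y≋Z = cong (Vec.foldr₁ _⊓_) (map-cong Y≋Z)
  where
  map-cong : ∀ {m} {Y Z : Vec _ m} → Pointwise _≈_ Y Z → Vec.map (Δ x) Y ≡ Vec.map (Δ x) Z
  map-cong [] = refl
  map-cong (_∷_ {x = τ} {y = ρ} e es) = cong₂ _∷_ (Δ-congʳ x {τ} {ρ} e) (map-cong es)

Obj-cong : ∀ {d n m} (S : Vec (Permutation′ d) n) {Y Z : Vec (Permutation′ d) (suc m)} →
           Pointwise _≈_ Y Z → Obj S Y ≡ Obj S Z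
Obj-cong []      e = refl
Obj-cong (x ∷ S) {Y} {Z} e = cong₂ _+_ (dist-cong x e) (Obj-cong S {Y} {Z} e)

module _ {d n} (S : Vec (Permutation′ d) n) where

  IsMin : ∀ {m} → Vec (Permutation′ d) (suc m) → Set
  IsMin {m} Z = ∀ (Y : Vec (Permutation′ d) (suc m)) → Obj S Z ≤ Obj S Y

  optimum-of-size : ∀ m → ∃[ Z ] IsMin {m} Z
  optimum-of-size m = Vec-minimizable {_~_ = _≈_} (λ {x} _ → refl) (Permutation-minimizable d) (suc m)
                                      (Obj S) (λ {Y} {Z} → Obj-cong S {Y} {Z})

  -- The new optimum is the smaller of the optimum for `k` and the best value with exactly `suc k`
  -- entries.
  IsOPT-suc : ∀ {k v} → IsOPT S k v → (Z : Vec (Permutation′ d) (suc k)) → IsMin Z →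
              v ≤ Obj S Z ⊎ Obj S Z ≤ v → ∃[ v′ ] IsOPT S (suc k) v′
  IsOPT-suc {k} {v} ((m , Y , m≤ , Y≡) , v-min) Z Z-min (inj₁ v≤) =
    v , (m , Y , m≤n⇒m≤1+n m≤ , Y≡) , λ m′ Y′ m′≤ → cases m′ Y′ (m≤n⇒m<n∨m≡n m′≤)
    where
    cases : ∀ m′ (Y′ : Vec (Permutation′ d) (suc m′)) → suc m′ < suc k ⊎ suc m′ ≡ suc k → v ≤ Obj S Y′
    cases m′ Y′ (inj₁ m′<)  = v-min m′ Y′ (≤-pred m′<)
    cases m′ Y′ (inj₂ refl) = ≤-trans v≤ (Z-min Y′)
  IsOPT-suc {k} {v} (_ , v-min) Z Z-min (inj₂ Z≤) =
    Obj S Z , (k , Z , ≤-refl , refl) , λ m′ Y′ m′≤ → cases m′ Y′ (m≤n⇒m<n∨m≡n m′≤)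
    where
    cases : ∀ m′ (Y′ : Vec (Permutation′ d) (suc m′)) → suc m′ < suc k ⊎ suc m′ ≡ suc k → Obj S Z ≤ Obj S Y′
    cases m′ Y′ (inj₁ m′<)  = ≤-trans Z≤ (v-min m′ Y′ (≤-pred m′<))
    cases m′ Y′ (inj₂ refl) = Z-min Y′

  optimum : ∀ k → 1 ≤ k → ∃[ v ] IsOPT S k v
  optimum (suc zero) _ = initial (optimum-of-size 0)
    where
    initial : (∃[ Z ] IsMin {0} Z) → ∃[ v ] IsOPT S 1 v
    initial (Z , min) = Obj S Z , (0 , Z , ≤-refl , refl) , λ { zero Y _ → min Y ; (suc _) Y (s≤s ()) }
  optimum (suc (suc k)) _ = step (optimum (suc k) (s≤s z≤n)) (optimum-of-size (suc k))
    where
    step : (∃[ v ] IsOPT S (suc k) v) → (∃[ Z ] IsMin {suc k} Z) → ∃[ v ] IsOPT S (suc (suc k)) v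
    step (v , opt) (Z , min) = IsOPT-suc opt Z min (≤-total v (Obj S Z))

-- The objective function and its approximation by candidates

nth : ∀ {A : Set} {n} → A → Vec A n → ℕ → A
nth a []       _       = a
nth a (x ∷ xs) zero    = x
nth a (x ∷ xs) (suc i) = nth a xs i

nth-lookup : ∀ {A : Set} {n} (a : A) (xs : Vec A n) i → nth a xs (toℕ i) ≡ lookup xs i
nth-lookup a (x ∷ xs) zero    = refl
nth-lookup a (x ∷ xs) (suc i) = nth-lookup a xs i

Obj≡sum : ∀ {d n m} (S : Vec (Permutation′ d) n) (Y : Vec (Permutation′ d) (suc m)) →
          Obj S Y ≡ sumTo n (λ j → dist (nth Perm.id S j) Y)
Obj≡sum []      Y = refl
Obj≡sum {n = suc n} (x ∷ S) Y = trans (cong (dist x Y +_) (Obj≡sum S Y)) (sym (sum-head n (λ j → dist (nth Perm.id (x ∷ S) j) Y)))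

dist≤ : ∀ {d m} x (Y : Vec (Permutation′ d) (suc m)) i → dist x Y ≤ Δ x (lookup Y i)
dist≤ x (y ∷ [])     zero    = ≤-refl
dist≤ x (y ∷ z ∷ Y)  zero    = m⊓n≤m (Δ x y) _
dist≤ x (y ∷ z ∷ Y)  (suc i) = ≤-trans (m⊓n≤n (Δ x y) _) (dist≤ x (z ∷ Y) i)

dist-attained : ∀ {d m} x (Y : Vec (Permutation′ d) (suc m)) → ∃[ i ] dist x Y ≡ Δ x (lookup Y i)
dist-attained x (y ∷ []) = zero , refl
dist-attained x (y ∷ z ∷ Y) with ⊓-sel (Δ x y) (dist x (z ∷ Y)) | dist-attained x (z ∷ Y)
... | inj₁ e | _      = zero , e
... | inj₂ e | i , e′ = suc i , trans e e′

module Solutions {d n} (S : Vec (Permutation′ d) n) (1≤n : 1 ≤ n) (k : ℕ) (1≤k : 1 ≤ k) where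

  σ : ℕ → Permutation′ d
  σ = nth Perm.id S

  X P : ℕ → ℕ → ℕ
  X j = seqOf (σ j)
  P j = posOf (σ j)

  I : ∀ {x} → x < n → InverseOn d (X x) (P x)
  I {x} _ = inverseOn (σ x)

  open Candidates n d X P

  abstract
    candidate : ℕ → Permutation′ d
    candidate c = fromPos (place c) (rank<d) (rank-injective)
      where open MajorityCorrect 1≤n I c

    candidate-pos : ∀ c {a} → a < d → posOf (candidate c) a ≡ place c a
    candidate-pos c = posOf-fromPos (place c) rank<d rank-injective
      where open MajorityCorrect 1≤n I c

  Δ≤D : ∀ j c → Δ (σ j) (candidate c) ≤ D j c
  Δ≤D j c = ≤-trans (Δ≤gap (σ j) (candidate c) (place c) (candidate-pos c)) (≤-reflexive (sym (D≡gap j c)))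

  -- By definition the same cost that the program minimises.
  costs : (ℕ → ℕ) → ℕ → ℕ
  costs t j = minTo (λ i → D j (t i)) (k ∸ 1)

  total : (ℕ → ℕ) → ℕ
  total t = sumTo n (costs t)

  medians : (ℕ → ℕ) → Vec (Permutation′ d) (suc (k ∸ 1))
  medians t = tabulate (λ i → candidate (t (toℕ i)))

  -- `D` bounds `Δ` from above, and the minimum in `costs` is attained by one of the medians.
  Obj≤total : ∀ t → Obj S (medians t) ≤ total t
  Obj≤total t = ≤-trans (≤-reflexive (Obj≡sum S (medians t))) (sum-mono n λ j _ → bound j)
    where
    attained : ∀ j → (∃[ i ] i ≤ k ∸ 1 × costs t j ≡ D j (t i)) → dist (σ j) (medians t) ≤ costs t j
    attained j (i , i≤ , e) = at (toFin (s≤s i≤))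
      where
      at : (∃[ i′ ] toℕ i′ ≡ i) → dist (σ j) (medians t) ≤ costs t j
      at (i′ , refl) = begin
        dist (σ j) (medians t)                      ≤⟨ dist≤ (σ j) (medians t) i′ ⟩
        Δ (σ j) (lookup (medians t) i′)             ≡⟨ cong (Δ (σ j)) (lookup∘tabulate (λ i → candidate (t (toℕ i))) i′) ⟩
        Δ (σ j) (candidate (t (toℕ i′)))            ≤⟨ Δ≤D j (t (toℕ i′)) ⟩
        D j (t (toℕ i′))                            ≡⟨ sym e ⟩
        costs t j                                   ∎
        where open ≤-Reasoning
    bound : ∀ j → dist (σ j) (medians t) ≤ costs t j
    bound j = attained j (minTo-attained (λ i → D j (t i)) (k ∸ 1))

  -- Every set of medians is matched, cluster by cluster, by candidates; 124 is 4 * grow 5.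
  module _ (A B : ℕ) (2A≡B+1 : 2 * A ≡ B + 1) (A+124≤B : A + 124 ≤ B) {m} (Y : Vec (Permutation′ d) (suc m)) (m<k : suc m ≤ k) where

    -- The default pads `Y` to `k` medians; the clusters of the added ones are empty.
    y : ℕ → Permutation′ d
    y = nth Perm.id Y

    centre : ℕ → ℕ
    centre j = toℕ (proj₁ (dist-attained (σ j) Y))

    centre-dist : ∀ j → dist (σ j) Y ≡ Δ (σ j) (y (centre j))
    centre-dist j = trans (proj₂ (dist-attained (σ j) Y)) (cong (Δ (σ j)) (sym (nth-lookup Perm.id Y (proj₁ (dist-attained (σ j) Y)))))

    centre<k : ∀ j → centre j < k
    centre<k j = <-≤-trans (Fin.toℕ<n (proj₁ (dist-attained (σ j) Y))) m<k

    cluster : ℕ → ℕ → ℕ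
    cluster i j = 𝟙 (i ≡ᵇ centre j)

    chosen : ∀ i → ∃[ c ] c < n ^ 5 × A * sumTo n (λ j → cluster i j * D j c) ≤ B * sumTo n (λ j → cluster i j * Δ (σ j) (y i))
    chosen i =
      let c , c< , h = good-candidate 1≤n I (cluster i) (posOf (y i)) (InverseOn-injective (inverseOn (y i)))
                         (λ x → proj₁ (Δ⇒agree (σ x) (y i))) (λ {x} _ → proj₂ (proj₂ (Δ⇒agree (σ x) (y i)))) A B 2A≡B+1 A+124≤B
      in c , c< , ≤-trans h (*-monoʳ-≤ B (sum-mono n λ j _ → *-monoʳ-≤ (cluster i j) (proj₁ (proj₂ (Δ⇒agree (σ j) (y i))))))

    tuple : ℕ → ℕ
    tuple i = proj₁ (chosen i)

    tuple< : ∀ i → tuple i < n ^ 5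
    tuple< i = proj₁ (proj₂ (chosen i))

    -- Each input permutation lies in exactly one of the `k` clusters, that of its centre.
    regroup : ∀ (f : ℕ → ℕ → ℕ) → sumTo n (λ j → f j (centre j)) ≡ sumTo k (λ i → sumTo n (λ j → cluster i j * f j i))
    regroup f = trans (sum-cong n λ j _ → sym (sum-pick k (f j) (centre<k j))) (sum-swap n k (λ j i → cluster i j * f j i))

    total-tuple : A * total tuple ≤ B * Obj S Y
    total-tuple = begin
      A * total tuple                                                           ≤⟨ *-monoʳ-≤ A (sum-mono n λ j _ → minTo-≤ (λ i → D j (tuple i)) (k ∸ 1) (≤-pred (≤-trans (centre<k j) (≤-reflexive (sym (m+[n∸m]≡n 1≤k)))))) ⟩
      A * sumTo n (λ j → D j (tuple (centre j)))                                ≡⟨ cong (A *_) (regroup (λ j i → D j (tuple i))) ⟩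
      A * sumTo k (λ i → sumTo n (λ j → cluster i j * D j (tuple i)))           ≡⟨ sym (sum-* k A _) ⟩
      sumTo k (λ i → A * sumTo n (λ j → cluster i j * D j (tuple i)))           ≤⟨ sum-mono k (λ i _ → proj₂ (proj₂ (chosen i))) ⟩
      sumTo k (λ i → B * sumTo n (λ j → cluster i j * Δ (σ j) (y i)))           ≡⟨ sum-* k B _ ⟩
      B * sumTo k (λ i → sumTo n (λ j → cluster i j * Δ (σ j) (y i)))           ≡⟨ cong (B *_) (sym (regroup (λ j i → Δ (σ j) (y i)))) ⟩
      B * sumTo n (λ j → Δ (σ j) (y (centre j)))                                ≡⟨ cong (B *_) (trans (sum-cong n λ j _ → sym (centre-dist j)) (sym (Obj≡sum S Y))) ⟩
      B * Obj S Y                                                               ∎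
      where open ≤-Reasoning

-- The memory layout of sequences of permutations.

wordAt-++ˡ : ∀ {m n} (xs : Vec ℕ m) (ys : Vec ℕ n) {i} → i < m →
             wordAt (toList (xs Vec.++ ys)) i ≡ wordAt (toList xs) i
wordAt-++ˡ (x ∷ xs) ys {zero}  _         = refl
wordAt-++ˡ (x ∷ xs) ys {suc i} (s≤s i<m) = wordAt-++ˡ xs ys i<m

wordAt-++ʳ : ∀ {m n} (xs : Vec ℕ m) (ys : Vec ℕ n) i →
             wordAt (toList (xs Vec.++ ys)) (m + i) ≡ wordAt (toList ys) i
wordAt-++ʳ []       ys i = refl
wordAt-++ʳ (x ∷ xs) ys i = wordAt-++ʳ xs ys i

wordAt-lookup : ∀ {m} (xs : Vec ℕ m) i → wordAt (toList xs) (toℕ i) ≡ lookup xs i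
wordAt-lookup (x ∷ xs) zero    = refl
wordAt-lookup (x ∷ xs) (suc i) = wordAt-lookup xs i

wordAt-beyond : ∀ {m} (xs : Vec ℕ m) {i} → m ≤ i → wordAt (toList xs) i ≡ 0
wordAt-beyond []       _         = refl
wordAt-beyond (x ∷ xs) (s≤s m≤i) = wordAt-beyond xs m≤i

wordAt-oneLine : ∀ {d} (σ : Permutation′ d) {a} → a < d → wordAt (toList (Vec.map toℕ (oneLine σ))) a ≡ seqOf σ a
wordAt-oneLine σ a<d with toFin a<d
... | a , refl = begin
  wordAt (toList (Vec.map toℕ (oneLine σ))) (toℕ a)  ≡⟨ wordAt-lookup (Vec.map toℕ (oneLine σ)) a ⟩
  lookup (Vec.map toℕ (oneLine σ)) a                 ≡⟨ lookup-map a toℕ (oneLine σ) ⟩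
  toℕ (lookup (oneLine σ) a)                         ≡⟨ cong toℕ (lookup∘tabulate (σ ⟨$⟩ʳ_) a) ⟩
  toℕ (σ ⟨$⟩ʳ a)                                     ≡⟨ sym (seqOf-toℕ σ a) ⟩
  seqOf σ (toℕ a)                                    ∎
  where open ≡-Reasoning

symbols-at : ∀ {d n} (S : Vec (Permutation′ d) n) {j a} → j < n → a < d →
             wordAt (toList (symbols S)) (j * d + a) ≡ seqOf (nth Perm.id S j) a
symbols-at (σ ∷ S) {zero} _ a<d = trans (wordAt-++ˡ (Vec.map toℕ (oneLine σ)) (symbols S) a<d) (wordAt-oneLine σ a<d)
symbols-at {d} (σ ∷ S) {suc j} {a} (s≤s j<n) a<d = trans (cong (wordAt (toList (symbols (σ ∷ S)))) (+-assoc d (j * d) a))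
  (trans (wordAt-++ʳ (Vec.map toℕ (oneLine σ)) (symbols S) (j * d + a)) (symbols-at S j<n a<d))

symbols≤ : ∀ {d n} (S : Vec (Permutation′ d) n) a → wordAt (toList (symbols S)) a ≤ d
symbols≤ {d} {n} S a with a <? n * d
... | no ¬a< = ≤-trans (≤-reflexive (wordAt-beyond (symbols S) (≮⇒≥ ¬a<))) z≤n
... | yes a< with unpair n d a<
...   | j , i , j<n , i<d , refl = ≤-trans (≤-reflexive (symbols-at S j<n i<d)) (<⇒≤ (x< (inverseOn (nth Perm.id S j)) i<d))

nth-tabulate : ∀ {A : Set} {n} (a : A) (f : ℕ → A) {j} → j < n → nth a (tabulate {n = n} (f ∘ toℕ)) j ≡ f j
nth-tabulate {n = suc n} a f {zero}  _         = refl
nth-tabulate {n = suc n} a f {suc j} (s≤s j<n) = nth-tabulate a (f ∘ suc) j<n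

InverseOn-flip : ∀ {d x p} → InverseOn d x p → InverseOn d p x
InverseOn-flip I = record { x< = p< I ; p< = x< I ; x∘p = p∘x I ; p∘x = x∘p I }

search-inverse : ∀ {d} (τ : Permutation′ d) {q} → (∀ {a} → a < d → posOf τ a ≡ q a) → 1 ≤ d →
                 ∀ {p} → p < d → search q p (d ∸ 1) ≡ seqOf τ p
search-inverse {suc d} τ q≡ _ {p} p<d = trans
  (search-cong d λ a a≤d → sym (q≡ (s≤s a≤d)))
  (search-finds (InverseOn-flip (inverseOn τ)) d ≤-refl p<d (≤-pred (x< (inverseOn τ) p<d)))

ℚ-≤ : ∀ a b c o v → a * o ≤ b * v → a ≡ suc c → (ℤ.+ o ℚ./ 1) ℚ.≤ (ℤ.+ b ℚ./ suc c) ℚ.* (ℤ.+ v ℚ./ 1)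
ℚ-≤ a b c o v h refl = ℚ.toℚᵘ-cancel-≤ (ℚᵘ.≤-respˡ-≃ (ℚᵘ.≃-sym (ℚ.toℚᵘ-fromℚᵘ (ℚᵘ.mkℚᵘ (ℤ.+ o) 0)))
  (ℚᵘ.≤-respʳ-≃ (ℚᵘ.≃-sym (ℚᵘ.≃-trans (ℚ.toℚᵘ-homo-* (ℤ.+ b ℚ./ suc c) (ℤ.+ v ℚ./ 1))
     (ℚᵘ.*-cong (ℚ.toℚᵘ-fromℚᵘ (ℚᵘ.mkℚᵘ (ℤ.+ b) c)) (ℚ.toℚᵘ-fromℚᵘ (ℚᵘ.mkℚᵘ (ℤ.+ v) 0)))))
    (ℚᵘ.*≤* (ℤ.≤-trans (ℤ.≤-reflexive (sym (ℤ.pos-* o (suc (c * 1)))))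
      (ℤ.≤-trans (ℤ.+≤+ bound) (ℤ.≤-reflexive (trans (ℤ.pos-* (b * v) 1) (cong (ℤ._* ℤ.+ 1) (ℤ.pos-* b v)))))))))
  where
  bound : o * suc (c * 1) ≤ b * v * 1
  bound = ≤-trans (≤-reflexive (trans (cong (λ z → o * suc z) (*-identityʳ c)) (*-comm o (suc c))))
                  (≤-trans h (≤-reflexive (sym (*-identityʳ (b * v)))))

-- If `k` is at least `n`, the input itself is optimal: register 0 already holds its size and its
-- symbols already start at address 0.
program : Prog
program = ifz (reg 2 ⋖ reg 0) (1 ≔ lit 0) (3 ≔ (N# ⊗ D#) ⨾ main)

module Monomials (s : ℕ) (1≤s : 1 ≤ s) where

  _^≥_ : ℕ → ℕ → Set
  e ^≥ x = x ≤ s ^ e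

  one : ∀ {x} → x ≤ s → 1 ^≥ x
  one h = ≤-trans h (≤-reflexive (sym (*-identityʳ s)))

  times : ∀ {x y} a b → a ^≥ x → b ^≥ y → (a + b) ^≥ (x * y)
  times a b hx hy = ≤-trans (*-mono-≤ hx hy) (≤-reflexive (sym (^-distribˡ-+-* s a b)))

  weaken : ∀ {x} a b → T (a ≤ᵇ b) → a ^≥ x → b ^≥ x
  weaken a b a≤b h = ≤-trans h (^-monoʳ-≤ s {{>-nonZero 1≤s}} (≤ᵇ⇒≤ a b a≤b))

-- All quantities are monomials of degree at most 8 in `s`, well below 12. The strict inequality
-- between `V ^ K` and `2 ^ w` takes one more factor `s`, which is at least 2.
fits : ∀ {n d k w} K → 1 ≤ n → 1 ≤ d → 1 ≤ k → (n + d + k) ^ suc (12 * K) ≤ 2 ^ w → Fits n d k w ((n + d + k) ^ 12) K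
fits {n} {d} {k} {w} K 1≤n 1≤d 1≤k h = record
  { V^K<2^w = <-≤-trans (≤-<-trans (≤-reflexive (^-*-assoc s 12 K)) (^-monoʳ-< s 2≤s {12 * K} ≤-refl)) h
  ; 1≤n = 1≤n ; 1≤d = 1≤d
  ; 2≤V = weaken 1 12 _ (one 2≤s)
  ; n≤V = weaken 1 12 _ n¹
  ; d≤V = weaken 1 12 _ d¹
  ; k<V = ≤-trans k+1≤s (weaken 1 12 _ (one ≤-refl))
  ; dd≤V = weaken 2 12 _ (times 1 1 d¹ d¹)
  ; nd<V = ≤-<-trans (times 1 1 n¹ d+1¹) (^-monoʳ-< s 2≤s {2} {12} (≤ᵇ⇒≤ 3 12 _))
  ; nk≤V = weaken 2 12 _ (times 1 1 n¹ k¹)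
  ; kdd≤V = weaken 3 12 _ (times 2 1 (times 1 1 k¹ d¹) d¹)
  ; ndd≤V = weaken 3 12 _ (times 2 1 (times 1 1 n¹ d¹) d¹)
  ; n⁵≤V = weaken 5 12 _ n⁵
  ; n⁵dd≤V = weaken 7 12 _ (times 6 1 (times 5 1 n⁵ d¹) d¹)
  ; n⁵dQ≤V = weaken 8 12 _ (times 6 2 (times 5 1 n⁵ d¹) (≤-trans (≤-reflexive (trans (+-comm (d * d) d) (sym (*-suc d d)))) (times 1 1 d¹ d+1¹)))
  ; n⁶d²≤V = weaken 8 12 _ (times 7 1 (times 6 1 (times 5 1 n⁵ n¹) d+1¹) d+1¹)
  }
  where
  s = n + d + k
  n≤s : n ≤ s
  n≤s = ≤-trans (m≤m+n n d) (m≤m+n (n + d) k)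
  d+1≤s : suc d ≤ s
  d+1≤s = ≤-trans (+-monoˡ-≤ d 1≤n) (m≤m+n (n + d) k)
  k+1≤s : suc k ≤ s
  k+1≤s = +-monoˡ-≤ k (≤-trans 1≤n (m≤m+n n d))
  2≤s : 2 ≤ s
  2≤s = ≤-trans (s≤s 1≤d) d+1≤s
  open Monomials s (≤-trans (s≤s z≤n) 2≤s)
  n¹ : 1 ^≥ n
  n¹ = one n≤s
  d¹ : 1 ^≥ d
  d¹ = one (≤-trans (n≤1+n d) d+1≤s)
  k¹ : 1 ^≥ k
  k¹ = one (≤-trans (n≤1+n k) k+1≤s)
  d+1¹ : 1 ^≥ suc d
  d+1¹ = one d+1≤s
  n⁵ : 5 ^≥ (n ^ 5)
  n⁵ = ^-monoˡ-≤ 5 n≤s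

-- Running time.

module Time (K n d k : ℕ) (9≤K : 9 ≤ K) (2≤n : 2 ≤ n) (1≤d : 1 ≤ d) (1≤k : 1 ≤ k) (k≤n : k ≤ n) where

  private
    1≤n : 1 ≤ n
    1≤n = ≤-trans (s≤s z≤n) 2≤n

  M Z : ℕ
  M = n ^ 5 * d ^ 3
  Z = (n ^ 5) ^ k * (n ^ 7 * d)

  below-product : ∀ {x y z} → 1 ≤ y → x ≤ z → x ≤ z * y
  below-product {x} {y} {z} 1≤y x≤z = ≤-trans x≤z (≤-trans (≤-reflexive (sym (*-identityʳ z))) (*-monoʳ-≤ z 1≤y))

  n≤n⁵ : n ≤ n ^ 5
  n≤n⁵ = ≤-trans (≤-reflexive (sym (*-identityʳ n))) (^-monoʳ-≤ n {{>-nonZero 1≤n}} {1} {5} (s≤s z≤n))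

  cube : ∀ x y → x * y * (y * y) ≡ x * (y * (y * (y * 1)))
  cube = solve-∀

  n⁵dd≤M : n ^ 5 * d * d ≤ M
  n⁵dd≤M = ≤-trans (*-monoʳ-≤ (n ^ 5 * d) (below-product 1≤d ≤-refl)) (≤-reflexive (cube (n ^ 5) d))

  ndd≤M : n * d * d ≤ M
  ndd≤M = ≤-trans (*-monoˡ-≤ d (*-monoˡ-≤ d n≤n⁵)) n⁵dd≤M

  nd≤M : n * d ≤ M
  nd≤M = ≤-trans (below-product 1≤d ≤-refl) ndd≤M

  n≤M : n ≤ M
  n≤M = ≤-trans (below-product 1≤d ≤-refl) nd≤M

  1≤M : 1 ≤ M
  1≤M = ≤-trans 1≤n n≤M

  n⁵dQ≤2M : n ^ 5 * d * (d * d + d) ≤ M + M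
  n⁵dQ≤2M = ≤-trans (≤-reflexive (*-distribˡ-+ (n ^ 5 * d) (d * d) d)) (+-mono-≤ (≤-reflexive (cube (n ^ 5) d)) n⁵dd≤M)

  -- If `n ≤ d`, one factor `n` is replaced by `d`; otherwise one factor `d` by `n`.
  n⁶dd≤M+n⁷d : n ^ 5 * n * d * d ≤ M + n ^ 7 * d
  n⁶dd≤M+n⁷d with ≤-total n d
  ... | inj₁ n≤d = ≤-trans (*-monoˡ-≤ d (*-monoˡ-≤ d (*-monoʳ-≤ (n ^ 5) n≤d)))
                     (≤-trans (≤-reflexive (trans (*-assoc (n ^ 5 * d) d d) (cube (n ^ 5) d))) (m≤m+n M _))
  ... | inj₂ d≤n = ≤-trans (*-monoˡ-≤ d (*-monoʳ-≤ (n ^ 5 * n) d≤n)) (≤-trans (≤-reflexive (cong (_* d) (e (n ^ 5) n))) (m≤n+m _ M))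
    where
    e : ∀ x n → x * n * n ≡ n * (n * x)
    e = solve-∀

  n⁶ : n ^ 5 * n * suc d * suc d ≤ 4 * (M + n ^ 7 * d)
  n⁶ = ≤-trans (*-mono-≤ (*-monoʳ-≤ (n ^ 5 * n) sd≤2d) sd≤2d) (≤-trans (≤-reflexive (e (n ^ 5 * n) d)) (*-monoʳ-≤ 4 n⁶dd≤M+n⁷d))
    where
    sd≤2d : suc d ≤ 2 * d
    sd≤2d = +-mono-≤ 1≤d (≤-reflexive (sym (+-identityʳ d)))
    e : ∀ x d → x * (2 * d) * (2 * d) ≡ 4 * (x * d * d)
    e = solve-∀

  T-preparation T-initialise T-round T-write : ℕ
  T-preparation = K * suc (n * d) + (K * suc (n * d * d) + (K * suc (n ^ 5 * d * d) + (K * suc (n ^ 5 * d * (d * d + d)) +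
       (K * suc (n ^ 5 * d * d) + K * suc (n ^ 5 * n * suc d * suc d)))))
  T-initialise = K * suc k + (K * suc k + (K * 2 + K * 2))
  T-round = K * suc (n * k) + (K * suc n + (K * suc k + (K * 2 + (K * suc (suc k) + (K * suc k + K * 2)))))
  T-write = (K * suc (k * d * d) + K * suc (k * d)) + 4

  module _ (u v : ℕ) (1≤u : 1 ≤ u) where
    once : ∀ {x} → x ≤ v * u → K * suc x ≤ K * (suc v * u)
    once x≤ = *-monoʳ-≤ K (+-mono-≤ 1≤u x≤)

  single : ∀ {x u} → x ≤ u → x ≤ 1 * u
  single {u = u} h = ≤-trans h (≤-reflexive (sym (*-identityˡ u)))

  preparation≤ : T-preparation ≤ K * (16 * M + 4 * (n ^ 7 * d))
  preparation≤ = ≤-trans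
    (+-mono-≤ (once M 1 1≤M (single nd≤M)) (+-mono-≤ (once M 1 1≤M (single ndd≤M)) (+-mono-≤ (once M 1 1≤M (single n⁵dd≤M))
    (+-mono-≤ (once M 2 1≤M (≤-trans n⁵dQ≤2M (≤-reflexive (cong (M +_) (sym (+-identityʳ M))))))
    (+-mono-≤ (once M 1 1≤M (single n⁵dd≤M)) (*-monoʳ-≤ K (+-mono-≤ 1≤M n⁶)))))))
    (≤-reflexive (e K M (n ^ 7 * d)))
    where
    e : ∀ K M H → K * (2 * M) + (K * (2 * M) + (K * (2 * M) + (K * (3 * M) + (K * (2 * M) + K * (M + 4 * (M + H)))))) ≡ K * (16 * M + 4 * H)
    e = solve-∀

  k≤M : k ≤ 1 * M
  k≤M = single (≤-trans k≤n n≤M)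

  initialise≤ : T-initialise ≤ K * (8 * M)
  initialise≤ = ≤-trans
    (+-mono-≤ (once M 1 1≤M k≤M) (+-mono-≤ (once M 1 1≤M k≤M) (+-mono-≤ (once M 1 1≤M (single 1≤M)) (once M 1 1≤M (single 1≤M)))))
    (≤-reflexive (e K M))
    where
    e : ∀ K M → K * (2 * M) + (K * (2 * M) + (K * (2 * M) + K * (2 * M))) ≡ K * (8 * M)
    e = solve-∀

  round≤ : T-round + 9 ≤ K * (16 * (n * n))
  round≤ = ≤-trans (+-mono-≤
    (+-mono-≤ (once S 1 1≤S (single (*-monoʳ-≤ n k≤n))) (+-mono-≤ (once S 1 1≤S (single n≤S)) (+-mono-≤ (once S 1 1≤S (single k≤S))
    (+-mono-≤ (once S 1 1≤S (single 1≤S)) (+-mono-≤ (once S 2 1≤S (+-mono-≤ 1≤S (single k≤S)))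
    (+-mono-≤ (once S 1 1≤S (single k≤S)) (once S 1 1≤S (single 1≤S))))))))
    (≤-trans 9≤K (below-product 1≤S ≤-refl)))
    (≤-reflexive (e K S))
    where
    S = n * n
    n≤S : n ≤ S
    n≤S = below-product 1≤n ≤-refl
    1≤S : 1 ≤ S
    1≤S = ≤-trans 1≤n n≤S
    k≤S : k ≤ S
    k≤S = ≤-trans k≤n n≤S
    e : ∀ K S → K * (2 * S) + (K * (2 * S) + (K * (2 * S) + (K * (2 * S) + (K * (3 * S) + (K * (2 * S) + K * (2 * S)))))) + K * S ≡ K * (16 * S)
    e = solve-∀

  write≤ : T-write ≤ K * (4 * M) + 4 * M
  write≤ = ≤-trans (+-mono-≤ (+-mono-≤ (once M 1 1≤M (single (≤-trans (*-monoˡ-≤ d (*-monoˡ-≤ d k≤n)) ndd≤M)))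
                                        (once M 1 1≤M (single (≤-trans (*-monoˡ-≤ d k≤n) nd≤M)))) (*-monoʳ-≤ 4 1≤M))
    (≤-reflexive (e K M))
    where
    e : ∀ K M → K * (2 * M) + K * (2 * M) + 4 * M ≡ K * (4 * M) + 4 * M
    e = solve-∀

  1≤n⁵ᵏ : 1 ≤ (n ^ 5) ^ k
  1≤n⁵ᵏ = m^n>0 (n ^ 5) {{>-nonZero (≤-trans 1≤n n≤n⁵)}} k

  n⁷d≤Z : n ^ 7 * d ≤ Z
  n⁷d≤Z = ≤-trans (≤-reflexive (sym (*-identityˡ (n ^ 7 * d)))) (*-monoˡ-≤ (n ^ 7 * d) 1≤n⁵ᵏ)

  nn≤n⁷d : n * n ≤ n ^ 7 * d
  nn≤n⁷d = below-product 1≤d (≤-trans (≤-reflexive (cong (n *_) (sym (*-identityʳ n)))) (^-monoʳ-≤ n {{>-nonZero 1≤n}} {2} {7} (s≤s (s≤s z≤n))))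

  main≤ : 8 + (T-preparation + (T-initialise + (((n ^ 5) ^ k * (T-round + 9) + 9) + T-write))) ≤ (20 * K) * Z + (28 * K + 21) * M
  main≤ = ≤-trans
    (+-mono-≤ (*-monoʳ-≤ 8 1≤M) (+-mono-≤ (≤-trans preparation≤ (*-monoʳ-≤ K (+-monoʳ-≤ (16 * M) (*-monoʳ-≤ 4 n⁷d≤Z))))
      (+-mono-≤ initialise≤ (+-mono-≤ (+-mono-≤ rounds (*-monoʳ-≤ 9 1≤M)) write≤))))
    (≤-reflexive (e K M Z))
    where
    e₁ : ∀ x K s → x * (K * (16 * s)) ≡ K * (16 * (x * s))
    e₁ = solve-∀
    rounds : (n ^ 5) ^ k * (T-round + 9) ≤ K * (16 * Z)
    rounds = ≤-trans (*-monoʳ-≤ ((n ^ 5) ^ k) round≤) (≤-trans (≤-reflexive (e₁ ((n ^ 5) ^ k) K (n * n)))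
      (*-monoʳ-≤ K (*-monoʳ-≤ 16 (*-monoʳ-≤ ((n ^ 5) ^ k) nn≤n⁷d))))
    e : ∀ K M Z → 8 * M + (K * (16 * M + 4 * Z) + (K * (8 * M) + ((K * (16 * Z) + 9 * M) + (K * (4 * M) + 4 * M)))) ≡ (20 * K) * Z + (28 * K + 21) * M
    e = solve-∀

  x≤n^x : ∀ x → x ≤ n ^ x
  x≤n^x zero    = z≤n
  x≤n^x (suc x) = ≤-trans (+-mono-≤ (m^n>0 n {{>-nonZero 1≤n}} x) (x≤n^x x))
    (≤-trans (≤-reflexive (cong (n ^ x +_) (sym (+-identityʳ (n ^ x))))) (*-monoˡ-≤ (n ^ x) 2≤n))

  -- The first summand of the time bound has no constant factor, so `20 * K` moves into the
  -- exponent, as `n` is at least 2; since `k` is at least 1, all exponents become multiples of `k`.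
  Z≤ : (20 * K) * Z ≤ n ^ ((12 + 20 * K) * k) * d
  Z≤ = begin
    (20 * K) * Z                                       ≤⟨ *-monoˡ-≤ Z (x≤n^x (20 * K)) ⟩
    n ^ (20 * K) * ((n ^ 5) ^ k * (n ^ 7 * d))         ≡⟨ cong (λ z → n ^ (20 * K) * (z * (n ^ 7 * d))) (^-*-assoc n 5 k) ⟩
    n ^ (20 * K) * (n ^ (5 * k) * (n ^ 7 * d))         ≡⟨ assoc₃ (n ^ (20 * K)) (n ^ (5 * k)) (n ^ 7) d ⟩
    n ^ (20 * K) * n ^ (5 * k) * n ^ 7 * d             ≡⟨ cong (_* d) (trans (cong (_* n ^ 7) (sym (^-distribˡ-+-* n (20 * K) (5 * k)))) (sym (^-distribˡ-+-* n (20 * K + 5 * k) 7))) ⟩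
    n ^ (20 * K + 5 * k + 7) * d                       ≤⟨ *-monoˡ-≤ d (^-monoʳ-≤ n {{>-nonZero 1≤n}} exponent) ⟩
    n ^ ((12 + 20 * K) * k) * d                        ∎
    where
    open ≤-Reasoning
    assoc₃ : ∀ a b c d → a * (b * (c * d)) ≡ a * b * c * d
    assoc₃ = solve-∀
    e : ∀ J k → J * k + 5 * k + 7 * k ≡ (12 + J) * k
    e = solve-∀
    exponent : 20 * K + 5 * k + 7 ≤ (12 + 20 * K) * k
    exponent = ≤-trans (+-mono-≤ {20 * K + 5 * k} {20 * K * k + 5 * k} {7} {7 * k}
      (+-monoˡ-≤ (5 * k) (below-product {20 * K} 1≤k ≤-refl)) (below-product {7} 1≤k ≤-refl)) (≤-reflexive (e (20 * K) k))

-- Assembling the theorem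

open import Data.Integer using (+_)
open import Data.Rational using (_/_)

-- The bound on the weights is abstract, lest it be unfolded in exponents.
abstract
  K₀ : ℕ
  K₀ = 2000

  2000≤K₀ : 2000 ≤ K₀
  2000≤K₀ = ≤-refl

9≤K₀ : 9 ≤ K₀
9≤K₀ = ≤-trans (≤ᵇ⇒≤ 9 2000 _) 2000≤K₀

-- The exponent from `Z≤`, the coefficient from `main≤`, and the word-size exponent that `fits` asks
-- for.
a₀ b₀ c₀ : ℕ
a₀ = 12 + 20 * K₀
b₀ = 28 * K₀ + 21
c₀ = suc (12 * K₀)

Result : ∀ {n d} → ℕ → Vec (Permutation′ d) n → ℕ → Set
Result {n} {d} k S w = ∃[ t ] ∃[ s ] Run w program (input S k) t s ×
  t ≤ n ^ (a₀ * k) * (d * ⌈log₂ d ⌉) + b₀ * (n ^ 5 * d ^ 3) ×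
  ∃[ m ] Σ (Vec (Permutation′ d) (suc m)) λ Y → Outputs s Y × IsApproxMedian (+ 1999 / 1000) S k Y

approximate : ∀ {n d k m} (S : Vec (Permutation′ d) n) (Y : Vec (Permutation′ d) (suc m)) → suc m ≤ k →
  (∀ {m′} (Y′ : Vec (Permutation′ d) (suc m′)) → suc m′ ≤ k → 1000 * Obj S Y ≤ 1999 * Obj S Y′) →
  IsApproxMedian (+ 1999 / 1000) S k Y
approximate {d = d} {k} {m} S Y m<k close = conclude (optimum S k (≤-trans (s≤s z≤n) m<k))
  where
  conclude : (∃[ v ] IsOPT S k v) → IsApproxMedian (+ 1999 / 1000) S k Y
  conclude (v , opt@((m′ , Y′ , m′< , Y′≡) , _)) = m<k , v , opt ,
    ℚ-≤ 1000 1999 999 (Obj S Y) v (subst (λ z → 1000 * Obj S Y ≤ 1999 * z) Y′≡ (close Y′ m′<)) refl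

wrap-zero : ∀ w → wrap w 0 ≡ 0
wrap-zero w = m<n⇒m%n≡m {{m^n≢0 2 w}} (m^n>0 2 w)

module _ {n d} (S : Vec (Permutation′ d) (suc n)) where

  Obj-self : Obj S S ≡ 0
  Obj-self = n≤0⇒n≡0 (≤-trans (≤-reflexive (Obj≡sum S S)) (≤-trans (sum-mono (suc n) zero-dist) (≤-reflexive (sum-zero (suc n)))))
    where
    zero-dist : ∀ j → j < suc n → dist (nth Perm.id S j) S ≤ 0
    zero-dist j j< = at (toFin j<)
      where
      at : (∃[ i ] toℕ i ≡ j) → dist (nth Perm.id S j) S ≤ 0
      at (i , refl) = ≤-trans (dist≤ (nth Perm.id S (toℕ i)) S i)
        (≤-trans (≤-reflexive (cong (λ x → Δ x (lookup S i)) (nth-lookup Perm.id S i))) (Δ-minimal (lookup S i) (lookup S i) {0} refl))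

  return-input : ∀ {k} w → 1 ≤ d → suc n ≤ k → Result k S w
  return-input {k} w 1≤d n<k = 6 , setReg 1 (wrap w 0) (input S k) ,
    if-zero (trans (cong (λ b → wrap w (𝟙 b)) (<ᵇ-false n<k)) (wrap-zero w)) assign ,
    ≤-trans 6≤ (m≤n+m _ _) ,
    n , S , (refl , λ i → trans (cong (λ z → wordAt (toList (symbols S)) (z + toℕ i)) (wrap-zero w)) (wordAt-lookup (symbols S) i)) ,
    approximate S S n<k λ _ _ → ≤-trans (≤-reflexive (trans (cong (1000 *_) Obj-self) (*-zeroʳ 1000))) z≤n
    where
    6≤ : 6 ≤ b₀ * (suc n ^ 5 * d ^ 3)
    6≤ = *-mono-≤ {6} {b₀} {1} (≤-trans (≤ᵇ⇒≤ 6 21 _) (m≤n+m 21 (28 * K₀)))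
                  (*-mono-≤ {1} (m^n>0 (suc n) 5) (m^n>0 d {{>-nonZero 1≤d}} 3))

module _ {n d k} (S : Vec (Permutation′ d) n) (w : ℕ) (2≤n : 2 ≤ n) (2≤d : 2 ≤ d) (k<n : suc k < n)
         (wide : (n + d + suc k) ^ c₀ ≤ 2 ^ w) where

  private
    1≤n : 1 ≤ n
    1≤n = ≤-trans (s≤s z≤n) 2≤n
    1≤d : 1 ≤ d
    1≤d = ≤-trans (s≤s z≤n) 2≤d
    1≤k : 1 ≤ suc k
    1≤k = s≤s z≤n
    V = (n + d + suc k) ^ 12
    F : Fits n d (suc k) w V K₀
    F = fits K₀ 1≤n 1≤d 1≤k wide

  open Fits F using (V^K<2^w; 2≤V; n≤V; d≤V; k≤V; nd≤V)
  open Machine n d (suc k) w V K₀ F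
  open Solutions S 1≤n (suc k) 1≤k

  private
    low : ℕ → ℕ
    low = wordAt (toList (symbols S))

    open module C = Correctness n d (suc k) w V K₀ F 1≤k (<⇒≤ k<n) 2000≤K₀ X P I low (symbols-at S)
      using (Solution; main-run; T-main; St; Γ₀)

  small-word : ∀ {a} → a ≤ V → wrap w a ≡ a
  small-word a≤V = m<n⇒m%n≡m {{m^n≢0 2 w}} (≤-<-trans (≤-trans a≤V (≤-trans (≤-reflexive (sym (*-identityʳ V)))
    (^-monoʳ-≤ V {{>-nonZero (≤-trans (s≤s z≤n) 2≤V)}} (≤-trans (s≤s z≤n) 9≤K₀)))) V^K<2^w)

  start : Store
  start = setReg 3 (n * d) (input S (suc k))

  start-Inv : Inv start
  start-Inv = record { r0 = refl ; r1 = refl ; r2 = refl ; r3 = refl ; regs≤ = regs≤ ; mem≤ = λ a → ≤-trans (symbols≤ S a) d≤V }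
    where
    regs≤ : ∀ r → regs start r ≤ V
    regs≤ 0 = n≤V
    regs≤ 1 = d≤V
    regs≤ 2 = k≤V
    regs≤ 3 = nd≤V
    regs≤ (suc (suc (suc (suc r)))) = z≤n

  start-St : St Γ₀ start
  start-St = start-Inv , (λ _ _ ()) , λ _ → refl

  module _ (sol : Solution main start T-main) where
    open C.Solution sol

    Y : Vec (Permutation′ d) (suc k)
    Y = medians best

    outputs : Outputs s′ Y
    outputs = size , λ i → at i (unpair (suc k) d (Fin.toℕ<n i))
      where
      at : ∀ i → (∃[ q ] ∃[ p ] q < suc k × p < d × toℕ i ≡ q * d + p) → mem s′ (regs s′ 1 + toℕ i) ≡ lookup (symbols Y) i
      at i (q , p , q< , p< , i≡) = begin
        mem s′ (regs s′ 1 + toℕ i)                    ≡⟨ cong₂ (λ z i → mem s′ (z + i)) zero-start i≡ ⟩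
        mem s′ (q * d + p)                            ≡⟨ out q< p< ⟩
        search (place (best q)) p (d ∸ 1)             ≡⟨ search-inverse (candidate (best q)) (candidate-pos (best q)) 1≤d p< ⟩
        seqOf (candidate (best q)) p                  ≡⟨ cong (λ τ → seqOf τ p) (sym (nth-tabulate Perm.id (λ i → candidate (best i)) q<)) ⟩
        seqOf (nth Perm.id Y q) p                     ≡⟨ sym (symbols-at Y q< p<) ⟩
        wordAt (toList (symbols Y)) (q * d + p)       ≡⟨ cong (wordAt (toList (symbols Y))) (sym i≡) ⟩
        wordAt (toList (symbols Y)) (toℕ i)           ≡⟨ wordAt-lookup (symbols Y) i ⟩
        lookup (symbols Y) i                          ∎
        where
        open ≡-Reasoning
        open Candidates n d X P using (place)

    -- The tuple found costs no more than the tuple of candidates that matches `Y′`, which is within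
    -- the factor `B` over `A`.
    close : ∀ A B → 2 * A ≡ B + 1 → A + 124 ≤ B →
            ∀ {m} (Y′ : Vec (Permutation′ d) (suc m)) → suc m ≤ suc k → A * Obj S Y ≤ B * Obj S Y′
    close A B 2A≡B+1 A+124≤B Y′ m< = ≤-trans
      (*-monoʳ-≤ A (≤-trans (Obj≤total best) (opt (λ {i} _ → tuple< A B 2A≡B+1 A+124≤B Y′ m< i))))
      (total-tuple A B 2A≡B+1 A+124≤B Y′ m<)

    1≤log : 1 ≤ ⌈log₂ d ⌉
    1≤log = ≤-trans (≤-reflexive (sym (⌈log₂2^n⌉≡n 1))) (⌈log₂⌉-mono-≤ 2≤d)

    -- The 8 steps are the test of `k` against `n` and the computation of `n * d`, 4 each.
    total-time : 8 + t ≤ n ^ (a₀ * suc k) * (d * ⌈log₂ d ⌉) + b₀ * (n ^ 5 * d ^ 3)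
    total-time = ≤-trans (+-monoʳ-≤ 8 t≤) (≤-trans main≤ (+-monoˡ-≤ (b₀ * (n ^ 5 * d ^ 3)) (≤-trans Z≤
      (*-monoʳ-≤ (n ^ (a₀ * suc k)) (≤-trans (≤-reflexive (sym (*-identityʳ d))) (*-monoʳ-≤ d 1≤log))))))
      where open Time K₀ n d (suc k) 9≤K₀ 2≤n 1≤d 1≤k (<⇒≤ k<n)

    solve : Result (suc k) S w
    solve = 4 + (4 + t) , s′ ,
      if-nonzero (λ z → 1≢0 (trans (sym (trans (cong (λ b → wrap w (𝟙 b)) (<ᵇ-true k<n)) (small-word (≤-trans (s≤s z≤n) 2≤V)))) z))
        (seq (subst (λ v → Run w (3 ≔ (N# ⊗ D#)) (input S (suc k)) 4 (setReg 3 v (input S (suc k)))) (small-word nd≤V) assign) run) ,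
      total-time , k , Y , outputs , approximate S Y ≤-refl (close 1000 1999 refl (≤ᵇ⇒≤ 1124 1999 _))

  compute : Result (suc k) S w
  compute = solve (main-run start-St)

-- One symbol has only one permutation. For `d` equal to 1 the logarithm, and with it the first
-- summand of the time bound, would vanish.
two-symbols : ∀ {n d} (S : Vec (Permutation′ d) n) → Distinct S → 2 ≤ n → 1 ≤ d → 2 ≤ d
two-symbols {d = suc (suc d)} S _ _ _ = s≤s (s≤s z≤n)
two-symbols {d = suc zero} (σ ∷ τ ∷ S) ((σ≉τ ∷ _) ∷ _) _ _ = contradiction (λ i → Fin-1 (σ Perm.⟨$⟩ʳ i) (τ Perm.⟨$⟩ʳ i)) σ≉τ
  where
  Fin-1 : ∀ (i j : Fin 1) → i ≡ j
  Fin-1 zero zero = refl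
two-symbols {d = suc zero} (_ ∷ []) _ (s≤s ())

theorem3p4 : Σ Prog λ P → ∃[ a ] ∃[ b ] ∃[ c ]
    ∀ (n d k : ℕ) → 1 ≤ n → 1 ≤ d → 1 ≤ k →
    ∀ (S : Vec (Permutation′ d) n) → Distinct S →
    ∀ (w : ℕ) → (n + d + k) ^ c ≤ 2 ^ w →
    ∃[ t ] ∃[ s ] Run w P (input S k) t s ×
    t ≤ n ^ (a * k) * (d * ⌈log₂ d ⌉) + b * (n ^ 5 * d ^ 3) ×
    ∃[ m ] Σ (Vec (Permutation′ d) (suc m)) λ Y →
    Outputs s Y × IsApproxMedian (+ 1999 / 1000) S k Y
theorem3p4 = program , a₀ , b₀ , c₀ , run
  where
  run : ∀ n d k → 1 ≤ n → 1 ≤ d → 1 ≤ k → ∀ (S : Vec (Permutation′ d) n) → Distinct S →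
        ∀ w → (n + d + k) ^ c₀ ≤ 2 ^ w → Result k S w
  run (suc n) d (suc k) _ 1≤d _ S distinct w wide = cases (suc k <? suc n)
    where
    cases : Dec (suc k < suc n) → Result (suc k) S w
    cases (no k≮n)  = return-input S w 1≤d (≮⇒≥ k≮n)
    cases (yes k<n) = compute S w 2≤n (two-symbols S distinct 2≤n 1≤d) k<n wide
      where
      2≤n : 2 ≤ suc n
      2≤n = ≤-trans (s≤s (s≤s z≤n)) k<n
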